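{- Let $G$ be an antiferromagnetic weighted graph and let $\mathcal{K}$ be the class of all complete graphs. If $H$ is a $\mathcal{K}$-blow-up of a bipartite graph $F$, then \[ \hom(H,G)^2\le \hom(H\times K_2,G). \]
   Context: A weighted graph $G$ on a finite vertex set is given by a symmetric function $G:V(G)\times V(G)\to\mathbb{R}_{\ge 0}$ (equivalently a symmetric nonnegative matrix); loops (positive diagonal entries) are allowed. $G$ is antiferromagnetic if this symmetric matrix has at most one positive eigenvalue, counted with multiplicity. For a graph $H$, $\hom(H,G)=\sum_{\phi:V(H)\to V(G)}\prod_{uv\in E(H)}G(\phi(u),\phi(v))$. The tensor product $H\times K_2$ has vertex set $V(H)\times\{1,2\}$, with $(u,i)$ adjacent to $(v,j)$ iff $uv\in E(H)$ and $i\ne j$. For a class $\mathcal{H}$ of graphs and a graph $F$ on vertices $v_1,\dots,v_k$, an $\mathcal{H}$-blow-up of $F$ is obtained by choosing $H_1,\dots,H_k\in\mathcal{H}$, taking their disjoint union, and adding all edges between $V(H_i)$ and $V(H_j)$ whenever $v_iv_j\in E(F)$. -}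

module Defs where

open import Algebra.Bundles using (CommutativeRing)
import Algebra.Properties.CommutativeMonoid.Sum as FiniteSum
open import Data.Bool.Base using (Bool; if_then_else_)
open import Data.Fin.Base using (Fin; finToFun; quotient; remainder)
import Data.Fin.Properties as Fin
open import Data.Nat.Base as ℕ using (ℕ)
open import Data.Product.Base using (Σ-syntax; ∃; ∃-syntax; _×_; _,_)
open import Data.Vec.Functional using (Vector)
open import Function.Bundles using (_⇔_; _⤖_; Bijection)
open import Level using (0ℓ)
open import Relation.Binary.Core using (Rel)
open import Relation.Binary.Definitions using (Decidable; Symmetric)
open import Relation.Binary.PropositionalEquality.Core using (_≡_; _≢_; ≢-sym; refl)
open import Relation.Binary.Structures using (IsDecTotalOrder)
open import Relation.Nullary.Decidable using (does; ¬?; _×-dec_)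
open import Relation.Nullary.Negation.Core using (¬_)
open import Relation.Unary using (Pred)

-- The standard library has no real numbers.  They are axiomatised, as usual in
-- classical analysis, as a Dedekind-complete totally ordered field; these
-- axioms are categorical, so quantifying over all models is speaking about ℝ.
record CompleteOrderedField : Set₁ where
  field
    commutativeRing : CommutativeRing 0ℓ 0ℓ

  open CommutativeRing commutativeRing public

  field
    _≤_             : Rel Carrier 0ℓ
    isDecTotalOrder : IsDecTotalOrder _≈_ _≤_
    0≉1             : ¬ (0# ≈ 1#)
    inverse         : ∀ x → ¬ (x ≈ 0#) → ∃[ y ] (x * y ≈ 1#)
    +-monoˡ-≤       : ∀ z {x y} → x ≤ y → (x + z) ≤ (y + z)
    *-nonNegative   : ∀ {x y} → 0# ≤ x → 0# ≤ y → 0# ≤ (x * y)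

  UpperBound : Pred Carrier 0ℓ → Pred Carrier 0ℓ
  UpperBound S b = ∀ x → S x → x ≤ b

  field
    supremum : ∀ (S : Pred Carrier 0ℓ) → ∃ S → ∃ (UpperBound S) →
               ∃[ s ] (UpperBound S s × (∀ b → UpperBound S b → s ≤ b))

  infix 4 _≤_ _<_

  _<_ : Rel Carrier 0ℓ
  x < y = x ≤ y × ¬ (x ≈ y)

  open FiniteSum +-commutativeMonoid public using () renaming (sum to ∑)
  open FiniteSum *-commutativeMonoid public using () renaming (sum to ∏)

-- Finite simple graphs, with vertices labelled by an initial segment of ℕ.
record Graph : Set₁ where
  field
    order    : ℕ
    Adj      : Rel (Fin order) 0ℓ
    adj?     : Decidable Adj
    adj-sym  : Symmetric Adj
    loopless : ∀ u → ¬ Adj u u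

open Graph public

Vertex : Graph → Set
Vertex H = Fin (order H)

GraphClass : Set₁
GraphClass = Graph → Set

Complete : GraphClass
Complete H = ∀ u v → u ≢ v → Adj H u v

K : ℕ → Graph
K n = record
  { order    = n
  ; Adj      = _≢_
  ; adj?     = λ u v → ¬? (u Fin.≟ v)
  ; adj-sym  = ≢-sym
  ; loopless = λ _ u≢u → u≢u refl
  }

Bipartite : Graph → Set
Bipartite F = Σ[ side ∈ (Vertex F → Bool) ] (∀ u v → Adj F u v → side u ≢ side v)

-- The vertex labelled p stands for the pair (quotient p , remainder p), via the
-- bijection Fin (m * n) ↔ Fin m × Fin n.
_⊗_ : Graph → Graph → Graph
H ⊗ L = record
  { order    = order H ℕ.* order L
  ; Adj      = λ p q → Adj H (fst p) (fst q) × Adj L (snd p) (snd q)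
  ; adj?     = λ p q → adj? H (fst p) (fst q) ×-dec adj? L (snd p) (snd q)
  ; adj-sym  = λ (a , b) → adj-sym H a , adj-sym L b
  ; loopless = λ p (a , _) → loopless H (fst p) a
  }
  where
  fst : Fin (order H ℕ.* order L) → Vertex H
  fst = quotient (order L)

  snd : Fin (order H ℕ.* order L) → Vertex L
  snd = remainder {order H} (order L)

data BlowUpAdj (F : Graph) (parts : Vertex F → Graph) :
               Rel (Σ[ i ∈ Vertex F ] Vertex (parts i)) 0ℓ where
  within  : ∀ {i a b} → Adj (parts i) a b → BlowUpAdj F parts (i , a) (i , b)
  between : ∀ {i j a b} → Adj F i j → BlowUpAdj F parts (i , a) (j , b)

-- H is, up to isomorphism, obtained from the disjoint union of members of 𝓗
-- indexed by the vertices of F by joining the parts adjacent in F.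
record IsBlowUp (𝓗 : GraphClass) (F H : Graph) : Set₁ where
  field
    parts    : Vertex F → Graph
    parts∈𝓗 : ∀ i → 𝓗 (parts i)
    vertices : (Σ[ i ∈ Vertex F ] Vertex (parts i)) ⤖ Vertex H
    edges    : ∀ x y → BlowUpAdj F parts x y ⇔
                       Adj H (Bijection.to vertices x) (Bijection.to vertices y)

module _ (ℝ : CompleteOrderedField) where
  open CompleteOrderedField ℝ using
    (Carrier; _≈_; _≤_; _<_; _*_; 0#; 1#; ∑; ∏)

  record WeightedGraph : Set where
    field
      order  : ℕ
      weight : Fin order → Fin order → Carrier
      symm   : ∀ i j → weight i j ≈ weight j i
      nonNeg : ∀ i j → 0# ≤ weight i j

  module _ (G : WeightedGraph) where
    open WeightedGraph G renaming (order to n)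

    record IsEigenvector (μ : Carrier) (v : Vector Carrier n) : Set where
      field
        nonZero  : ¬ (∀ i → v i ≈ 0#)
        equation : ∀ i → ∑ (λ j → weight i j * v j) ≈ μ * v i

    -- At most one positive eigenvalue counted with multiplicity: there is at
    -- most one positive value, and its eigenspace is at most one-dimensional.
    -- (The matrix is symmetric, so geometric and algebraic multiplicities agree.)
    record Antiferromagnetic : Set where
      field
        unique : ∀ {μ ν v w} → 0# < μ → 0# < ν →
                 IsEigenvector μ v → IsEigenvector ν w → μ ≈ ν
        simple : ∀ {μ v w} → 0# < μ →
                 IsEigenvector μ v → IsEigenvector μ w →
                 ∃[ c ] (∀ i → w i ≈ c * v i)

  -- `finToFun` enumerates all maps V(H) → V(G), each exactly once; requiring
  -- u < v makes every edge of H contribute a single factor.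
  hom : Graph → WeightedGraph → Carrier
  hom H G = ∑ {n ℕ.^ order H} (λ k → homWeight (finToFun k))
    where
    open WeightedGraph G renaming (order to n)

    homWeight : (Vertex H → Fin n) → Carrier
    homWeight φ = ∏ (λ u → ∏ (λ v →
      if does (u Fin.<? v ×-dec adj? H u v) then weight (φ u) (φ v) else 1#))

{-# OPTIONS --safe #-}
module Submission where

open import Defs
import Algebra.Properties.AbelianGroup
import Algebra.Properties.CommutativeMonoid.Sum
import Algebra.Properties.Monoid.Mult
import Algebra.Properties.Ring
import Algebra.Properties.Semiring.Mult
import Algebra.Properties.Semiring.Sum
import Algebra.Solver.Ring
open import Algebra.Solver.Ring.AlmostCommutativeRing using (fromCommutativeRing; _-Raw-AlmostCommutative⟶_)
open import Data.Bool.Base using (Bool; true; false; if_then_else_; _∧_; _∨_)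
open import Data.Empty using (⊥; ⊥-elim)
open import Data.Fin.Base using (Fin; zero; suc; _↑ˡ_; _↑ʳ_; combine; remQuot; quotient; remainder; finToFun)
import Data.Fin.Properties as Fin
open import Data.Integer.Base as ℤ using (ℤ; +_; -[1+_])
import Data.Integer.Properties as ℤ
open import Data.List.Base using (List; []; _∷_; map; _++_; replicate; length; allFin; tabulate)
open import Data.List.Membership.Propositional using (_∈_)
open import Data.List.Membership.Propositional.Properties using (∈-allFin)
open import Data.List.Properties using (++-identityʳ; map-tabulate)
open import Data.List.Relation.Binary.Permutation.Propositional as ↭ using (_↭_)
import Data.List.Relation.Binary.Permutation.Propositional.Properties as ↭
open import Data.List.Relation.Unary.All as All using (All; []; _∷_)
open import Data.List.Relation.Unary.AllPairs as AllPairs using (AllPairs; []; _∷_)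
open import Data.List.Relation.Unary.Any using (here; there)
open import Data.List.Relation.Unary.Unique.Propositional.Properties using (allFin⁺)
open import Data.Maybe.Base using (Maybe; just; nothing)
open import Data.Nat.Base as ℕ using (ℕ; zero; suc)
import Data.Nat.Properties as ℕ
open import Data.Product.Base using (∃; ∃-syntax; _×_; _,_; proj₁; proj₂; uncurry; swap)
open import Data.Sum.Base using (_⊎_; inj₁; inj₂)
open import Data.Vec.Functional using (Vector) renaming (_∷_ to _∷ᵛ_)
open import Function.Base using (_∘_; id; const)
open import Function.Bundles using (Bijection; Equivalence; mk⇔)
open import Level using (0ℓ)
open import Relation.Binary.Bundles using (Poset)
import Relation.Binary.PropositionalEquality as ≡
open import Relation.Binary.PropositionalEquality using (_≡_; _≢_)
import Relation.Binary.Reasoning.PartialOrder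
import Relation.Binary.Reasoning.Setoid
open import Relation.Binary.Structures using (IsDecTotalOrder)
open import Relation.Nullary using (¬_; Dec; yes; no; does)
open import Relation.Nullary.Decidable using (dec-true; dec-false; does-⇔; ¬?; _×-dec_)
open import Relation.Unary using (Pred; Decidable)

-- Summing over pairs of maps (φ, ψ) and exchanging φ with ψ on one side of F,
-- hom(H × K₂, G) differs from hom(H, G)² only inside the cliques of H, where
-- G(φu,φv) G(ψu,ψv) becomes G(φu,ψv) G(ψu,φv).  So the cliques can be treated one
-- at a time: with all other vertices fixed, every vertex of a clique carries the
-- same two weights f and g, which are positive once G is perturbed to be positive.
-- If Z(h₁,…,hₖ) denotes the partition function of Kₖ with vertex weights hᵢ, the
-- replacement inside a k-clique increases the sum, by induction on k, because
--   Z(f,…,f) Z(g,…,g) ≤ Z(g,f,…,f) Z(f,g,…,g).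
-- This follows from log-concavity of Z in two of its arguments, that is, from the
-- matrices Z(δₓ,δ_y,h₃,…,hₖ) having at most one positive eigenvalue.  For k = 2 that is
-- the hypothesis on G.  For larger k it is the Bochner argument of Shenfeld and van
-- Handel: the case k - 1 forces every positive eigenvalue of the matrix,
-- normalised to have row sums 1, to be at least 1, and by Perron-Frobenius the
-- eigenvalue 1 is simple and the largest.

-- The hypothesis speaks of eigenvectors, while the induction needs a notion that survives
-- conditioning on spins and rescaling. That notion is `ReverseCauchySchwarz`: a congruence merely
-- substitutes other vectors into it. Eigenvectors appear only in order to enter it, once from
-- antiferromagnetism and once in every Bochner step. They are produced by the supremum axiom: the
-- supremum of the Rayleigh quotients is attained, not by compactness, but because completing the
-- square shows that a semidefinite form without null vectors bounds every form. Positivity of the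
-- weights makes the Perron eigenvalue simple, allows division by the weight `h` in the Bochner
-- step, and allows cancelling partition functions when log-concavity is telescoped. Adding εJ to W,
-- with J the all-ones matrix, could create a second positive eigenvalue; (I + εJ) W (I + εJ) is a
-- congruence of W and cannot.

module OrderedField (ℝ : CompleteOrderedField) where

  open CompleteOrderedField ℝ public hiding (zero)
  open Algebra.Properties.Ring ring using (-‿distribˡ-*; -‿distribʳ-*; -0#≈0#; -‿involutive) public
  open Algebra.Properties.AbelianGroup +-abelianGroup using () renaming (⁻¹-∙-comm to -‿+-comm′)
  open Algebra.Properties.Semiring.Mult semiring using (×1-homo-*) renaming (_×_ to _·_)
  open Algebra.Properties.Monoid.Mult +-monoid using (×-homo-+)
  module O = IsDecTotalOrder isDecTotalOrder
  open O using (_≟_; _≤?_) public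

  R : Set
  R = Carrier

  -- With coefficients in ℤ the ring solver decides equality of coefficients by computation, and so
  -- can cancel terms; equality in the field is decided only by an abstract procedure.
  module IntegerCoefficients where
    open Relation.Binary.Reasoning.Setoid setoid

    ⟦_⟧ : ℤ → R
    ⟦ + n ⟧ = n · 1#
    ⟦ -[1+ n ] ⟧ = - (suc n · 1#)

    cancel-1 : ∀ a b → (1# + a) + - (1# + b) ≈ a + - b
    cancel-1 a b = begin
      (1# + a) + - (1# + b)     ≈⟨ +-congˡ (-‿+-comm′ 1# b) ⟨
      (1# + a) + (- 1# + - b)   ≈⟨ +-congʳ (+-comm 1# a) ⟩
      (a + 1#) + (- 1# + - b)   ≈⟨ +-assoc a 1# _ ⟩
      a + (1# + (- 1# + - b))   ≈⟨ +-congˡ (+-assoc 1# (- 1#) _) ⟨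
      a + ((1# + - 1#) + - b)   ≈⟨ +-congˡ (+-congʳ (-‿inverseʳ 1#)) ⟩
      a + (0# + - b)            ≈⟨ +-congˡ (+-identityˡ _) ⟩
      a + - b                   ∎

    ⊖-homo : ∀ m n → ⟦ m ℤ.⊖ n ⟧ ≈ m · 1# + - (n · 1#)
    ⊖-homo m zero = sym (trans (+-congˡ -0#≈0#) (+-identityʳ _))
    ⊖-homo zero (suc n) = sym (+-identityˡ _)
    ⊖-homo (suc m) (suc n) = begin
      ⟦ suc m ℤ.⊖ suc n ⟧             ≡⟨ ≡.cong ⟦_⟧ (ℤ.[1+m]⊖[1+n]≡m⊖n m n) ⟩
      ⟦ m ℤ.⊖ n ⟧                     ≈⟨ ⊖-homo m n ⟩
      m · 1# + - (n · 1#)             ≈⟨ cancel-1 _ _ ⟨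
      suc m · 1# + - (suc n · 1#)     ∎

    +-homo : ∀ i j → ⟦ i ℤ.+ j ⟧ ≈ ⟦ i ⟧ + ⟦ j ⟧
    +-homo (+ m) (+ n) = ×-homo-+ 1# m n
    +-homo (+ m) -[1+ n ] = ⊖-homo m (suc n)
    +-homo -[1+ m ] (+ n) = trans (⊖-homo n (suc m)) (+-comm _ _)
    +-homo -[1+ m ] -[1+ n ] = begin
      - (suc (suc (m ℕ.+ n)) · 1#)          ≡⟨ ≡.cong (λ k → - (suc k · 1#)) (ℕ.+-suc m n) ⟨
      - ((suc m ℕ.+ suc n) · 1#)            ≈⟨ -‿cong (×-homo-+ 1# (suc m) (suc n)) ⟩
      - (suc m · 1# + suc n · 1#)           ≈⟨ -‿+-comm′ _ _ ⟨
      - (suc m · 1#) + - (suc n · 1#)       ∎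

    -‿homo : ∀ i → ⟦ ℤ.- i ⟧ ≈ - ⟦ i ⟧
    -‿homo (+ zero) = sym -0#≈0#
    -‿homo (+ suc n) = refl
    -‿homo -[1+ n ] = sym (-‿involutive _)

    +*-homo : ∀ m j → ⟦ + m ℤ.* j ⟧ ≈ ⟦ + m ⟧ * ⟦ j ⟧
    +*-homo m (+ n) = begin
      ⟦ + m ℤ.* + n ⟧        ≡⟨ ≡.cong ⟦_⟧ (ℤ.pos-* m n) ⟨
      ⟦ + (m ℕ.* n) ⟧        ≈⟨ ×1-homo-* m n ⟩
      ⟦ + m ⟧ * ⟦ + n ⟧      ∎
    +*-homo m -[1+ n ] = begin
      ⟦ + m ℤ.* -[1+ n ] ⟧          ≡⟨ ≡.cong ⟦_⟧ (ℤ.neg-distribʳ-* (+ m) (+ suc n)) ⟨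
      ⟦ ℤ.- (+ m ℤ.* + suc n) ⟧     ≈⟨ -‿homo (+ m ℤ.* + suc n) ⟩
      - ⟦ + m ℤ.* + suc n ⟧         ≈⟨ -‿cong (+*-homo m (+ suc n)) ⟩
      - (⟦ + m ⟧ * ⟦ + suc n ⟧)     ≈⟨ -‿distribʳ-* _ _ ⟩
      ⟦ + m ⟧ * ⟦ -[1+ n ] ⟧        ∎

    *-homo : ∀ i j → ⟦ i ℤ.* j ⟧ ≈ ⟦ i ⟧ * ⟦ j ⟧
    *-homo (+ m) j = +*-homo m j
    *-homo -[1+ m ] j = begin
      ⟦ -[1+ m ] ℤ.* j ⟧            ≡⟨ ≡.cong ⟦_⟧ (ℤ.neg-distribˡ-* (+ suc m) j) ⟨
      ⟦ ℤ.- (+ suc m ℤ.* j) ⟧       ≈⟨ -‿homo (+ suc m ℤ.* j) ⟩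
      - ⟦ + suc m ℤ.* j ⟧           ≈⟨ -‿cong (+*-homo (suc m) j) ⟩
      - (⟦ + suc m ⟧ * ⟦ j ⟧)       ≈⟨ -‿distribˡ-* _ _ ⟩
      ⟦ -[1+ m ] ⟧ * ⟦ j ⟧          ∎

    morphism : ℤ.+-*-rawRing -Raw-AlmostCommutative⟶ fromCommutativeRing commutativeRing
    morphism = record
      { ⟦_⟧ = ⟦_⟧ ; +-homo = +-homo ; *-homo = *-homo ; -‿homo = -‿homo
      ; 0-homo = refl ; 1-homo = +-identityʳ 1# }

    coeff≟ : ∀ i j → Maybe (⟦ i ⟧ ≈ ⟦ j ⟧)
    coeff≟ i j with i ℤ.≟ j
    ... | yes i≡j = just (reflexive (≡.cong ⟦_⟧ i≡j))
    ... | no _ = nothing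

    module Solver = Algebra.Solver.Ring ℤ.+-*-rawRing
      (fromCommutativeRing commutativeRing) morphism coeff≟

  open IntegerCoefficients.Solver using (solve; _:=_; _:+_; _:*_; _:-_; :-_; con) public

  -- Arithmetic of the ordered field and finite sums.

  ≤-refl : ∀ {x} → x ≤ x
  ≤-refl = O.refl

  ≤-trans : ∀ {x y z} → x ≤ y → y ≤ z → x ≤ z
  ≤-trans = O.trans

  ≤-resp : ∀ {x x′ y y′} → x ≈ x′ → y ≈ y′ → x ≤ y → x′ ≤ y′
  ≤-resp p q x≤y = ≤-trans (O.reflexive (sym p)) (≤-trans x≤y (O.reflexive q))

  ≤-respˡ : ∀ {x x′ y} → x ≈ x′ → x ≤ y → x′ ≤ y
  ≤-respˡ p = ≤-resp p refl

  ≤-respʳ : ∀ {x y y′} → y ≈ y′ → x ≤ y → x ≤ y′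
  ≤-respʳ = ≤-resp refl

  <⇒≤ : ∀ {x y} → x < y → x ≤ y
  <⇒≤ = proj₁

  <⇒≱ : ∀ {x y} → x < y → ¬ (y ≤ x)
  <⇒≱ (x≤y , x≉y) y≤x = x≉y (O.antisym x≤y y≤x)

  ≰⇒> : ∀ {x y} → ¬ (x ≤ y) → y < x
  ≰⇒> {x} {y} x≰y with O.total x y
  ... | inj₁ x≤y = ⊥-elim (x≰y x≤y)
  ... | inj₂ y≤x = y≤x , λ y≈x → x≰y (O.reflexive (sym y≈x))

  ≤-stable : ∀ {x y} → ¬ ¬ (x ≤ y) → x ≤ y
  ≤-stable {x} {y} ¬¬p with x ≤? y
  ... | yes p = p
  ... | no ¬p = ⊥-elim (¬¬p ¬p)

  ≮⇒≥ : ∀ {x y} → ¬ (x < y) → y ≤ x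
  ≮⇒≥ x≮y = ≤-stable (λ y≰x → x≮y (≰⇒> y≰x))

  <-≤-trans : ∀ {x y z} → x < y → y ≤ z → x < z
  <-≤-trans x<y y≤z = ≰⇒> (λ z≤x → <⇒≱ x<y (≤-trans y≤z z≤x))

  ≤-<-trans : ∀ {x y z} → x ≤ y → y < z → x < z
  ≤-<-trans x≤y y<z = ≰⇒> (λ z≤x → <⇒≱ y<z (≤-trans z≤x x≤y))

  <-resp : ∀ {x x′ y y′} → x ≈ x′ → y ≈ y′ → x < y → x′ < y′
  <-resp p q x<y = ≤-<-trans (O.reflexive (sym p)) (<-≤-trans x<y (O.reflexive q))

  <-respʳ : ∀ {x y y′} → y ≈ y′ → x < y → x < y′
  <-respʳ = <-resp refl

  x-y≥0⇒y≤x : ∀ {x y} → 0# ≤ x - y → y ≤ x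
  x-y≥0⇒y≤x {x} {y} p = ≤-resp (+-identityˡ y)
    (solve 2 (λ x y → x :- y :+ y := x) refl x y) (+-monoˡ-≤ y p)

  y≤x⇒x-y≥0 : ∀ {x y} → y ≤ x → 0# ≤ x - y
  y≤x⇒x-y≥0 {x} {y} p = ≤-respˡ (-‿inverseʳ y) (+-monoˡ-≤ (- y) p)

  -- Certificate form: `z` is a visibly nonnegative expression, such as a sum of squares, and the
  -- identity is left to the ring solver.
  ≤-by : ∀ {x y} z → 0# ≤ z → z ≈ y - x → x ≤ y
  ≤-by z 0≤z eq = x-y≥0⇒y≤x (≤-respʳ eq 0≤z)

  +-mono-≤ : ∀ {x y u v} → x ≤ y → u ≤ v → x + u ≤ y + v
  +-mono-≤ {x} {y} {u} {v} p q =
    ≤-trans (+-monoˡ-≤ u p) (≤-resp (+-comm u y) (+-comm v y) (+-monoˡ-≤ y q))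

  +-nonNegative : ∀ {x y} → 0# ≤ x → 0# ≤ y → 0# ≤ x + y
  +-nonNegative p q = ≤-respˡ (+-identityˡ 0#) (+-mono-≤ p q)

  neg-nonNegative : ∀ {x} → x ≤ 0# → 0# ≤ - x
  neg-nonNegative {x} p = ≤-respʳ (+-identityˡ (- x)) (y≤x⇒x-y≥0 p)

  square-nonNegative : ∀ x → 0# ≤ x * x
  square-nonNegative x with O.total 0# x
  ... | inj₁ p = *-nonNegative p p
  ... | inj₂ p = ≤-respʳ (solve 1 (λ x → (:- x) :* (:- x) := x :* x) refl x)
                   (*-nonNegative (neg-nonNegative p) (neg-nonNegative p))

  0≤1 : 0# ≤ 1#
  0≤1 = ≤-respʳ (*-identityˡ 1#) (square-nonNegative 1#)

  0<1 : 0# < 1#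
  0<1 = 0≤1 , 0≉1

  *-monoˡ-≤ : ∀ {c x y} → 0# ≤ c → x ≤ y → c * x ≤ c * y
  *-monoˡ-≤ {c} {x} {y} p q = ≤-by _ (*-nonNegative p (y≤x⇒x-y≥0 q))
    (solve 3 (λ c x y → c :* (y :- x) := c :* y :- c :* x) refl c x y)

  *-monoʳ-≤ : ∀ {c x y} → 0# ≤ c → x ≤ y → x * c ≤ y * c
  *-monoʳ-≤ p q = ≤-resp (*-comm _ _) (*-comm _ _) (*-monoˡ-≤ p q)

  *-mono-≤ : ∀ {x y u v} → 0# ≤ x → 0# ≤ u → x ≤ y → u ≤ v → x * u ≤ y * v
  *-mono-≤ 0≤x 0≤u p q = ≤-trans (*-monoʳ-≤ 0≤u p) (*-monoˡ-≤ (≤-trans 0≤x p) q)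

  *-integral : ∀ {x y} → ¬ (x ≈ 0#) → x * y ≈ 0# → y ≈ 0#
  *-integral {x} {y} x≉0 xy≈0 with inverse x x≉0
  ... | z , xz≈1 = begin
      y             ≈⟨ *-identityˡ y ⟨
      1# * y        ≈⟨ *-congʳ xz≈1 ⟨
      (x * z) * y   ≈⟨ solve 3 (λ x y z → x :* z :* y := z :* (x :* y)) refl x y z ⟩
      z * (x * y)   ≈⟨ *-congˡ xy≈0 ⟩
      z * 0#        ≈⟨ zeroʳ z ⟩
      0#            ∎
    where open Relation.Binary.Reasoning.Setoid setoid

  >⇒≉ : ∀ {x} → 0# < x → ¬ (x ≈ 0#)
  >⇒≉ (_ , p) x≈0 = p (sym x≈0)

  *-positive : ∀ {x y} → 0# < x → 0# < y → 0# < x * y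
  *-positive p q = *-nonNegative (<⇒≤ p) (<⇒≤ q) ,
    λ e → >⇒≉ q (*-integral (>⇒≉ p) (sym e))

  +-positive : ∀ {x y} → 0# < x → 0# ≤ y → 0# < x + y
  +-positive {x} {y} p q = <-≤-trans p
    (≤-respˡ (+-identityʳ x) (+-mono-≤ ≤-refl q))

  square-positive : ∀ {x} → ¬ (x ≈ 0#) → 0# < x * x
  square-positive {x} p = square-nonNegative x , λ e → p (*-integral p (sym e))

  square≈0 : ∀ {x} → x * x ≈ 0# → x ≈ 0#
  square≈0 {x} e with x ≟ 0#
  ... | yes p = p
  ... | no p = ⊥-elim (>⇒≉ (square-positive p) e)

  *-cancelˡ-≤ : ∀ {c x y} → 0# < c → c * x ≤ c * y → x ≤ y
  *-cancelˡ-≤ {c} {x} {y} 0<c p = ≮⇒≥ λ y<x →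
    <⇒≱ (*-positive 0<c (0<x-y y<x)) (≤-resp
      (solve 3 (λ c x y → c :* x :- c :* y := c :* (x :- y)) refl c x y)
      (-‿inverseʳ (c * y)) (+-monoˡ-≤ (- (c * y)) p))
    where
    0<x-y : y < x → 0# < x - y
    0<x-y (y≤x , y≉x) = y≤x⇒x-y≥0 y≤x , λ e → y≉x (begin
      y            ≈⟨ +-identityˡ y ⟨
      0# + y       ≈⟨ +-congʳ e ⟩
      x - y + y    ≈⟨ solve 2 (λ x y → x :- y :+ y := x) refl x y ⟩
      x            ∎)
      where open Relation.Binary.Reasoning.Setoid setoid

  inverse⁺ : ∀ {x} → 0# < x → ∃[ y ] (0# < y × x * y ≈ 1#)
  inverse⁺ {x} 0<x with inverse x (>⇒≉ 0<x)
  ... | y , xy≈1 = y , ≰⇒> y≰0 , xy≈1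
    where
    y≰0 : ¬ (y ≤ 0#)
    y≰0 y≤0 = <⇒≱ 0<1 (≤-resp xy≈1 (zeroʳ x) (*-monoˡ-≤ (<⇒≤ 0<x) y≤0))

  +-≈0ˡ : ∀ {x y} → 0# ≤ x → 0# ≤ y → x + y ≈ 0# → x ≈ 0#
  +-≈0ˡ {x} {y} p q e = O.antisym
    (≤-resp (+-identityʳ x) e (+-mono-≤ ≤-refl q)) p

  +-≈0ʳ : ∀ {x y} → 0# ≤ x → 0# ≤ y → x + y ≈ 0# → y ≈ 0#
  +-≈0ʳ p q e = +-≈0ˡ q p (trans (+-comm _ _) e)

  open Algebra.Properties.Semiring.Sum semiring public
    using (sum-cong-≋; *-distribˡ-sum; *-distribʳ-sum; ∑-comm; ∑-distrib-+; sum-replicate-zero)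

  ∑-cong : ∀ {n} {f g : Fin n → R} → (∀ i → f i ≈ g i) → ∑ f ≈ ∑ g
  ∑-cong = sum-cong-≋

  ∑-mono : ∀ {n} {f g : Fin n → R} → (∀ i → f i ≤ g i) → ∑ f ≤ ∑ g
  ∑-mono {zero} _ = ≤-refl
  ∑-mono {suc n} p = +-mono-≤ (p zero) (∑-mono (λ i → p (suc i)))

  ∑-nonNegative : ∀ {n} {f : Fin n → R} → (∀ i → 0# ≤ f i) → 0# ≤ ∑ f
  ∑-nonNegative {zero} _ = ≤-refl
  ∑-nonNegative {suc n} p = +-nonNegative (p zero) (∑-nonNegative (λ i → p (suc i)))

  ∑-positive : ∀ {n} {f : Fin (suc n) → R} → (∀ i → 0# < f i) → 0# < ∑ f
  ∑-positive p = +-positive (p zero) (∑-nonNegative (λ i → <⇒≤ (p (suc i))))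

  ∑≈0⇒≈0 : ∀ {n} {f : Fin n → R} → (∀ i → 0# ≤ f i) → ∑ f ≈ 0# → ∀ i → f i ≈ 0#
  ∑≈0⇒≈0 p e zero = +-≈0ˡ (p zero) (∑-nonNegative (λ i → p (suc i))) e
  ∑≈0⇒≈0 p e (suc i) = ∑≈0⇒≈0 (λ i → p (suc i))
    (+-≈0ʳ (p zero) (∑-nonNegative (λ i → p (suc i))) e) i

  ∑-zero : ∀ {n} {f : Fin n → R} → (∀ i → f i ≈ 0#) → ∑ f ≈ 0#
  ∑-zero {n} p = trans (∑-cong p) (sum-replicate-zero n)

  module ≤-Reasoning where
    poset : Poset _ _ _
    poset = record { isPartialOrder = O.isPartialOrder }
    open Relation.Binary.Reasoning.PartialOrder poset public

-- Quadratic forms, and domination by completing the square.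

module QuadraticForm (ℝ : CompleteOrderedField) where

  open OrderedField ℝ
  open ≤-Reasoning

  ∑-linear : ∀ {n} a b (f g : Vector R n) → ∑ (λ i → a * f i + b * g i) ≈ a * ∑ f + b * ∑ g
  ∑-linear a b f g = trans (∑-distrib-+ (λ i → a * f i) (λ i → b * g i))
    (+-cong (sym (*-distribˡ-sum a f)) (sym (*-distribˡ-sum b g)))

  Matrix : ℕ → Set
  Matrix n = Fin n → Fin n → R

  infix 8 ⟪_,_⟫
  infixr 9 _⊙_

  ⟪_,_⟫ : ∀ {n} → Vector R n → Vector R n → R
  ⟪ x , y ⟫ = ∑ (λ i → x i * y i)

  _⊙_ : ∀ {n} → Matrix n → Vector R n → Vector R n
  (M ⊙ x) i = ∑ (λ j → M i j * x j)

  form : ∀ {n} → Matrix n → Vector R n → Vector R n → R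
  form M x y = ⟪ x , M ⊙ y ⟫

  q : ∀ {n} → Matrix n → Vector R n → R
  q M x = form M x x

  NonZero : ∀ {n} → Vector R n → Set
  NonZero v = ¬ (∀ i → v i ≈ 0#)

  PSD : ∀ {n} → Matrix n → Set
  PSD N = ∀ x → 0# ≤ q N x

  lin : ∀ {n} → R → Vector R n → R → Vector R n → Vector R n
  lin a x b y i = a * x i + b * y i

  ⟪⟫-cong : ∀ {n} {x x′ y y′ : Vector R n} → (∀ i → x i ≈ x′ i) → (∀ i → y i ≈ y′ i) →
            ⟪ x , y ⟫ ≈ ⟪ x′ , y′ ⟫
  ⟪⟫-cong p q = ∑-cong (λ i → *-cong (p i) (q i))

  ⟪⟫-comm : ∀ {n} (x y : Vector R n) → ⟪ x , y ⟫ ≈ ⟪ y , x ⟫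
  ⟪⟫-comm x y = ∑-cong (λ i → *-comm (x i) (y i))

  ⟪⟫-linʳ : ∀ {n} (x : Vector R n) a y b z → ⟪ x , lin a y b z ⟫ ≈ a * ⟪ x , y ⟫ + b * ⟪ x , z ⟫
  ⟪⟫-linʳ x a y b z = trans
    (∑-cong (λ i → solve 5 (λ x a y b z → x :* (a :* y :+ b :* z) := a :* (x :* y) :+ b :* (x :* z))
                     refl (x i) a (y i) b (z i)))
    (∑-linear a b (λ i → x i * y i) (λ i → x i * z i))

  ⟪⟫-linˡ : ∀ {n} (x : Vector R n) a y b z → ⟪ lin a y b z , x ⟫ ≈ a * ⟪ y , x ⟫ + b * ⟪ z , x ⟫
  ⟪⟫-linˡ x a y b z = begin-equality
    ⟪ lin a y b z , x ⟫              ≈⟨ ⟪⟫-comm (lin a y b z) x ⟩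
    ⟪ x , lin a y b z ⟫              ≈⟨ ⟪⟫-linʳ x a y b z ⟩
    a * ⟪ x , y ⟫ + b * ⟪ x , z ⟫    ≈⟨ +-cong (*-congˡ (⟪⟫-comm x y)) (*-congˡ (⟪⟫-comm x z)) ⟩
    a * ⟪ y , x ⟫ + b * ⟪ z , x ⟫    ∎

  ⟪⟫-scaleʳ : ∀ {n} a (x y : Vector R n) → ⟪ x , (λ i → a * y i) ⟫ ≈ a * ⟪ x , y ⟫
  ⟪⟫-scaleʳ a x y = trans
    (∑-cong (λ i → solve 3 (λ a x y → x :* (a :* y) := a :* (x :* y)) refl a (x i) (y i)))
    (sym (*-distribˡ-sum a (λ i → x i * y i)))

  ⟪⟫-scaleˡ : ∀ {n} a (x y : Vector R n) → ⟪ (λ i → a * x i) , y ⟫ ≈ a * ⟪ x , y ⟫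
  ⟪⟫-scaleˡ a x y = trans (⟪⟫-comm (λ i → a * x i) y)
    (trans (⟪⟫-scaleʳ a y x) (*-congˡ (⟪⟫-comm y x)))

  ⊙-lin : ∀ {n} (M : Matrix n) a y b z i → (M ⊙ lin a y b z) i ≈ lin a (M ⊙ y) b (M ⊙ z) i
  ⊙-lin M a y b z i = ⟪⟫-linʳ (M i) a y b z

  form-cong : ∀ {n} {M N : Matrix n} → (∀ i j → M i j ≈ N i j) → ∀ x y → form M x y ≈ form N x y
  form-cong p x y = ⟪⟫-cong {x = x} (λ _ → refl) (λ i → ∑-cong (λ j → *-congʳ (p i j)))

  form-sym : ∀ {n} {M : Matrix n} → (∀ i j → M i j ≈ M j i) → ∀ x y → form M x y ≈ form M y x
  form-sym {M = M} M-sym x y = begin-equality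
    ∑ (λ i → x i * ∑ (λ j → M i j * y j))      ≈⟨ ∑-cong (λ i → *-distribˡ-sum (x i) (λ j → M i j * y j)) ⟩
    ∑ (λ i → ∑ (λ j → x i * (M i j * y j)))    ≈⟨ ∑-comm (λ i j → x i * (M i j * y j)) ⟩
    ∑ (λ j → ∑ (λ i → x i * (M i j * y j)))    ≈⟨ ∑-cong (λ j → ∑-cong (λ i → trans
                                                    (solve 3 (λ a b c → a :* (b :* c) := c :* (b :* a)) refl (x i) (M i j) (y j))
                                                    (*-congˡ (*-congʳ (M-sym i j))))) ⟩
    ∑ (λ j → ∑ (λ i → y j * (M j i * x i)))    ≈⟨ ∑-cong (λ j → *-distribˡ-sum (y j) (λ i → M j i * x i)) ⟨
    ∑ (λ j → y j * ∑ (λ i → M j i * x i))      ∎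

  form-linᴹ : ∀ {n} a (M : Matrix n) b N x y →
              form (λ i j → a * M i j + b * N i j) x y ≈ a * form M x y + b * form N x y
  form-linᴹ a M b N x y = begin-equality
    ⟪ x , (λ i j → a * M i j + b * N i j) ⊙ y ⟫  ≈⟨ ⟪⟫-cong {x = x} (λ _ → refl) (λ i → ⟪⟫-linˡ y a (M i) b (N i)) ⟩
    ⟪ x , lin a (M ⊙ y) b (N ⊙ y) ⟫              ≈⟨ ⟪⟫-linʳ x a (M ⊙ y) b (N ⊙ y) ⟩
    a * form M x y + b * form N x y              ∎

  _⊗ᵛ_ : ∀ {n} → Vector R n → Vector R n → Matrix n
  (r ⊗ᵛ s) i j = r i * s j

  ⊗ᵛ-⊙ : ∀ {n} (r s y : Vector R n) i → ((r ⊗ᵛ s) ⊙ y) i ≈ ⟪ s , y ⟫ * r i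
  ⊗ᵛ-⊙ r s y i = begin-equality
    ∑ (λ j → r i * s j * y j)      ≈⟨ ∑-cong (λ j → *-assoc (r i) (s j) (y j)) ⟩
    ∑ (λ j → r i * (s j * y j))    ≈⟨ *-distribˡ-sum (r i) (λ j → s j * y j) ⟨
    r i * ⟪ s , y ⟫                ≈⟨ *-comm _ _ ⟩
    ⟪ s , y ⟫ * r i                ∎

  form-⊗ᵛ : ∀ {n} (r s x y : Vector R n) → form (r ⊗ᵛ s) x y ≈ ⟪ r , x ⟫ * ⟪ s , y ⟫
  form-⊗ᵛ r s x y = begin-equality
    ⟪ x , (r ⊗ᵛ s) ⊙ y ⟫              ≈⟨ ⟪⟫-cong {x = x} (λ _ → refl) (⊗ᵛ-⊙ r s y) ⟩
    ⟪ x , (λ i → ⟪ s , y ⟫ * r i) ⟫   ≈⟨ ⟪⟫-scaleʳ ⟪ s , y ⟫ x r ⟩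
    ⟪ s , y ⟫ * ⟪ x , r ⟫             ≈⟨ *-comm _ _ ⟩
    ⟪ x , r ⟫ * ⟪ s , y ⟫             ≈⟨ *-congʳ (⟪⟫-comm x r) ⟩
    ⟪ r , x ⟫ * ⟪ s , y ⟫             ∎

  form-linʳ : ∀ {n} (M : Matrix n) x a y b z → form M x (lin a y b z) ≈ a * form M x y + b * form M x z
  form-linʳ M x a y b z = trans
    (⟪⟫-cong {x = x} (λ _ → refl) (⊙-lin M a y b z)) (⟪⟫-linʳ x a (M ⊙ y) b (M ⊙ z))

  q-lin : ∀ {n} {M : Matrix n} → (∀ i j → M i j ≈ M j i) → ∀ a x b y →
          q M (lin a x b y) ≈ a * a * q M x + (a * b + a * b) * form M x y + b * b * q M y
  q-lin {M = M} M-sym a x b y = begin-equality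
    form M (lin a x b y) (lin a x b y)
      ≈⟨ form-linʳ M (lin a x b y) a x b y ⟩
    a * form M (lin a x b y) x + b * form M (lin a x b y) y
      ≈⟨ +-cong (*-congˡ (⟪⟫-linˡ (M ⊙ x) a x b y)) (*-congˡ (⟪⟫-linˡ (M ⊙ y) a x b y)) ⟩
    a * (a * q M x + b * form M y x) + b * (a * form M x y + b * q M y)
      ≈⟨ +-congʳ (*-congˡ (+-congˡ (*-congˡ (form-sym M-sym y x)))) ⟩
    a * (a * q M x + b * form M x y) + b * (a * form M x y + b * q M y)
      ≈⟨ solve 5 (λ a b X Y F → a :* (a :* X :+ b :* F) :+ b :* (a :* F :+ b :* Y) :=
                     a :* a :* X :+ (a :* b :+ a :* b) :* F :+ b :* b :* Y)
           refl a b (q M x) (q M y) (form M x y) ⟩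
    a * a * q M x + (a * b + a * b) * form M x y + b * b * q M y ∎

  q-scale : ∀ {n} (M : Matrix n) b x → q M (λ i → b * x i) ≈ b * b * q M x
  q-scale M b x = begin-equality
    ⟪ (λ i → b * x i) , M ⊙ (λ i → b * x i) ⟫  ≈⟨ ⟪⟫-scaleˡ b x _ ⟩
    b * ⟪ x , M ⊙ (λ i → b * x i) ⟫            ≈⟨ *-congˡ (⟪⟫-cong {x = x} (λ _ → refl) (λ i → ⟪⟫-scaleʳ b (M i) x)) ⟩
    b * ⟪ x , (λ i → b * (M ⊙ x) i) ⟫          ≈⟨ *-congˡ (⟪⟫-scaleʳ b x (M ⊙ x)) ⟩
    b * (b * q M x)                            ≈⟨ *-assoc _ _ _ ⟨
    b * b * q M x                              ∎

  tail : ∀ {n} → Matrix (suc n) → Matrix n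
  tail M i j = M (suc i) (suc j)

  -- The induction below meets matrices that are not symmetric, such as `reduced`; their quadratic
  -- form sees only the sum of the corner row and the corner column.
  border : ∀ {n} → Matrix (suc n) → Vector R n
  border M i = M zero (suc i) + M (suc i) zero

  q-∷ : ∀ {n} (M : Matrix (suc n)) x →
        q M x ≈ M zero zero * (x zero * x zero) + x zero * ⟪ border M , x ∘ suc ⟫ + q (tail M) (x ∘ suc)
  q-∷ M x = begin-equality
    s * (a * s + ⟪ u , y ⟫) + ∑ (λ i → y i * (v i * s + (tail M ⊙ y) i))
      ≈⟨ +-congˡ (∑-cong λ i → solve 4 (λ y v s z → y :* (v :* s :+ z) := s :* (v :* y) :+ y :* z)
                                   refl (y i) (v i) s ((tail M ⊙ y) i)) ⟩
    s * (a * s + ⟪ u , y ⟫) + ∑ (λ i → s * (v i * y i) + y i * (tail M ⊙ y) i)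
      ≈⟨ +-congˡ (∑-distrib-+ (λ i → s * (v i * y i)) _) ⟩
    s * (a * s + ⟪ u , y ⟫) + (∑ (λ i → s * (v i * y i)) + q (tail M) y)
      ≈⟨ +-congˡ (+-congʳ (*-distribˡ-sum s (λ i → v i * y i))) ⟨
    s * (a * s + ⟪ u , y ⟫) + (s * ⟪ v , y ⟫ + q (tail M) y)
      ≈⟨ solve 5 (λ s a U V Q → s :* (a :* s :+ U) :+ (s :* V :+ Q) := a :* (s :* s) :+ s :* (U :+ V) :+ Q)
           refl s a ⟪ u , y ⟫ ⟪ v , y ⟫ (q (tail M) y) ⟩
    a * (s * s) + s * (⟪ u , y ⟫ + ⟪ v , y ⟫) + q (tail M) y
      ≈⟨ +-congʳ (+-congˡ (*-congˡ (trans (sym (∑-distrib-+ (λ i → u i * y i) (λ i → v i * y i)))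
           (∑-cong (λ i → sym (distribʳ (y i) (u i) (v i))))))) ⟩
    a * (s * s) + s * ⟪ border M , y ⟫ + q (tail M) y ∎
    where
    s = x zero
    a = M zero zero
    y = x ∘ suc
    u = λ i → M zero (suc i)
    v = λ i → M (suc i) zero

  -- Weaker by a factor 2 than the arithmetic-geometric mean inequality, which saves halving.
  *≤square+square : ∀ t e → t * e ≤ t * t + e * e
  *≤square+square t e with O.total 0# (t * e)
  ... | inj₁ p = ≤-trans (≤-respˡ (+-identityʳ _) (+-mono-≤ ≤-refl p))
    (≤-by _ (square-nonNegative (t - e))
      (solve 2 (λ t e → (t :- e) :* (t :- e) := t :* t :+ e :* e :- (t :* e :+ t :* e)) refl t e))
  ... | inj₂ p = ≤-trans p (+-nonNegative (square-nonNegative t) (square-nonNegative e))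

  -- Completing the square: with a the corner entry, b = 2a and ρ the pairing with
  -- the border, 2b N(s ∷ y) = (b s + ρ)² + schur N y.
  module CompleteSquare {n} (N : Matrix (suc n)) where
    a b : R
    a = N zero zero
    b = a + a

    -- For symmetric `N` this is 4a times the usual Schur complement; the factor replaces division
    -- by the corner.
    schur : Matrix n
    schur i j = (b + b) * tail N i j + (- 1#) * (border N ⊗ᵛ border N) i j

    q-schur : ∀ y → q schur y ≈ (b + b) * q (tail N) y - ⟪ border N , y ⟫ * ⟪ border N , y ⟫
    q-schur y = begin-equality
      q schur y
        ≈⟨ form-linᴹ (b + b) (tail N) (- 1#) (border N ⊗ᵛ border N) y y ⟩
      (b + b) * q (tail N) y + (- 1#) * q (border N ⊗ᵛ border N) y
        ≈⟨ +-congˡ (trans (sym (-‿distribˡ-* 1# _)) (-‿cong (trans (*-identityˡ _) (form-⊗ᵛ (border N) (border N) y y)))) ⟩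
      (b + b) * q (tail N) y - ⟪ border N , y ⟫ * ⟪ border N , y ⟫ ∎

    -- The vector with tail b y on the hyperplane where `linear` vanishes. There `N` reduces to
    -- `schur`, so semidefiniteness passes down to `schur` and null vectors lift back to `N`.
    extend : Vector R n → Vector R (suc n)
    extend y = (- ⟪ border N , y ⟫) ∷ᵛ (λ i → b * y i)

    q-extend : ∀ y → q N (extend y) ≈ a * q schur y
    q-extend y = begin-equality
      q N (extend y)
        ≈⟨ q-∷ N (extend y) ⟩
      a * (- ρ * - ρ) + - ρ * ⟪ border N , (λ i → b * y i) ⟫ + q (tail N) (λ i → b * y i)
        ≈⟨ +-cong (+-congˡ (*-congˡ (⟪⟫-scaleʳ b (border N) y))) (q-scale (tail N) b y) ⟩
      a * (- ρ * - ρ) + - ρ * (b * ρ) + b * b * q (tail N) y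
        ≈⟨ solve 3 (λ a ρ Q → a :* (:- ρ :* :- ρ) :+ :- ρ :* ((a :+ a) :* ρ) :+ (a :+ a) :* (a :+ a) :* Q :=
                      a :* (((a :+ a) :+ (a :+ a)) :* Q :- ρ :* ρ)) refl a ρ (q (tail N) y) ⟩
      a * ((b + b) * q (tail N) y - ρ * ρ)
        ≈⟨ *-congˡ (q-schur y) ⟨
      a * q schur y ∎
      where ρ = ⟪ border N , y ⟫

    linear : Vector R (suc n) → R
    linear x = b * x zero + ⟪ border N , x ∘ suc ⟫

    square+schur : ∀ x → linear x * linear x + q schur (x ∘ suc) ≈ (b + b) * q N x
    square+schur x = begin-equality
      linear x * linear x + q schur (x ∘ suc)
        ≈⟨ +-congˡ (q-schur (x ∘ suc)) ⟩
      linear x * linear x + ((b + b) * q (tail N) (x ∘ suc) - ρ * ρ)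
        ≈⟨ solve 4 (λ a s ρ Q →
             ((a :+ a) :* s :+ ρ) :* ((a :+ a) :* s :+ ρ) :+ (((a :+ a) :+ (a :+ a)) :* Q :- ρ :* ρ) :=
             ((a :+ a) :+ (a :+ a)) :* (a :* (s :* s) :+ s :* ρ :+ Q))
           refl a (x zero) ρ (q (tail N) (x ∘ suc)) ⟩
      (b + b) * (a * (x zero * x zero) + x zero * ρ + q (tail N) (x ∘ suc))
        ≈⟨ *-congˡ (q-∷ N x) ⟨
      (b + b) * q N x ∎
      where ρ = ⟪ border N , x ∘ suc ⟫

    module _ (M : Matrix (suc n)) where
      p : R
      p = M zero zero

      -- Substituting b s = t - ρ, with t = `linear x`, into b² q M makes ⟪ η , y ⟫ the coefficient
      -- of t.
      η : Vector R n
      η = lin b (border M) (- (p + p)) (border N)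

      -- The part of b² q M free of t after that substitution, with e² added for e = ⟪ η , y ⟫: the
      -- e² produced by t e ≤ t² + e² then cancels.
      reduced : Matrix n
      reduced i j = 1# * (1# * (b * b * tail M i j + p * (border N ⊗ᵛ border N) i j)
                            + (- b) * (border N ⊗ᵛ border M) i j)
                  + 1# * (η ⊗ᵛ η) i j

      q-reduced : ∀ x → let t = linear x; e = ⟪ η , x ∘ suc ⟫ in
                  b * b * q M x ≈ p * (t * t) + t * e + q reduced (x ∘ suc) - e * e
      q-reduced x = sym (begin-equality
        p * (t * t) + t * e + q reduced y - e * e
          ≈⟨ +-congʳ (+-congˡ expand) ⟩
        p * (t * t) + t * e + (b * b * Q + p * (ρ * ρ) + (- b) * (ρ * κ) + e * e) - e * e
          ≈⟨ +-cong (+-congʳ (+-congˡ (*-congˡ e-eq))) refl ⟩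
        p * (t * t) + t * (b * κ + - (p + p) * ρ) + (b * b * Q + p * (ρ * ρ) + (- b) * (ρ * κ) + e * e) - e * e
          ≈⟨ trans (+-congʳ (sym (+-assoc _ _ _))) (trans (+-assoc _ _ _) (trans (+-congˡ (-‿inverseʳ (e * e))) (+-identityʳ _))) ⟩
        p * (t * t) + t * (b * κ + - (p + p) * ρ) + (b * b * Q + p * (ρ * ρ) + (- b) * (ρ * κ))
          ≈⟨ +-congˡ (+-congˡ (solve 3 (λ b ρ κ → (:- b) :* (ρ :* κ) := :- (ρ :* (b :* κ))) refl b ρ κ)) ⟩
        p * (t * t) + t * (b * κ + - (p + p) * ρ) + (b * b * Q + p * (ρ * ρ) + - (ρ * (b * κ)))
          ≈⟨ solve 5 (λ p X ρ Y W →
               p :* ((X :+ ρ) :* (X :+ ρ)) :+ (X :+ ρ) :* (Y :+ :- (p :+ p) :* ρ)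
                 :+ (W :+ p :* (ρ :* ρ) :+ :- (ρ :* Y)) :=
               p :* (X :* X) :+ X :* Y :+ W) refl p (b * x zero) ρ (b * κ) (b * b * Q) ⟩
        p * (b * x zero * (b * x zero)) + b * x zero * (b * κ) + b * b * Q
          ≈⟨ solve 5 (λ p b s κ Q → p :* (b :* s :* (b :* s)) :+ b :* s :* (b :* κ) :+ b :* b :* Q :=
               b :* b :* (p :* (s :* s) :+ s :* κ :+ Q)) refl p b (x zero) κ Q ⟩
        b * b * (p * (x zero * x zero) + x zero * κ + Q)
          ≈⟨ *-congˡ (q-∷ M x) ⟨
        b * b * q M x ∎)
        where
        y = x ∘ suc
        t = linear x
        e = ⟪ η , y ⟫
        ρ = ⟪ border N , y ⟫
        κ = ⟪ border M , y ⟫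
        Q = q (tail M) y
        e-eq : e ≈ b * κ + - (p + p) * ρ
        e-eq = ⟪⟫-linˡ y b (border M) (- (p + p)) (border N)
        expand : q reduced y ≈ b * b * Q + p * (ρ * ρ) + (- b) * (ρ * κ) + e * e
        expand = begin-equality
          q reduced y
            ≈⟨ form-linᴹ 1# _ 1# (η ⊗ᵛ η) y y ⟩
          1# * _ + 1# * q (η ⊗ᵛ η) y
            ≈⟨ +-cong (*-identityˡ _) (trans (*-identityˡ _) (form-⊗ᵛ η η y y)) ⟩
          _ + e * e
            ≈⟨ +-congʳ (trans (form-linᴹ 1# _ (- b) (border N ⊗ᵛ border M) y y)
                 (+-cong (*-identityˡ _) (*-congˡ (form-⊗ᵛ (border N) (border M) y y)))) ⟩
          _ + (- b) * (ρ * κ) + e * e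
            ≈⟨ +-congʳ (+-congʳ (trans (form-linᴹ (b * b) (tail M) p (border N ⊗ᵛ border N) y y)
                 (+-congˡ (*-congˡ (form-⊗ᵛ (border N) (border N) y y))))) ⟩
          b * b * Q + p * (ρ * ρ) + (- b) * (ρ * κ) + e * e ∎

  Dominates : ∀ {n} → Matrix n → Set
  Dominates N = ∀ M → ∃[ C ] (0# ≤ C × (∀ x → q M x ≤ C * q N x))

  -- Replaces compactness of the unit sphere. By induction on the dimension: a zero corner makes the
  -- first basis vector null; otherwise the square is completed and the Schur complement is
  -- semidefinite of smaller dimension. Its null vectors lift by `extend`, and a bound for
  -- `reduced M` gives one for `M`.
  degenerate⊎dominates : ∀ {n} (N : Matrix n) → PSD N →
                         (∃[ v ] (NonZero v × q N v ≈ 0#)) ⊎ Dominates N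
  degenerate⊎dominates {zero} N _ = inj₂ λ M → 0# , ≤-refl , λ x → O.reflexive (sym (zeroˡ _))
  degenerate⊎dominates {suc n} N N-psd with N zero zero ≟ 0#
  ... | yes a≈0 = inj₁ (e₀ , (λ z → 0≉1 (sym (z zero))) , q-e₀)
    where
    e₀ : Vector R (suc n)
    e₀ = 1# ∷ᵛ λ _ → 0#
    q-e₀ : q N e₀ ≈ 0#
    q-e₀ = begin-equality
      q N e₀ ≈⟨ q-∷ N e₀ ⟩
      N zero zero * (1# * 1#) + 1# * ⟪ border N , (λ _ → 0#) ⟫ + q (tail N) (λ _ → 0#)
        ≈⟨ +-cong (+-cong (trans (*-congʳ a≈0) (zeroˡ _)) (trans (*-congˡ (∑-zero (λ i → zeroʳ (border N i)))) (zeroʳ 1#)))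
             (∑-zero (λ i → zeroˡ ((tail N ⊙ (λ _ → 0#)) i))) ⟩
      0# + 0# + 0# ≈⟨ trans (+-identityʳ _) (+-identityʳ _) ⟩
      0# ∎
  ... | no a≉0 = result (degenerate⊎dominates schur schur-psd)
    where
    open CompleteSquare N

    0<a : 0# < a
    0<a = ≤-respʳ q-e₀ (N-psd e₀) , (λ e → a≉0 (sym e))
      where
      e₀ : Vector R (suc n)
      e₀ = 1# ∷ᵛ λ _ → 0#
      q-e₀ : q N e₀ ≈ a
      q-e₀ = begin-equality
        q N e₀ ≈⟨ q-∷ N e₀ ⟩
        N zero zero * (1# * 1#) + 1# * ⟪ border N , (λ _ → 0#) ⟫ + q (tail N) (λ _ → 0#)
          ≈⟨ +-cong (+-cong (trans (*-congˡ (*-identityʳ _)) (*-identityʳ _)) (trans (*-congˡ (∑-zero (λ i → zeroʳ (border N i)))) (zeroʳ 1#)))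
               (∑-zero (λ i → zeroˡ ((tail N ⊙ (λ _ → 0#)) i))) ⟩
        a + 0# + 0# ≈⟨ trans (+-identityʳ _) (+-identityʳ _) ⟩
        a ∎

    0<b : 0# < b
    0<b = +-positive 0<a (<⇒≤ 0<a)

    schur-psd : PSD schur
    schur-psd y = *-cancelˡ-≤ 0<a
      (≤-resp (sym (zeroʳ a)) (q-extend y) (N-psd (extend y)))

    result : (∃[ v ] (NonZero v × q schur v ≈ 0#)) ⊎ Dominates schur →
             (∃[ v ] (NonZero v × q N v ≈ 0#)) ⊎ Dominates N
    result (inj₁ (v , v≉0 , qv≈0)) = inj₁ (extend v
      , (λ z → v≉0 (λ i → *-integral (>⇒≉ 0<b) (z (suc i))))
      , trans (q-extend v) (trans (*-congˡ qv≈0) (zeroʳ a)))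
    result (inj₂ dom) = inj₂ λ M → let C″ , 0≤C″ , bound = dom (reduced M) in bounded M C″ 0≤C″ bound
      where
      bounded : ∀ M C″ → 0# ≤ C″ → (∀ y → q (reduced M) y ≤ C″ * q schur y) →
                ∃[ C ] (0# ≤ C × (∀ x → q M x ≤ C * q N x))
      bounded M C″ 0≤C″ bound = β * (D * (b + b))
          , *-nonNegative (<⇒≤ 0<β) (*-nonNegative 0≤D (<⇒≤ (+-positive 0<b (<⇒≤ 0<b))))
          , λ x → *-cancelˡ-≤ (*-positive 0<b 0<b) (≤-respʳ (rescale x) (main x))
        where
        b⁻² = inverse⁺ (*-positive 0<b 0<b)
        β = proj₁ b⁻²
        0<β = proj₁ (proj₂ b⁻²)
        bbβ≈1 = proj₂ (proj₂ b⁻²)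
        -- p + 1 may be negative, so P is an upper bound for it that is nonnegative whatever the
        -- sign of p. D serves both as factor of the square and as factor of the Schur part.
        P D : R
        P = p M * p M + 1# * 1# + 1#
        D = P + C″
        0≤P : 0# ≤ P
        0≤P = +-nonNegative (+-nonNegative (square-nonNegative _) (square-nonNegative 1#)) 0≤1
        0≤D : 0# ≤ D
        0≤D = +-nonNegative 0≤P 0≤C″
        p≤ : p M + 1# ≤ P
        p≤ = +-monoˡ-≤ 1# (≤-respˡ (*-identityʳ _) (*≤square+square (p M) 1#))
        rescale : ∀ x → D * ((b + b) * q N x) ≈ b * b * (β * (D * (b + b)) * q N x)
        rescale x = begin-equality
          D * ((b + b) * q N x)                      ≈⟨ *-identityˡ _ ⟨
          1# * (D * ((b + b) * q N x))               ≈⟨ *-congʳ bbβ≈1 ⟨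
          b * b * β * (D * ((b + b) * q N x))
            ≈⟨ solve 4 (λ b β D Q → b :* b :* β :* (D :* ((b :+ b) :* Q)) := b :* b :* (β :* (D :* (b :+ b)) :* Q))
                 refl b β D (q N x) ⟩
          b * b * (β * (D * (b + b)) * q N x)        ∎
        main : ∀ x → b * b * q M x ≤ D * ((b + b) * q N x)
        main x = begin
          b * b * q M x
            ≈⟨ q-reduced M x ⟩
          p M * (t * t) + t * e + q (reduced M) y - e * e
            ≤⟨ +-monoˡ-≤ (- (e * e)) (+-mono-≤ (+-mono-≤ ≤-refl (*≤square+square t e)) (bound y)) ⟩
          p M * (t * t) + (t * t + e * e) + C″ * S - e * e
            ≈⟨ solve 5 (λ p t e C S → p :* t :+ (t :+ e) :+ C :* S :- e := p :* t :+ t :+ C :* S)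
                 refl (p M) (t * t) (e * e) C″ S ⟩
          p M * (t * t) + t * t + C″ * S
            ≈⟨ +-congʳ (trans (+-congˡ (sym (*-identityˡ _))) (sym (distribʳ _ _ _))) ⟩
          (p M + 1#) * (t * t) + C″ * S
            ≤⟨ +-monoˡ-≤ (C″ * S) (*-monoʳ-≤ (square-nonNegative t) p≤) ⟩
          P * (t * t) + C″ * S
            ≤⟨ ≤-by _ (+-nonNegative (*-nonNegative 0≤C″ (square-nonNegative t)) (*-nonNegative 0≤P (schur-psd y)))
                 (solve 4 (λ P C t S → C :* t :+ P :* S := (P :+ C) :* (t :+ S) :- (P :* t :+ C :* S)) refl P C″ (t * t) S) ⟩
          D * (t * t + S)
            ≈⟨ *-congˡ (square+schur x) ⟩
          D * ((b + b) * q N x) ∎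
          where
          y = x ∘ suc
          t = linear x
          e = ⟪ η M , y ⟫
          S = q schur y

-- Eigenvectors from Rayleigh quotients, and the reverse Cauchy-Schwarz inequality.

module Spectrum (ℝ : CompleteOrderedField) where

  open OrderedField ℝ
  open QuadraticForm ℝ
  open ≤-Reasoning

  SymmetricMatrix : ∀ {n} → Matrix n → Set
  SymmetricMatrix M = ∀ i j → M i j ≈ M j i

  -- With r = form N v y and Q = q N y, the vector -(Q + 1) v + r y has value -(Q + 2) r², which
  -- semidefiniteness forces to be nonnegative, so r = 0. Taking y = N v makes the norm of N v
  -- vanish.
  psd-kernel : ∀ {n} {N : Matrix n} → SymmetricMatrix N → PSD N →
               ∀ v → q N v ≈ 0# → ∀ i → (N ⊙ v) i ≈ 0#
  psd-kernel {N = N} N-sym N-psd v qv≈0 i =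
    square≈0 (∑≈0⇒≈0 (λ i → square-nonNegative ((N ⊙ v) i)) (trans (form-sym N-sym (N ⊙ v) v) (orthogonal (N ⊙ v))) i)
    where
    orthogonal : ∀ y → form N v y ≈ 0#
    orthogonal y = square≈0 (O.antisym r²≤0 (square-nonNegative r))
      where
      r Q a : R
      r = form N v y
      Q = q N y
      a = - (Q + 1#)
      0<Q+1+1 : 0# < 1# + (Q + 1#)
      0<Q+1+1 = +-positive 0<1 (+-nonNegative (N-psd y) 0≤1)
      expand : q N (lin a v r y) ≈ - ((1# + (Q + 1#)) * (r * r))
      expand = begin-equality
        q N (lin a v r y)
          ≈⟨ q-lin N-sym a v r y ⟩
        a * a * q N v + (a * r + a * r) * r + r * r * Q
          ≈⟨ +-congʳ (+-congʳ (trans (*-congˡ qv≈0) (zeroʳ _))) ⟩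
        0# + (a * r + a * r) * r + r * r * Q
          ≈⟨ +-congʳ (+-identityˡ _) ⟩
        (a * r + a * r) * r + r * r * Q
          ≈⟨ solve 3 (λ Q e r → (:- (Q :+ e) :* r :+ :- (Q :+ e) :* r) :* r :+ r :* r :* Q :=
               :- ((e :+ (Q :+ e)) :* (r :* r))) refl Q 1# r ⟩
        - ((1# + (Q + 1#)) * (r * r)) ∎
      r²≤0 : r * r ≤ 0#
      r²≤0 = *-cancelˡ-≤ 0<Q+1+1 (≤-by _ (≤-respʳ expand (N-psd (lin a v r y)))
        (sym (trans (+-congʳ (zeroʳ _)) (+-identityˡ _))))

  -- Recursion on the indices, in place of a test for equality, lets `diag-⊙` follow the recursion
  -- of the sum.
  diag : ∀ {n} → Vector R n → Matrix n
  diag B zero zero = B zero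
  diag B zero (suc j) = 0#
  diag B (suc i) zero = 0#
  diag B (suc i) (suc j) = diag (B ∘ suc) i j

  diag-sym : ∀ {n} (B : Vector R n) → SymmetricMatrix (diag B)
  diag-sym B zero zero = refl
  diag-sym B zero (suc j) = refl
  diag-sym B (suc i) zero = refl
  diag-sym B (suc i) (suc j) = diag-sym (B ∘ suc) i j

  diag-⊙ : ∀ {n} (B x : Vector R n) i → (diag B ⊙ x) i ≈ B i * x i
  diag-⊙ B x zero = trans (+-congˡ (∑-zero (λ j → zeroˡ (x (suc j))))) (+-identityʳ _)
  diag-⊙ B x (suc i) = trans (+-cong (zeroˡ (x zero)) (diag-⊙ (B ∘ suc) (x ∘ suc) i)) (+-identityˡ _)

  module _ {n} {B : Vector R n} (B>0 : ∀ i → 0# < B i) where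

    q-diag-summand : ∀ x i → x i * (diag B ⊙ x) i ≈ B i * (x i * x i)
    q-diag-summand x i = trans (*-congˡ (diag-⊙ B x i))
      (solve 2 (λ b x → x :* (b :* x) := b :* (x :* x)) refl (B i) (x i))

    diag-psd : PSD (diag B)
    diag-psd x = ∑-nonNegative (λ i → ≤-respʳ (sym (q-diag-summand x i))
      (*-nonNegative (<⇒≤ (B>0 i)) (square-nonNegative (x i))))

    diag-definite : ∀ x → q (diag B) x ≈ 0# → ∀ i → x i ≈ 0#
    diag-definite x qx≈0 i = square≈0 (*-integral (>⇒≉ (B>0 i)) (trans (sym (q-diag-summand x i))
      (∑≈0⇒≈0 (λ i → ≤-respʳ (sym (q-diag-summand x i))
        (*-nonNegative (<⇒≤ (B>0 i)) (square-nonNegative (x i)))) qx≈0 i)))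

    diag-positive : ∀ {x} → NonZero x → 0# < q (diag B) x
    diag-positive {x} x≉0 = diag-psd x , λ e → x≉0 (diag-definite x (sym e))

    diag-dominates : Dominates (diag B)
    diag-dominates = nondegenerate (degenerate⊎dominates (diag B) diag-psd)
      where
      nondegenerate : (∃[ v ] (NonZero v × q (diag B) v ≈ 0#)) ⊎ Dominates (diag B) → Dominates (diag B)
      nondegenerate (inj₁ (v , v≉0 , qv≈0)) = ⊥-elim (v≉0 (diag-definite v qv≈0))
      nondegenerate (inj₂ dom) = dom

  q-zero : ∀ {n} (A : Matrix n) {x} → (∀ i → x i ≈ 0#) → q A x ≈ 0#
  q-zero A {x} x≈0 = ∑-zero (λ i → trans (*-congʳ (x≈0 i)) (zeroˡ ((A ⊙ x) i)))

  -- The largest generalised eigenvalue is the supremum of the Rayleigh quotients: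
  -- there μ B - A is positive semidefinite, and it dominates no multiple of B.
  module _ {n} {A : Matrix n} (A-sym : SymmetricMatrix A)
           {B : Vector R n} (B>0 : ∀ i → 0# < B i)
           (u : Vector R n) (qu>0 : 0# < q A u) where

    private
      D : Matrix n
      D = diag B

      -- The downward closure of the set of quotients q A x / q D x, written without division; it
      -- has the same supremum.
      Rayleigh : R → Set
      Rayleigh t = ∃[ x ] (NonZero x × t * q D x ≤ q A x)

      u≉0 : NonZero u
      u≉0 z = >⇒≉ qu>0 (q-zero A z)

      quotient∈Rayleigh : ∀ x → NonZero x → ∃[ t ] (Rayleigh t × t * q D x ≈ q A x)
      quotient∈Rayleigh x x≉0 = t , (x , x≉0 , O.reflexive eq) , eq
        where
        inv = inverse⁺ (diag-positive B>0 x≉0)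
        t = q A x * proj₁ inv
        eq : t * q D x ≈ q A x
        eq = begin-equality
          q A x * proj₁ inv * q D x     ≈⟨ *-assoc _ _ _ ⟩
          q A x * (proj₁ inv * q D x)   ≈⟨ *-congˡ (trans (*-comm _ _) (proj₂ (proj₂ inv))) ⟩
          q A x * 1#                    ≈⟨ *-identityʳ _ ⟩
          q A x                         ∎

      bounded : ∃ (UpperBound Rayleigh)
      bounded = C , λ { t (x , x≉0 , tx≤) → *-cancelˡ-≤ (diag-positive B>0 x≉0)
        (≤-resp (*-comm _ _) (*-comm _ _) (≤-trans tx≤ (proj₂ (proj₂ dom) x))) }
        where
        dom = diag-dominates B>0 A
        C = proj₁ dom

      top = supremum Rayleigh (_ , proj₁ (proj₂ (quotient∈Rayleigh u u≉0))) bounded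

      μ : R
      μ = proj₁ top

      0<μ : 0# < μ
      0<μ = ≰⇒> λ μ≤0 → <⇒≱ qu>0 (begin
        q A u          ≈⟨ proj₂ (proj₂ (quotient∈Rayleigh u u≉0)) ⟨
        t * q D u      ≤⟨ *-monoʳ-≤ (diag-psd B>0 u) (≤-trans t≤μ μ≤0) ⟩
        0# * q D u     ≈⟨ zeroˡ _ ⟩
        0#             ∎)
        where
        t = proj₁ (quotient∈Rayleigh u u≉0)
        t≤μ : t ≤ μ
        t≤μ = proj₁ (proj₂ top) t (proj₁ (proj₂ (quotient∈Rayleigh u u≉0)))

      N : Matrix n
      N i j = μ * D i j + (- 1#) * A i j

      N-sym : SymmetricMatrix N
      N-sym i j = +-cong (*-congˡ (diag-sym B i j)) (*-congˡ (A-sym i j))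

      minus : ∀ x → (- 1#) * x ≈ - x
      minus x = trans (sym (-‿distribˡ-* 1# x)) (-‿cong (*-identityˡ x))

      q-N : ∀ x → q N x ≈ μ * q D x - q A x
      q-N x = trans (form-linᴹ μ D (- 1#) A x x) (+-congˡ (minus (q A x)))

      qA≤μqD : ∀ x → q A x ≤ μ * q D x
      qA≤μqD x = cases (q D x ≟ 0#)
        where
        cases : Dec (q D x ≈ 0#) → q A x ≤ μ * q D x
        cases (yes e) = O.reflexive (trans (q-zero A (diag-definite B>0 x e)) (sym (trans (*-congˡ e) (zeroʳ μ))))
        cases (no ne) = ≤-respˡ (proj₂ (proj₂ t∈)) (*-monoʳ-≤ (diag-psd B>0 x) (proj₁ (proj₂ top) _ (proj₁ (proj₂ t∈))))
          where t∈ = quotient∈Rayleigh x (λ z → ne (q-zero D z))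

      N-psd : PSD N
      N-psd x = ≤-respʳ (sym (q-N x)) (y≤x⇒x-y≥0 (qA≤μqD x))

      -- If C N bounded D, then ε D ≤ N for ε = 1 / (1 + C), and μ - ε would still bound all
      -- Rayleigh quotients. The summand 1 keeps the denominator positive when C = 0.
      ¬dominates : ¬ Dominates N
      ¬dominates dom = <⇒≱ 0<ε (x-y≥0⇒y≤x (≤-respʳ
        (solve 2 (λ μ ε → (μ :- ε) :- μ := con (+ 0) :- ε) refl μ ε)
        (y≤x⇒x-y≥0 (proj₂ (proj₂ top) (μ - ε) upper))))
        where
        C = proj₁ (dom D)
        0≤C = proj₁ (proj₂ (dom D))
        C>0 : 0# < 1# + C
        C>0 = +-positive 0<1 0≤C
        ε = proj₁ (inverse⁺ C>0)
        0<ε : 0# < ε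
        0<ε = proj₁ (proj₂ (inverse⁺ C>0))
        [1+C]ε≈1 = proj₂ (proj₂ (inverse⁺ C>0))
        εqD≤qN : ∀ x → ε * q D x ≤ q N x
        εqD≤qN x = *-cancelˡ-≤ C>0 (begin
          (1# + C) * (ε * q D x)   ≈⟨ *-assoc _ _ _ ⟨
          (1# + C) * ε * q D x     ≈⟨ trans (*-congʳ [1+C]ε≈1) (*-identityˡ _) ⟩
          q D x                    ≤⟨ proj₂ (proj₂ (dom D)) x ⟩
          C * q N x                ≈⟨ +-identityˡ _ ⟨
          0# + C * q N x           ≤⟨ +-monoˡ-≤ _ (N-psd x) ⟩
          q N x + C * q N x        ≈⟨ +-congʳ (*-identityˡ _) ⟨
          1# * q N x + C * q N x   ≈⟨ distribʳ _ _ _ ⟨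
          (1# + C) * q N x         ∎)
        upper : UpperBound Rayleigh (μ - ε)
        upper t (x , x≉0 , tx≤) = *-cancelˡ-≤ (diag-positive B>0 x≉0) (begin
          q D x * t           ≈⟨ *-comm _ _ ⟩
          t * q D x           ≤⟨ tx≤ ⟩
          q A x               ≤⟨ ≤-by _ (y≤x⇒x-y≥0 (εqD≤qN x)) (trans (+-congʳ (q-N x))
                                   (solve 4 (λ μ ε d a → (μ :* d :- a) :- ε :* d := d :* (μ :- ε) :- a) refl μ ε (q D x) (q A x))) ⟩
          q D x * (μ - ε)     ∎)

    -- Since `N` = μ D - A is semidefinite but not dominating, it has a null vector, and
    -- `psd-kernel` turns that into an eigenvector. The vector `u` with q A u > 0 makes μ positive.
    positive-eigenvector : ∃[ μ ] ∃[ v ] (0# < μ × NonZero v × (∀ i → (A ⊙ v) i ≈ μ * (B i * v i)))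
    positive-eigenvector = extract (degenerate⊎dominates N N-psd)
      where
      extract : (∃[ v ] (NonZero v × q N v ≈ 0#)) ⊎ Dominates N →
                ∃[ μ ] ∃[ v ] (0# < μ × NonZero v × (∀ i → (A ⊙ v) i ≈ μ * (B i * v i)))
      extract (inj₂ dom) = ⊥-elim (¬dominates dom)
      extract (inj₁ (v , v≉0 , qv≈0)) = μ , v , 0<μ , v≉0 , λ i → begin-equality
        (A ⊙ v) i
          ≈⟨ +-identityˡ _ ⟨
        0# + (A ⊙ v) i
          ≈⟨ +-congʳ (psd-kernel N-sym N-psd v qv≈0 i) ⟨
        (N ⊙ v) i + (A ⊙ v) i
          ≈⟨ +-congʳ (⟪⟫-linˡ v μ (D i) (- 1#) (A i)) ⟩
        μ * (D ⊙ v) i + (- 1#) * (A ⊙ v) i + (A ⊙ v) i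
          ≈⟨ +-congʳ (+-congˡ (minus _)) ⟩
        μ * (D ⊙ v) i - (A ⊙ v) i + (A ⊙ v) i
          ≈⟨ solve 2 (λ x a → x :- a :+ a := x) refl (μ * (D ⊙ v) i) ((A ⊙ v) i) ⟩
        μ * (D ⊙ v) i
          ≈⟨ *-congˡ (diag-⊙ B v i) ⟩
        μ * (B i * v i) ∎

  -- For a symmetric matrix this is equivalent to having at most one positive eigenvalue, counted
  -- with multiplicity.
  ReverseCauchySchwarz : ∀ {n} → Matrix n → Set
  ReverseCauchySchwarz A = ∀ f u → 0# ≤ q A f → q A f * q A u ≤ form A f u * form A f u

  -- With α = ⟪ v , f ⟫ and β = ⟪ v , u ⟫, the vector z = α u - β f lies in the hyperplane, and α²
  -- (r² - p Q) = (α r - β p)² - p q A z. If p > 0 then α ≠ 0, since otherwise f itself would lie in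
  -- the hyperplane.
  nonPositive-on-hyperplane⇒RCS : ∀ {n} {A : Matrix n} → SymmetricMatrix A →
    ∀ v → (∀ z → ⟪ v , z ⟫ ≈ 0# → q A z ≤ 0#) → ReverseCauchySchwarz A
  nonPositive-on-hyperplane⇒RCS {A = A} A-sym v neg f u 0≤p = cases (p ≟ 0#)
    where
    p Q r α β : R
    p = q A f
    Q = q A u
    r = form A f u
    α = ⟪ v , f ⟫
    β = ⟪ v , u ⟫
    cases : Dec (p ≈ 0#) → p * Q ≤ r * r
    cases (yes p≈0) = ≤-respˡ (sym (trans (*-congʳ p≈0) (zeroˡ Q))) (square-nonNegative r)
    cases (no p≉0) = *-cancelˡ-≤ (square-positive α≉0) (≤-by _
        (+-nonNegative (square-nonNegative (α * r - β * p)) (*-nonNegative 0≤p (neg-nonNegative (neg z z⊥))))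
        (trans (+-congˡ (*-congˡ (-‿cong q-z)))
          (solve 5 (λ α β p Q r →
            (α :* r :- β :* p) :* (α :* r :- β :* p)
              :+ p :* :- (α :* α :* Q :+ (α :* :- β :+ α :* :- β) :* r :+ :- β :* :- β :* p)
            := α :* α :* (r :* r) :- α :* α :* (p :* Q)) refl α β p Q r)))
      where
      α≉0 : ¬ (α ≈ 0#)
      α≉0 α≈0 = p≉0 (O.antisym (neg f α≈0) 0≤p)
      z = lin α u (- β) f
      z⊥ : ⟪ v , z ⟫ ≈ 0#
      z⊥ = trans (⟪⟫-linʳ v α u (- β) f)
        (solve 2 (λ α β → α :* β :+ :- β :* α := con (+ 0)) refl α β)
      q-z : q A z ≈ α * α * Q + (α * - β + α * - β) * r + - β * - β * p
      q-z = trans (q-lin A-sym α u (- β) f) (+-congʳ (+-congˡ (*-congˡ (form-sym A-sym u f))))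

  form-eigen : ∀ {n} {A : Matrix n} → SymmetricMatrix A → ∀ {μ v} → (∀ i → (A ⊙ v) i ≈ μ * v i) →
               ∀ w → form A v w ≈ μ * ⟪ v , w ⟫
  form-eigen {A = A} A-sym {μ} {v} eq w = begin-equality
    form A v w                    ≈⟨ form-sym A-sym v w ⟩
    ⟪ w , A ⊙ v ⟫                 ≈⟨ ⟪⟫-cong {x = w} (λ _ → refl) eq ⟩
    ⟪ w , (λ i → μ * v i) ⟫       ≈⟨ ⟪⟫-scaleʳ μ w v ⟩
    μ * ⟪ w , v ⟫                 ≈⟨ *-congˡ (⟪⟫-comm w v) ⟩
    μ * ⟪ v , w ⟫                 ∎

  module _ (G : WeightedGraph ℝ) (G-anti : Antiferromagnetic ℝ G) where
    open WeightedGraph G renaming (order to n; weight to A; symm to A-sym)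
    open Antiferromagnetic G-anti

    private
      -- Deflation: `A′` is s A - μ v vᵀ with s = ⟪ v , v ⟫, so it kills v and agrees with s A on
      -- the complement of v. A vector z there with q A z > 0 would give `A′` a positive eigenvector
      -- w. It is orthogonal to v, hence an eigenvector of A; `unique` gives it the eigenvalue μ and
      -- `simple` makes it a multiple of v, so w = 0.
      deflated-nonPositive : ∀ {μ v} → 0# < μ → NonZero v → (∀ i → (A ⊙ v) i ≈ μ * v i) →
                             ∀ z → ⟪ v , z ⟫ ≈ 0# → q A z ≤ 0#
      deflated-nonPositive {μ} {v} 0<μ v≉0 eq z v⊥z = ≮⇒≥ λ 0<qz →
        absurd (positive-eigenvector A′-sym {B = λ _ → 1#} (λ _ → 0<1) z
          (<-respʳ (sym (q-A′ z v⊥z)) (*-positive 0<s 0<qz)))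
        where
        s : R
        s = ⟪ v , v ⟫
        0<s : 0# < s
        0<s = ∑-nonNegative (λ i → square-nonNegative (v i)) ,
          λ e → v≉0 (λ i → square≈0 (∑≈0⇒≈0 (λ i → square-nonNegative (v i)) (sym e) i))
        A′ : Matrix n
        A′ i j = s * A i j + (- μ) * (v ⊗ᵛ v) i j
        A′-sym : SymmetricMatrix A′
        A′-sym i j = +-cong (*-congˡ (A-sym i j)) (*-congˡ (*-comm (v i) (v j)))
        A′-⊙ : ∀ y i → (A′ ⊙ y) i ≈ s * (A ⊙ y) i + (- μ) * (⟪ v , y ⟫ * v i)
        A′-⊙ y i = trans (⟪⟫-linˡ y s (A i) (- μ) ((v ⊗ᵛ v) i)) (+-congˡ (*-congˡ (⊗ᵛ-⊙ v v y i)))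
        vanish : ∀ a {b c} → b ≈ 0# → a + (- μ) * (b * c) ≈ a
        vanish a b≈0 = trans (+-congˡ (trans (*-congˡ (trans (*-congʳ b≈0) (zeroˡ _))) (zeroʳ _))) (+-identityʳ a)
        q-A′ : ∀ y → ⟪ v , y ⟫ ≈ 0# → q A′ y ≈ s * q A y
        q-A′ y v⊥y = trans (form-linᴹ s A (- μ) (v ⊗ᵛ v) y y)
          (trans (+-congˡ (*-congˡ (form-⊗ᵛ v v y y))) (vanish _ v⊥y))
        form-A′ : ∀ w → form A′ v w ≈ 0#
        form-A′ w = begin-equality
          form A′ v w
            ≈⟨ form-linᴹ s A (- μ) (v ⊗ᵛ v) v w ⟩
          s * form A v w + (- μ) * form (v ⊗ᵛ v) v w
            ≈⟨ +-cong (*-congˡ (form-eigen A-sym eq w)) (*-congˡ (form-⊗ᵛ v v v w)) ⟩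
          s * (μ * ⟪ v , w ⟫) + (- μ) * (s * ⟪ v , w ⟫)
            ≈⟨ solve 3 (λ s μ x → s :* (μ :* x) :+ :- μ :* (s :* x) := con (+ 0)) refl s μ ⟪ v , w ⟫ ⟩
          0# ∎
        absurd : ∃[ ν ] ∃[ w ] (0# < ν × NonZero w × (∀ i → (A′ ⊙ w) i ≈ ν * (1# * w i))) → ⊥
        absurd (ν , w , 0<ν , w≉0 , eq′) = w≉0 λ i → trans (w≈cv i) (trans (*-congʳ c≈0) (zeroˡ _))
          where
          v⊥w : ⟪ v , w ⟫ ≈ 0#
          v⊥w = *-integral (>⇒≉ 0<ν) (trans (sym (trans
            (⟪⟫-cong {x = v} (λ _ → refl) (λ i → trans (eq′ i) (*-congˡ (*-identityˡ (w i)))))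
            (⟪⟫-scaleʳ ν v w))) (form-A′ w))
          s⁻¹ = proj₁ (inverse⁺ 0<s)
          ν′ : R
          ν′ = s⁻¹ * ν
          0<ν′ : 0# < ν′
          0<ν′ = *-positive (proj₁ (proj₂ (inverse⁺ 0<s))) 0<ν
          eq-w : ∀ i → (A ⊙ w) i ≈ ν′ * w i
          eq-w i = begin-equality
            (A ⊙ w) i                    ≈⟨ *-identityˡ _ ⟨
            1# * (A ⊙ w) i               ≈⟨ *-congʳ (trans (*-comm _ _) (proj₂ (proj₂ (inverse⁺ 0<s)))) ⟨
            s⁻¹ * s * (A ⊙ w) i          ≈⟨ *-assoc _ _ _ ⟩
            s⁻¹ * (s * (A ⊙ w) i)        ≈⟨ *-congˡ (trans (sym (vanish _ v⊥w)) (sym (A′-⊙ w i))) ⟩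
            s⁻¹ * (A′ ⊙ w) i             ≈⟨ *-congˡ (trans (eq′ i) (*-congˡ (*-identityˡ _))) ⟩
            s⁻¹ * (ν * w i)              ≈⟨ *-assoc _ _ _ ⟨
            ν′ * w i                     ∎
          v-eigen : IsEigenvector ℝ G μ v
          v-eigen = record { nonZero = v≉0 ; equation = eq }
          ν′≈μ : ν′ ≈ μ
          ν′≈μ = unique 0<ν′ 0<μ (record { nonZero = w≉0 ; equation = eq-w }) v-eigen
          w-eigen : IsEigenvector ℝ G μ w
          w-eigen = record { nonZero = w≉0 ; equation = λ i → trans (eq-w i) (*-congʳ ν′≈μ) }
          multiple = simple 0<μ v-eigen w-eigen
          c = proj₁ multiple
          w≈cv = proj₂ multiple
          c≈0 : c ≈ 0#
          c≈0 = *-integral (>⇒≉ 0<s) (begin-equality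
            s * c                          ≈⟨ *-comm _ _ ⟩
            c * ⟪ v , v ⟫                  ≈⟨ ⟪⟫-scaleʳ c v v ⟨
            ⟪ v , (λ i → c * v i) ⟫        ≈⟨ ⟪⟫-cong {x = v} (λ _ → refl) w≈cv ⟨
            ⟪ v , w ⟫                      ≈⟨ v⊥w ⟩
            0#                             ∎)

    antiferromagnetic⇒RCS : ReverseCauchySchwarz A
    antiferromagnetic⇒RCS f u 0≤p = cases (q A f ≟ 0#)
      where
      cases : Dec (q A f ≈ 0#) → q A f * q A u ≤ form A f u * form A f u
      cases (yes p≈0) = ≤-respˡ (sym (trans (*-congʳ p≈0) (zeroˡ _))) (square-nonNegative _)
      cases (no p≉0) = top (positive-eigenvector A-sym {B = λ _ → 1#} (λ _ → 0<1) f (0≤p , λ e → p≉0 (sym e)))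
        where
        top : ∃[ μ ] ∃[ v ] (0# < μ × NonZero v × (∀ i → (A ⊙ v) i ≈ μ * (1# * v i))) →
              q A f * q A u ≤ form A f u * form A f u
        top (μ , v , 0<μ , v≉0 , eq) = nonPositive-on-hyperplane⇒RCS A-sym v
          (deflated-nonPositive 0<μ v≉0 (λ i → trans (eq i) (*-congˡ (*-identityˡ (v i))))) f u 0≤p

-- The Bochner method for matrices with positive entries.

module Bochner (ℝ : CompleteOrderedField) where

  open OrderedField ℝ
  open QuadraticForm ℝ
  open Spectrum ℝ
  open ≤-Reasoning

  scale : ∀ {n} → Vector R n → Matrix n → Matrix n
  scale c A i j = c i * c j * A i j

  scale-⊙ : ∀ {n} (c : Vector R n) A y i → (scale c A ⊙ y) i ≈ c i * (A ⊙ (λ j → c j * y j)) i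
  scale-⊙ c A y i = trans
    (∑-cong (λ j → solve 4 (λ a b m y → a :* b :* m :* y := a :* (m :* (b :* y))) refl (c i) (c j) (A i j) (y j)))
    (sym (*-distribˡ-sum (c i) (λ j → A i j * (c j * y j))))

  form-scale : ∀ {n} (c : Vector R n) A x y →
               form (scale c A) x y ≈ form A (λ i → c i * x i) (λ i → c i * y i)
  form-scale c A x y = ∑-cong (λ i → trans (*-congˡ (scale-⊙ c A y i))
    (solve 3 (λ x c z → x :* (c :* z) := c :* x :* z) refl (x i) (c i) ((A ⊙ (λ j → c j * y j)) i)))

  RCS-scale : ∀ {n} (c : Vector R n) {A} → ReverseCauchySchwarz A → ReverseCauchySchwarz (scale c A)
  RCS-scale c {A} rcs f u 0≤p = ≤-resp
    (sym (*-cong (form-scale c A f f) (form-scale c A u u)))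
    (sym (*-cong (form-scale c A f u) (form-scale c A f u)))
    (rcs (λ i → c i * f i) (λ i → c i * u i) (≤-respʳ (form-scale c A f f) 0≤p))

  RCS-cong : ∀ {n} {A A′ : Matrix n} → (∀ i j → A i j ≈ A′ i j) → ReverseCauchySchwarz A → ReverseCauchySchwarz A′
  RCS-cong {A = A} {A′} eq rcs f u 0≤p = ≤-resp
    (*-cong (form-cong eq f f) (form-cong eq u u))
    (*-cong (form-cong eq f u) (form-cong eq f u))
    (rcs f u (≤-respʳ (sym (form-cong eq f f)) 0≤p))

  -- Eigenvalues λ are taken relative to the row sums B, so the constant vector has λ = 1. The
  -- hypotheses split q A u into local terms with B κ ≤ (A u)²; on an eigenvector, summation gives λ
  -- ≤ λ², hence λ ≥ 1 for every positive λ.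
  module Normalised {n} {A : Matrix (suc n)} (A-sym : SymmetricMatrix A) (A>0 : ∀ i j → 0# < A i j)
    (κ : Vector R (suc n) → Vector R (suc n))
    (∑κ : ∀ u → q A u ≈ ∑ (κ u))
    (κ≤ : ∀ u i → ∑ (A i) * κ u i ≤ (A ⊙ u) i * (A ⊙ u) i) where

    private
      B one : Vector R (suc n)
      B i = ∑ (A i)
      one i = 1#

      B>0 : ∀ i → 0# < B i
      B>0 i = ∑-positive (A>0 i)

      β : R
      β = ∑ B

      β>0 : 0# < β
      β>0 = ∑-positive B>0

      -- β A with the constant eigenvector deflated: `A′` kills `one`. A generalised eigenvalue μ of
      -- `A′` thus stands for λ = μ / β.
      A′ : Matrix (suc n)
      A′ i j = β * A i j + (- 1#) * (B ⊗ᵛ B) i j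

      A′-sym : SymmetricMatrix A′
      A′-sym i j = +-cong (*-congˡ (A-sym i j)) (*-congˡ (*-comm (B i) (B j)))

      minus : ∀ x → (- 1#) * x ≈ - x
      minus x = trans (sym (-‿distribˡ-* 1# x)) (-‿cong (*-identityˡ x))

      ⟪,one⟫ : ∀ x → ⟪ x , one ⟫ ≈ ∑ x
      ⟪,one⟫ x = ∑-cong (λ i → *-identityʳ (x i))

      form-A′ : ∀ x y → form A′ x y ≈ β * form A x y - ⟪ B , x ⟫ * ⟪ B , y ⟫
      form-A′ x y = trans (form-linᴹ β A (- 1#) (B ⊗ᵛ B) x y) (+-congˡ (trans (minus _) (-‿cong (form-⊗ᵛ B B x y))))

      form-one : ∀ y → form A one y ≈ ⟪ B , y ⟫
      form-one y = trans (form-sym A-sym one y) (trans (⟪⟫-cong {x = y} (λ _ → refl) (λ i → ⟪,one⟫ (A i))) (⟪⟫-comm y B))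

      form-A′-one : ∀ y → form A′ one y ≈ 0#
      form-A′-one y = begin-equality
        form A′ one y                                   ≈⟨ form-A′ one y ⟩
        β * form A one y - ⟪ B , one ⟫ * ⟪ B , y ⟫      ≈⟨ +-cong (*-congˡ (form-one y)) (-‿cong (*-congʳ (⟪,one⟫ B))) ⟩
        β * ⟪ B , y ⟫ - β * ⟪ B , y ⟫                   ≈⟨ -‿inverseʳ _ ⟩
        0#                                              ∎

      module Eigen {μ v} (0<μ : 0# < μ) (v≉0 : NonZero v) (eq : ∀ i → (A′ ⊙ v) i ≈ μ * (B i * v i)) where

        B⊥v : ⟪ B , v ⟫ ≈ 0#
        B⊥v = *-integral (>⇒≉ 0<μ) (begin-equality
          μ * ⟪ B , v ⟫                     ≈⟨ *-distribˡ-sum μ (λ i → B i * v i) ⟩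
          ∑ (λ i → μ * (B i * v i))         ≈⟨ ∑-cong (λ i → trans (*-identityˡ _) (eq i)) ⟨
          form A′ one v                     ≈⟨ form-A′-one v ⟩
          0#                                ∎)

        eq-A : ∀ i → β * (A ⊙ v) i ≈ μ * (B i * v i)
        eq-A i = begin-equality
          β * (A ⊙ v) i                                 ≈⟨ +-identityʳ _ ⟨
          β * (A ⊙ v) i + 0#                            ≈⟨ +-congˡ (trans (*-congˡ (trans (*-congʳ B⊥v) (zeroˡ (B i)))) (zeroʳ (- 1#))) ⟨
          β * (A ⊙ v) i + (- 1#) * (⟪ B , v ⟫ * B i)    ≈⟨ +-congˡ (*-congˡ (⊗ᵛ-⊙ B B v i)) ⟨
          β * (A ⊙ v) i + (- 1#) * ((B ⊗ᵛ B) ⊙ v) i     ≈⟨ ⟪⟫-linˡ v β (A i) (- 1#) ((B ⊗ᵛ B) i) ⟨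
          (A′ ⊙ v) i                                    ≈⟨ eq i ⟩
          μ * (B i * v i)                               ∎

        s : R
        s = ∑ (λ i → B i * (v i * v i))

        summand≥0 : ∀ i → 0# ≤ B i * (v i * v i)
        summand≥0 i = *-nonNegative (<⇒≤ (B>0 i)) (square-nonNegative (v i))

        0<s : 0# < s
        0<s = ∑-nonNegative summand≥0 , λ e → v≉0 (λ i →
          square≈0 (*-integral (>⇒≉ (B>0 i)) (∑≈0⇒≈0 summand≥0 (sym e) i)))

        βq≈μs : β * q A v ≈ μ * s
        βq≈μs = begin-equality
          β * q A v                               ≈⟨ ⟪⟫-scaleʳ β v (A ⊙ v) ⟨
          ⟪ v , (λ i → β * (A ⊙ v) i) ⟫           ≈⟨ ∑-cong (λ i → trans (*-congˡ (eq-A i))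
                                                       (solve 3 (λ v μ b → v :* (μ :* (b :* v)) := μ :* (b :* (v :* v))) refl (v i) μ (B i))) ⟩
          ∑ (λ i → μ * (B i * (v i * v i)))       ≈⟨ *-distribˡ-sum μ (λ i → B i * (v i * v i)) ⟨
          μ * s                                   ∎

        -- This is λ ≥ 1: `κ≤` for the eigenvector, summed over i, reads λ s ≤ λ² s after division
        -- by β².
        β≤μ : β ≤ μ
        β≤μ = *-cancelˡ-≤ (*-positive 0<μ 0<s) (begin
          μ * s * β
            ≈⟨ *-congʳ βq≈μs ⟨
          β * q A v * β
            ≈⟨ trans (*-assoc _ _ _) (trans (*-congˡ (*-comm _ _)) (trans (sym (*-assoc _ _ _)) (*-congˡ (∑κ v)))) ⟩
          β * β * ∑ (κ v)
            ≈⟨ *-distribˡ-sum (β * β) (κ v) ⟩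
          ∑ (λ i → β * β * κ v i)
            ≤⟨ ∑-mono local ⟩
          ∑ (λ i → μ * μ * (B i * (v i * v i)))
            ≈⟨ *-distribˡ-sum (μ * μ) (λ i → B i * (v i * v i)) ⟨
          μ * μ * s
            ≈⟨ solve 2 (λ μ s → μ :* μ :* s := μ :* s :* μ) refl μ s ⟩
          μ * s * μ ∎)
          where
          local : ∀ i → β * β * κ v i ≤ μ * μ * (B i * (v i * v i))
          local i = *-cancelˡ-≤ (B>0 i) (begin
            B i * (β * β * κ v i)
              ≈⟨ solve 3 (λ b β k → b :* (β :* β :* k) := β :* β :* (b :* k)) refl (B i) β (κ v i) ⟩
            β * β * (B i * κ v i)
              ≤⟨ *-monoˡ-≤ (square-nonNegative β) (κ≤ v i) ⟩
            β * β * ((A ⊙ v) i * (A ⊙ v) i)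
              ≈⟨ solve 2 (λ β a → β :* β :* (a :* a) := β :* a :* (β :* a)) refl β ((A ⊙ v) i) ⟩
            β * (A ⊙ v) i * (β * (A ⊙ v) i)
              ≈⟨ *-cong (eq-A i) (eq-A i) ⟩
            μ * (B i * v i) * (μ * (B i * v i))
              ≈⟨ solve 3 (λ μ b v → μ :* (b :* v) :* (μ :* (b :* v)) := b :* (μ :* μ :* (b :* (v :* v)))) refl μ (B i) (v i) ⟩
            B i * (μ * μ * (B i * (v i * v i))) ∎)

        edge : Fin (suc n) → Fin (suc n) → R
        edge i j = A i j * ((v i - v j) * (v i - v j))

        edge≥0 : ∀ i j → 0# ≤ edge i j
        edge≥0 i j = *-nonNegative (<⇒≤ (A>0 i j)) (square-nonNegative _)

        dirichlet : R
        dirichlet = ∑ (λ i → ∑ (edge i))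

        -- Expanding the squares, the two diagonal terms sum to s each because B consists of row
        -- sums and A is symmetric. Dirichlet energy is nonnegative, which is the bound λ ≤ 1;
        -- together with `β≤μ` it must vanish.
        dirichlet-eq : dirichlet + (q A v + q A v) ≈ s + s
        dirichlet-eq = begin-equality
          dirichlet + (q A v + q A v)
            ≈⟨ +-congˡ (+-cong flatten flatten) ⟩
          dirichlet + (∑ (λ i → ∑ (cross i)) + ∑ (λ i → ∑ (cross i)))
            ≈⟨ +-congˡ (trans (∑-cong (λ i → ∑-distrib-+ (cross i) (cross i)))
                 (∑-distrib-+ (λ i → ∑ (cross i)) (λ i → ∑ (cross i)))) ⟨
          dirichlet + ∑ (λ i → ∑ (λ j → cross i j + cross i j))
            ≈⟨ trans (∑-cong (λ i → ∑-distrib-+ (edge i) (λ j → cross i j + cross i j)))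
                 (∑-distrib-+ (λ i → ∑ (edge i)) (λ i → ∑ (λ j → cross i j + cross i j))) ⟨
          ∑ (λ i → ∑ (λ j → edge i j + (cross i j + cross i j)))
            ≈⟨ ∑-cong (λ i → ∑-cong (λ j → solve 3 (λ a x y →
                 a :* ((x :- y) :* (x :- y)) :+ (x :* (a :* y) :+ x :* (a :* y)) := a :* (x :* x) :+ a :* (y :* y))
                 refl (A i j) (v i) (v j))) ⟩
          ∑ (λ i → ∑ (λ j → A i j * (v i * v i) + A i j * (v j * v j)))
            ≈⟨ trans (∑-cong (λ i → ∑-distrib-+ (λ j → A i j * (v i * v i)) (λ j → A i j * (v j * v j))))
                 (∑-distrib-+ (λ i → ∑ (λ j → A i j * (v i * v i))) (λ i → ∑ (λ j → A i j * (v j * v j)))) ⟩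
          ∑ (λ i → ∑ (λ j → A i j * (v i * v i))) + ∑ (λ i → ∑ (λ j → A i j * (v j * v j)))
            ≈⟨ +-cong rows (trans (∑-comm (λ i j → A i j * (v j * v j)))
                 (trans (∑-cong (λ j → ∑-cong (λ i → *-congʳ {v j * v j} (A-sym i j)))) rows)) ⟩
          s + s ∎
          where
          cross : Fin (suc n) → Fin (suc n) → R
          cross i j = v i * (A i j * v j)
          flatten : q A v ≈ ∑ (λ i → ∑ (cross i))
          flatten = ∑-cong (λ i → *-distribˡ-sum (v i) (λ j → A i j * v j))
          rows : ∑ (λ i → ∑ (λ j → A i j * (v i * v i))) ≈ s
          rows = ∑-cong (λ i → sym (*-distribʳ-sum (v i * v i) (A i)))

        dirichlet≤0 : dirichlet ≤ 0#
        dirichlet≤0 = *-cancelˡ-≤ β>0 (≤-by _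
          (+-nonNegative (*-nonNegative (<⇒≤ 0<s) (y≤x⇒x-y≥0 β≤μ)) (*-nonNegative (<⇒≤ 0<s) (y≤x⇒x-y≥0 β≤μ)))
          (begin-equality
          s * (μ - β) + s * (μ - β)
            ≈⟨ solve 3 (λ s μ β → s :* (μ :- β) :+ s :* (μ :- β) := (μ :* s :+ μ :* s) :- β :* (s :+ s)) refl s μ β ⟩
          (μ * s + μ * s) - β * (s + s)
            ≈⟨ +-cong (+-cong βq≈μs βq≈μs) (-‿cong (*-congˡ dirichlet-eq)) ⟨
          (β * q A v + β * q A v) - β * (dirichlet + (q A v + q A v))
            ≈⟨ solve 3 (λ β Q d → (β :* Q :+ β :* Q) :- β :* (d :+ (Q :+ Q)) := β :* con (+ 0) :- β :* d)
                 refl β (q A v) dirichlet ⟩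
          β * 0# - β * dirichlet ∎))

        -- Every entry of A is positive, so zero Dirichlet energy equates the values at any two
        -- indices. A constant vector orthogonal to B is zero, which is the contradiction in
        -- `absurd`.
        v-constant : ∀ i j → v i ≈ v j
        v-constant i j = begin-equality
          v i                 ≈⟨ solve 2 (λ x y → x := x :- y :+ y) refl (v i) (v j) ⟩
          v i - v j + v j     ≈⟨ +-congʳ (square≈0 (*-integral (>⇒≉ (A>0 i j)) (∑≈0⇒≈0 (edge≥0 i)
                                   (∑≈0⇒≈0 (λ i → ∑-nonNegative (edge≥0 i))
                                     (O.antisym dirichlet≤0 (∑-nonNegative (λ i → ∑-nonNegative (edge≥0 i)))) i) j))) ⟩
          0# + v j            ≈⟨ +-identityˡ _ ⟩
          v j                 ∎

        absurd : ⊥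
        absurd = v≉0 λ j → *-integral (>⇒≉ β>0) (begin-equality
          β * v j                     ≈⟨ *-distribʳ-sum (v j) B ⟩
          ∑ (λ i → B i * v j)         ≈⟨ ∑-cong (λ i → *-congˡ {B i} (v-constant i j)) ⟨
          ⟪ B , v ⟫                   ≈⟨ B⊥v ⟩
          0#                          ∎)

    nonPositive : ∀ z → ⟪ B , z ⟫ ≈ 0# → q A z ≤ 0#
    nonPositive z B⊥z = ≮⇒≥ λ 0<qz →
      let μ , v , 0<μ , v≉0 , eq = positive-eigenvector A′-sym B>0 z (<-respʳ (sym q-A′) (*-positive β>0 0<qz))
      in Eigen.absurd 0<μ v≉0 eq
      where
      q-A′ : q A′ z ≈ β * q A z
      q-A′ = begin-equality
        q A′ z                                  ≈⟨ form-A′ z z ⟩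
        β * q A z - ⟪ B , z ⟫ * ⟪ B , z ⟫       ≈⟨ +-congˡ (-‿cong (trans (*-congʳ B⊥z) (zeroˡ _))) ⟩
        β * q A z - 0#                          ≈⟨ solve 1 (λ x → x :- con (+ 0) := x) refl (β * q A z) ⟩
        β * q A z                               ∎

    rcs : ReverseCauchySchwarz A
    rcs = nonPositive-on-hyperplane⇒RCS A-sym B nonPositive

  -- The congruence by the diagonal matrix of h turns h into the constant vector and A h into the
  -- row sums up to the factor h, which is the situation of `Normalised`; the congruence by 1 / h
  -- returns to A.
  bochner : ∀ {n} {A : Matrix (suc n)} → SymmetricMatrix A → (∀ i j → 0# < A i j) →
            ∀ {h} → (∀ i → 0# < h i) → (Q : Vector R (suc n) → Vector R (suc n)) →
            (∀ u → q A u ≈ ⟪ h , Q u ⟫) →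
            (∀ u i → (A ⊙ h) i * Q u i ≤ (A ⊙ u) i * (A ⊙ u) i) →
            ReverseCauchySchwarz A
  bochner {n} {A} A-sym A>0 {h} h>0 Q ∑Q Q≤ = RCS-cong unscale (RCS-scale h⁻¹ {scale h A} Ã-rcs)
    where
    h⁻¹ : Vector R (suc n)
    h⁻¹ i = proj₁ (inverse⁺ (h>0 i))

    unit : ∀ i → h i * h⁻¹ i ≈ 1#
    unit i = proj₂ (proj₂ (inverse⁺ (h>0 i)))

    unscale : ∀ i j → scale h⁻¹ (scale h A) i j ≈ A i j
    unscale i j = begin-equality
      h⁻¹ i * h⁻¹ j * (h i * h j * A i j)
        ≈⟨ solve 5 (λ a b c d m → c :* d :* (a :* b :* m) := (a :* c) :* ((b :* d) :* m)) refl (h i) (h j) (h⁻¹ i) (h⁻¹ j) (A i j) ⟩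
      h i * h⁻¹ i * (h j * h⁻¹ j * A i j)
        ≈⟨ *-cong (unit i) (*-congʳ (unit j)) ⟩
      1# * (1# * A i j)
        ≈⟨ trans (*-identityˡ _) (*-identityˡ _) ⟩
      A i j ∎

    row : ∀ i → ∑ (scale h A i) ≈ h i * (A ⊙ h) i
    row i = trans (∑-cong (λ j → solve 3 (λ a b m → a :* b :* m := a :* (m :* b)) refl (h i) (h j) (A i j)))
      (sym (*-distribˡ-sum (h i) (λ j → A i j * h j)))

    Ã-rcs : ReverseCauchySchwarz (scale h A)
    Ã-rcs = Normalised.rcs
      (λ i j → *-cong (*-comm (h i) (h j)) (A-sym i j))
      (λ i j → *-positive (*-positive (h>0 i) (h>0 j)) (A>0 i j))
      (λ u i → h i * Q (λ j → h j * u j) i)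
      (λ u → trans (form-scale h A u u) (∑Q (λ j → h j * u j)))
      (λ u i → let u′ = λ j → h j * u j in begin
        ∑ (scale h A i) * (h i * Q u′ i)
          ≈⟨ *-congʳ (row i) ⟩
        h i * (A ⊙ h) i * (h i * Q u′ i)
          ≈⟨ solve 3 (λ h a k → h :* a :* (h :* k) := h :* h :* (a :* k)) refl (h i) ((A ⊙ h) i) (Q u′ i) ⟩
        h i * h i * ((A ⊙ h) i * Q u′ i)
          ≤⟨ *-monoˡ-≤ (square-nonNegative (h i)) (Q≤ u′ i) ⟩
        h i * h i * ((A ⊙ u′) i * (A ⊙ u′) i)
          ≈⟨ solve 2 (λ h a → h :* h :* (a :* a) := h :* a :* (h :* a)) refl (h i) ((A ⊙ u′) i) ⟩
        h i * (A ⊙ u′) i * (h i * (A ⊙ u′) i)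
          ≈⟨ *-cong (scale-⊙ h A u i) (scale-⊙ h A u i) ⟨
        (scale h A ⊙ u) i * (scale h A ⊙ u) i ∎)

-- Partition functions, and log-concavity for complete graphs.

module PartitionFunctions (ℝ : CompleteOrderedField) where

  open OrderedField ℝ
  open QuadraticForm ℝ
  open Spectrum ℝ
  open Bochner ℝ
  open ≤-Reasoning

  -- Abstracts the summation so that the same partition function serves spins, summed by `∑`, and
  -- pairs of spins, summed by `∑²`.
  record IsSum {X : Set} (Sum : (X → R) → R) : Set where
    field
      Sum-cong        : ∀ {f g} → (∀ x → f x ≈ g x) → Sum f ≈ Sum g
      Sum-mono        : ∀ {f g} → (∀ x → f x ≤ g x) → Sum f ≤ Sum g
      Sum-distribˡ    : ∀ c f → c * Sum f ≈ Sum (λ x → c * f x)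
      Sum-swap        : ∀ (F : X → X → R) → Sum (λ x → Sum (λ y → F x y)) ≈ Sum (λ y → Sum (λ x → F x y))

  ∑-isSum : ∀ n → IsSum (∑ {n})
  ∑-isSum n = record
    { Sum-cong = ∑-cong ; Sum-mono = ∑-mono
    ; Sum-distribˡ = *-distribˡ-sum ; Sum-swap = ∑-comm }

  -- The partition function of a pairwise interaction model on a list of sites,
  -- summing over the spin of the first site and absorbing its interactions into
  -- the weights of the remaining sites.
  module _ {X : Set} (Sum : (X → R) → R) where

    Weight Interaction : Set → Set
    Weight U = U → X → R
    Interaction U = U → U → X → X → R

    tilt : ∀ {U} → Interaction U → Weight U → U → X → Weight U
    tilt I w u x v y = w v y * I u v x y

    Z : ∀ {U} → Interaction U → List U → Weight U → R
    Z I [] w = 1#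
    Z I (u ∷ us) w = Sum (λ x → w u x * Z I us (tilt I w u x))

  module PartitionFunction {X : Set} {Sum : (X → R) → R} (isSum : IsSum Sum) {U : Set} where
    open IsSum isSum

    -- Interactions are compared only between distinct positions of the list. On a list without
    -- repetitions two interactions may thus differ on the diagonal, as `mixed` and the edge weights
    -- of a loopless graph do.
    Z-cong : ∀ {I I′ : Interaction Sum U} {us} {w w′ : Weight Sum U} →
             All (λ u → ∀ x → w u x ≈ w′ u x) us →
             AllPairs (λ u v → ∀ x y → I u v x y ≈ I′ u v x y) us →
             Z Sum I us w ≈ Z Sum I′ us w′
    Z-cong [] [] = refl
    Z-cong (p ∷ ps) (e ∷ es) = Sum-cong λ x → *-cong (p x)
      (Z-cong (All.zipWith (λ (p , e) y → *-cong (p y) (e x y)) (ps , e)) es)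

    module _ (I : Interaction Sum U) where

      Z-congʷ : ∀ us {w w′ : Weight Sum U} → (∀ u x → w u x ≈ w′ u x) → Z Sum I us w ≈ Z Sum I us w′
      Z-congʷ [] p = refl
      Z-congʷ (u ∷ us) p = Sum-cong λ x → *-cong (p u x) (Z-congʷ us (λ v y → *-congʳ (p v y)))

      Z-swap : (∀ u v x y → I u v x y ≈ I v u y x) → ∀ u v us w →
               Z Sum I (u ∷ v ∷ us) w ≈ Z Sum I (v ∷ u ∷ us) w
      Z-swap I-sym u v us w = begin-equality
        Sum (λ x → w u x * Sum (λ y → tilt Sum I w u x v y * Z Sum I us (tilt Sum I (tilt Sum I w u x) v y)))
          ≈⟨ Sum-cong (λ x → Sum-distribˡ (w u x) _) ⟩
        Sum (λ x → Sum (λ y → w u x * (tilt Sum I w u x v y * Z Sum I us (tilt Sum I (tilt Sum I w u x) v y))))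
          ≈⟨ Sum-swap _ ⟩
        Sum (λ y → Sum (λ x → w u x * (tilt Sum I w u x v y * Z Sum I us (tilt Sum I (tilt Sum I w u x) v y))))
          ≈⟨ Sum-cong (λ y → Sum-cong λ x → trans
               (solve 4 (λ a b c z → a :* (b :* c :* z) := b :* (a :* c :* z)) refl (w u x) (w v y) (I u v x y) _)
               (*-congˡ (*-cong (*-congˡ (I-sym u v x y)) (Z-congʷ us (λ t s →
                 solve 3 (λ a b c → a :* b :* c := a :* c :* b) refl (w t s) (I u t x s) (I v t y s)))))) ⟩
        Sum (λ y → Sum (λ x → w v y * (tilt Sum I w v y u x * Z Sum I us (tilt Sum I (tilt Sum I w v y) u x))))
          ≈⟨ Sum-cong (λ y → Sum-distribˡ (w v y) _) ⟨
        Sum (λ y → w v y * Sum (λ x → tilt Sum I w v y u x * Z Sum I us (tilt Sum I (tilt Sum I w v y) u x))) ∎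

      Z-↭ : (∀ u v x y → I u v x y ≈ I v u y x) → ∀ {us vs} → us ↭ vs → ∀ w → Z Sum I us w ≈ Z Sum I vs w
      Z-↭ I-sym ↭.refl w = refl
      Z-↭ I-sym (↭.prep u p) w = Sum-cong λ x → *-congˡ (Z-↭ I-sym p _)
      Z-↭ I-sym {_ ∷ _ ∷ us} (↭.swap u v p) w = trans (Z-swap I-sym u v us w)
        (Sum-cong λ y → *-congˡ (Sum-cong λ x → *-congˡ (Z-↭ I-sym p _)))
      Z-↭ I-sym (↭.trans p q) w = trans (Z-↭ I-sym p w) (Z-↭ I-sym q w)

  form-∑ : ∀ {m n} (c : Vector R m) (M : Fin m → Matrix n) x y →
           form (λ i j → ∑ (λ k → c k * M k i j)) x y ≈ ∑ (λ k → c k * form (M k) x y)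
  form-∑ c M x y = begin-equality
    ∑ (λ i → x i * ∑ (λ j → ∑ (λ k → c k * M k i j) * y j))
      ≈⟨ ∑-cong (λ i → trans (*-congˡ (∑-cong (λ j → *-distribʳ-sum (y j) (λ k → c k * M k i j))))
           (trans (*-congˡ (∑-comm (λ j k → c k * M k i j * y j))) (*-distribˡ-sum (x i) (λ k → ∑ (λ j → c k * M k i j * y j))))) ⟩
    ∑ (λ i → ∑ (λ k → x i * ∑ (λ j → c k * M k i j * y j)))
      ≈⟨ ∑-comm (λ i k → x i * ∑ (λ j → c k * M k i j * y j)) ⟩
    ∑ (λ k → ∑ (λ i → x i * ∑ (λ j → c k * M k i j * y j)))
      ≈⟨ ∑-cong (λ k → ∑-cong (λ i → *-congˡ (trans (∑-cong (λ j → *-assoc (c k) (M k i j) (y j)))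
           (sym (*-distribˡ-sum (c k) (λ j → M k i j * y j)))))) ⟩
    ∑ (λ k → ∑ (λ i → x i * (c k * (M k ⊙ y) i)))
      ≈⟨ ∑-cong (λ k → ⟪⟫-scaleʳ (c k) x (M k ⊙ y)) ⟩
    ∑ (λ k → c k * form (M k) x y) ∎

  module CompleteGraph {n} {G : Matrix (suc n)} (G-sym : SymmetricMatrix G)
    (G>0 : ∀ i j → 0# < G i j) (G-rcs : ReverseCauchySchwarz G) {U : Set} where

    open PartitionFunction (∑-isSum (suc n)) {U}

    -- Each position of the list is a vertex of a complete graph and U only names its weight, so a
    -- repeated entry means several vertices with the same weight.
    G-interaction : Interaction (∑ {suc n}) U
    G-interaction _ _ = G

    Zᴷ : List U → Weight (∑ {suc n}) U → R
    Zᴷ = Z ∑ G-interaction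

    Positive : Weight (∑ {suc n}) U → Set
    Positive w = ∀ u x → 0# < w u x

    tiltᴷ : Weight (∑ {suc n}) U → Fin (suc n) → Weight (∑ {suc n}) U
    tiltᴷ w x u y = w u y * G x y

    tiltᴷ-positive : ∀ {w} → Positive w → ∀ x → Positive (tiltᴷ w x)
    tiltᴷ-positive w>0 x u y = *-positive (w>0 u y) (G>0 x y)

    Zᴷ-positive : ∀ us {w} → Positive w → 0# < Zᴷ us w
    Zᴷ-positive [] w>0 = 0<1
    Zᴷ-positive (u ∷ us) w>0 = ∑-positive (λ x → *-positive (w>0 u x) (Zᴷ-positive us (tiltᴷ-positive w>0 x)))

    -- The matrix Z(δ_y, δ_z, ...): Z is multilinear in its weights, and these are its coefficients
    -- in the first two.
    hessian : List U → Weight (∑ {suc n}) U → Matrix (suc n)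
    hessian us w y z = G y z * Zᴷ us (tiltᴷ (tiltᴷ w y) z)

    Zᴷ-hessian : ∀ u v us w → Zᴷ (u ∷ v ∷ us) w ≈ form (hessian us w) (w u) (w v)
    Zᴷ-hessian u v us w = ∑-cong (λ y → *-congˡ {w u y} (∑-cong (λ z →
      solve 3 (λ a b c → a :* b :* c := b :* c :* a) refl (w v z) (G y z) (Zᴷ us (tiltᴷ (tiltᴷ w y) z)))))

    hessian-sym : ∀ us w → SymmetricMatrix (hessian us w)
    hessian-sym us w y z = *-cong (G-sym y z) (Z-congʷ G-interaction us (λ u x →
      solve 3 (λ a b c → a :* b :* c := a :* c :* b) refl (w u x) (G y x) (G z x)))

    hessian-positive : ∀ us {w} → Positive w → ∀ y z → 0# < hessian us w y z
    hessian-positive us w>0 y z = *-positive (G>0 y z)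
      (Zᴷ-positive us (tiltᴷ-positive (tiltᴷ-positive w>0 y) z))

    private
      rotate : ∀ us w x y z → Zᴷ us (tiltᴷ (tiltᴷ (tiltᴷ w y) z) x) ≈ Zᴷ us (tiltᴷ (tiltᴷ (tiltᴷ w x) y) z)
      rotate us w x y z = Z-congʷ G-interaction us (λ u s →
        solve 4 (λ w a b c → w :* a :* b :* c := w :* c :* a :* b) refl (w u s) (G y s) (G z s) (G x s))

      -- The matrix Z(δ_y, δ_z, δₓ, ...) obtained by fixing the spin of `h` to x: a hessian with one
      -- site fewer, up to the diagonal congruence by G x. Hence the induction hypothesis applies to
      -- it.
      link : U → List U → Weight (∑ {suc n}) U → Fin (suc n) → Matrix (suc n)
      link h us w x = scale (G x) (hessian us (tiltᴷ w x))

    hessian-∷ : ∀ h us w y z → hessian (h ∷ us) w y z ≈ ∑ (λ x → w h x * link h us w x y z)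
    hessian-∷ h us w y z = trans (*-distribˡ-sum (G y z) (λ x → tiltᴷ (tiltᴷ w y) z h x * Zᴷ us (tiltᴷ (tiltᴷ (tiltᴷ w y) z) x)))
      (∑-cong (λ x → trans (*-congˡ (*-cong (*-cong (*-congˡ (G-sym y x)) (G-sym z x)) (rotate us w x y z)))
        (solve 5 (λ g w a b Z → g :* (w :* a :* b :* Z) := w :* (a :* b :* (g :* Z))) refl
          (G y z) (w h x) (G x y) (G x z) (Zᴷ us (tiltᴷ (tiltᴷ (tiltᴷ w x) y) z)))))

    -- Both sides are Z(δₓ, w h, u, ...), by symmetry of Z in its arguments: fixing the row index of
    -- the hessian is the same as fixing the spin in `link`. This is what makes reverse
    -- Cauchy-Schwarz for `link` the local inequality required by `bochner`.
    hessian-∷-⊙ : ∀ h us w u x → (hessian (h ∷ us) w ⊙ u) x ≈ form (link h us w x) (w h) u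
    hessian-∷-⊙ h us w u x = begin-equality
      ∑ (λ z → G x z * ∑ (λ y → w h y * G x y * G z y * Zᴷ us (tiltᴷ (tiltᴷ (tiltᴷ w x) z) y)) * u z)
        ≈⟨ ∑-cong (λ z → trans (trans (*-assoc _ _ _) (trans (*-congˡ (*-comm _ _)) (sym (*-assoc _ _ _))))
             (*-distribˡ-sum (G x z * u z) (λ y → w h y * G x y * G z y * Zᴷ us (tiltᴷ (tiltᴷ (tiltᴷ w x) z) y)))) ⟩
      ∑ (λ z → ∑ (λ y → G x z * u z * (w h y * G x y * G z y * Zᴷ us (tiltᴷ (tiltᴷ (tiltᴷ w x) z) y))))
        ≈⟨ ∑-comm (λ z y → G x z * u z * (w h y * G x y * G z y * Zᴷ us (tiltᴷ (tiltᴷ (tiltᴷ w x) z) y))) ⟩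
      ∑ (λ y → ∑ (λ z → G x z * u z * (w h y * G x y * G z y * Zᴷ us (tiltᴷ (tiltᴷ (tiltᴷ w x) z) y))))
        ≈⟨ ∑-cong (λ y → trans (∑-cong (λ z → summand y z)) (sym (*-distribˡ-sum (w h y) (λ z → link h us w x y z * u z)))) ⟩
      ∑ (λ y → w h y * ∑ (λ z → link h us w x y z * u z)) ∎
      where
      summand : ∀ y z → G x z * u z * (w h y * G x y * G z y * Zᴷ us (tiltᴷ (tiltᴷ (tiltᴷ w x) z) y)) ≈
                w h y * (link h us w x y z * u z)
      summand y z = trans
        (*-congˡ (*-cong (*-congˡ (G-sym z y)) (Z-congʷ G-interaction us (λ t s →
          solve 4 (λ w a b c → w :* a :* b :* c := w :* a :* c :* b) refl (w t s) (G x s) (G z s) (G y s)))))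
        (solve 6 (λ a u w b c Z → a :* u :* (w :* b :* c :* Z) := w :* (b :* a :* (c :* Z) :* u)) refl
          (G x z) (u z) (w h y) (G x y) (G y z) (Zᴷ us (tiltᴷ (tiltᴷ (tiltᴷ w x) y) z)))

    -- The Bochner step with Q u x = q (link x) u. The quadratic form of the hessian is the average
    -- of these with weights w h, by `hessian-∷`, and the local inequality is the induction
    -- hypothesis for `link` at the vectors w h and u.
    hessian-rcs : ∀ us {w} → Positive w → ReverseCauchySchwarz (hessian us w)
    hessian-rcs [] {w} w>0 = RCS-cong (λ y z → sym (*-identityʳ (G y z))) G-rcs
    hessian-rcs (h ∷ us) {w} w>0 = bochner (hessian-sym (h ∷ us) w) (hessian-positive (h ∷ us) w>0)
      (w>0 h) (λ u x → q (link h us w x) u)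
      (λ u → trans (form-cong (hessian-∷ h us w) u u) (form-∑ (w h) (link h us w) u u))
      (λ u x → ≤-resp
        (*-congʳ (sym (hessian-∷-⊙ h us w (w h) x)))
        (*-cong (sym (hessian-∷-⊙ h us w u x)) (sym (hessian-∷-⊙ h us w u x)))
        (RCS-scale (G x) {hessian us (tiltᴷ w x)} (hessian-rcs us (tiltᴷ-positive w>0 x)) (w h) u
          (≤-respʳ (hessian-∷-⊙ h us w (w h) x) (<⇒≤ (∑-positive (λ z →
            *-positive (hessian-positive (h ∷ us) w>0 x z) (w>0 h z)))))))

    Zᴷ-log-concave : ∀ u v us {w} → Positive w →
      Zᴷ (u ∷ u ∷ us) w * Zᴷ (v ∷ v ∷ us) w ≤ Zᴷ (u ∷ v ∷ us) w * Zᴷ (u ∷ v ∷ us) w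
    Zᴷ-log-concave u v us {w} w>0 = ≤-resp
      (sym (*-cong (Zᴷ-hessian u u us w) (Zᴷ-hessian v v us w)))
      (sym (*-cong (Zᴷ-hessian u v us w) (Zᴷ-hessian u v us w)))
      (hessian-rcs us w>0 (w u) (w v) (≤-respʳ (Zᴷ-hessian u u us w) (<⇒≤ (Zᴷ-positive (u ∷ u ∷ us) w>0))))

-- Replacing straight by crossed interactions inside one clique.

module CliqueCrossing (ℝ : CompleteOrderedField) where

  open OrderedField ℝ
  open QuadraticForm ℝ
  open Spectrum ℝ
  open PartitionFunctions ℝ
  open ≤-Reasoning

  ∑² : ∀ {n} → (Fin n × Fin n → R) → R
  ∑² f = ∑ (λ x → ∑ (λ y → f (x , y)))

  ∑²-isSum : ∀ n → IsSum (∑² {n})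
  ∑²-isSum n = record
    { Sum-cong = λ p → ∑-cong (λ x → ∑-cong (λ y → p (x , y)))
    ; Sum-mono = λ p → ∑-mono (λ x → ∑-mono (λ y → p (x , y)))
    ; Sum-distribˡ = λ c f → trans (*-distribˡ-sum c (λ x → ∑ (λ y → f (x , y))))
        (∑-cong (λ x → *-distribˡ-sum c (λ y → f (x , y))))
    ; Sum-swap = λ F → trans (∑-cong (λ x → ∑-comm (λ y x′ → ∑ (λ y′ → F (x , y) (x′ , y′)))))
        (trans (∑-comm (λ x x′ → ∑ (λ y → ∑ (λ y′ → F (x , y) (x′ , y′)))))
        (trans (∑-cong (λ x′ → ∑-cong (λ x → ∑-comm (λ y y′ → F (x , y) (x′ , y′)))))
        (∑-cong (λ x′ → ∑-comm (λ x y′ → ∑ (λ y → F (x , y) (x′ , y′)))))))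
    }

  ∑²-product : ∀ {n} (f g : Vector R n) → ∑² (λ (x , y) → f x * g y) ≈ ∑ f * ∑ g
  ∑²-product f g = begin-equality
    ∑ (λ x → ∑ (λ y → f x * g y))    ≈⟨ ∑-cong (λ x → *-distribˡ-sum (f x) g) ⟨
    ∑ (λ x → f x * ∑ g)              ≈⟨ *-distribʳ-sum (∑ g) f ⟨
    ∑ f * ∑ g                        ∎

  Z-map : ∀ {X U V} {Sum : (X → R) → R} (isSum : IsSum Sum) (I : Interaction Sum V) (e : U → V) us w →
          Z Sum I (map e us) w ≈ Z Sum (λ u v → I (e u) (e v)) us (λ u → w (e u))
  Z-map isSum I e [] w = refl
  Z-map isSum I e (u ∷ us) w = IsSum.Sum-cong isSum λ x → *-congˡ (Z-map isSum I e us _)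

  infixl 7 _⊠ʷ_
  _⊠ʷ_ : ∀ {n} {U : Set} → Weight (∑ {n}) U → Weight (∑ {n}) U → Weight (∑² {n}) U
  (w ⊠ʷ w′) u (x , y) = w u x * w′ u y

  doubled : ∀ {n} {U : Set} → Interaction (∑ {n}) U → Interaction (∑² {n}) U
  doubled I u v (x , y) (x′ , y′) = I u v x x′ * I u v y y′

  Z-doubled : ∀ {n} {U : Set} (I : Interaction (∑ {n}) U) us w w′ →
              Z ∑² (doubled I) us (w ⊠ʷ w′) ≈ Z ∑ I us w * Z ∑ I us w′
  Z-doubled I [] w w′ = sym (*-identityˡ 1#)
  Z-doubled {n} I (u ∷ us) w w′ = begin-equality
    ∑² (λ (x , y) → w u x * w′ u y * Z ∑² (doubled I) us (tilt ∑² (doubled I) (w ⊠ʷ w′) u (x , y)))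
      ≈⟨ IsSum.Sum-cong (∑²-isSum n) (λ (x , y) → *-congˡ (trans
           (Z-congʷ (doubled I) us (λ v (s , t) → solve 4 (λ a b c d → a :* b :* (c :* d) := a :* c :* (b :* d))
             refl (w v s) (w′ v t) (I u v x s) (I u v y t)))
           (Z-doubled I us (tilt ∑ I w u x) (tilt ∑ I w′ u y)))) ⟩
    ∑² (λ (x , y) → w u x * w′ u y * (Z ∑ I us (tilt ∑ I w u x) * Z ∑ I us (tilt ∑ I w′ u y)))
      ≈⟨ IsSum.Sum-cong (∑²-isSum n) (λ (x , y) → solve 4 (λ a b c d → a :* b :* (c :* d) := a :* c :* (b :* d))
           refl (w u x) (w′ u y) (Z ∑ I us (tilt ∑ I w u x)) (Z ∑ I us (tilt ∑ I w′ u y))) ⟩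
    ∑² (λ (x , y) → w u x * Z ∑ I us (tilt ∑ I w u x) * (w′ u y * Z ∑ I us (tilt ∑ I w′ u y)))
      ≈⟨ ∑²-product (λ x → w u x * Z ∑ I us (tilt ∑ I w u x)) (λ y → w′ u y * Z ∑ I us (tilt ∑ I w′ u y)) ⟩
    Z ∑ I (u ∷ us) w * Z ∑ I (u ∷ us) w′ ∎
    where open PartitionFunction (∑²-isSum n)

  straight crossed : ∀ {n} → Matrix n → Fin n × Fin n → Fin n × Fin n → R
  straight G (x , y) (x′ , y′) = G x x′ * G y y′
  crossed G (x , y) (x′ , y′) = G x y′ * G y x′

  module _ {n} {G : Matrix (suc n)} (G-sym : SymmetricMatrix G)
    (G>0 : ∀ i j → 0# < G i j) (G-rcs : ReverseCauchySchwarz G) where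

    private
      module Two {U : Set} (a b : U) {w : Weight (∑ {suc n}) U} (w>0 : ∀ u x → 0# < w u x) where
        open CompleteGraph G-sym G>0 G-rcs {U}
        open PartitionFunction (∑-isSum (suc n)) {U}

        word : ℕ → ℕ → List U
        word i j = replicate i a ++ replicate j b

        c : ℕ → ℕ → R
        c i j = Zᴷ (word i j) w

        permute : ∀ {us vs} → us ↭ vs → Zᴷ us w ≈ Zᴷ vs w
        permute p = Z-↭ G-interaction (λ _ _ → G-sym) p w

        shiftᵇ : ∀ i j → word i (suc j) ↭ b ∷ word i j
        shiftᵇ i j = ↭.shift b (replicate i a) (replicate j b)

        log-concave : ∀ i j → c (suc (suc i)) j * c i (suc (suc j)) ≤ c (suc i) (suc j) * c (suc i) (suc j)
        log-concave i j = ≤-resp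
          (*-congˡ (permute (↭.↭-trans (↭.prep b (↭.↭-sym (shiftᵇ i j))) (↭.↭-sym (shiftᵇ i (suc j))))))
          (*-cong mixed mixed)
          (Zᴷ-log-concave a b (word i j) w>0)
          where
          mixed : Zᴷ (a ∷ b ∷ word i j) w ≈ c (suc i) (suc j)
          mixed = permute (↭.prep a (↭.↭-sym (shiftᵇ i j)))

        -- On the diagonal of index sum N + 1, log-concavity says that the ratios c i (k + 1) / c (i
        -- + 1) k increase with i; the last one, at i = N, is c N 1 / c (N + 1) 0. Induction runs
        -- from there down to i = 0, cancelling positive values of `c`.
        exchange-at : ∀ k i {N} → i ℕ.+ k ≡ N → c (suc N) 0 * c i (suc k) ≤ c N 1 * c (suc i) k
        exchange-at zero i eq with ≡.trans (≡.sym (ℕ.+-identityʳ i)) eq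
        ... | ≡.refl = O.reflexive (*-comm _ _)
        exchange-at (suc k) i {N} eq = *-cancelˡ-≤ (Zᴷ-positive (word (suc (suc i)) k) w>0) (begin
          c (suc (suc i)) k * (c (suc N) 0 * c i (suc (suc k)))
            ≈⟨ solve 3 (λ x t y → x :* (t :* y) := t :* (x :* y)) refl (c (suc (suc i)) k) (c (suc N) 0) (c i (suc (suc k))) ⟩
          c (suc N) 0 * (c (suc (suc i)) k * c i (suc (suc k)))
            ≤⟨ *-monoˡ-≤ (<⇒≤ (Zᴷ-positive (word (suc N) 0) w>0)) (log-concave i k) ⟩
          c (suc N) 0 * (c (suc i) (suc k) * c (suc i) (suc k))
            ≈⟨ *-assoc _ _ _ ⟨
          c (suc N) 0 * c (suc i) (suc k) * c (suc i) (suc k)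
            ≤⟨ *-monoʳ-≤ (<⇒≤ (Zᴷ-positive (word (suc i) (suc k)) w>0))
                 (exchange-at k (suc i) (≡.trans (≡.sym (ℕ.+-suc i k)) eq)) ⟩
          c N 1 * c (suc (suc i)) k * c (suc i) (suc k)
            ≈⟨ solve 3 (λ s x y → s :* x :* y := x :* (s :* y)) refl (c N 1) (c (suc (suc i)) k) (c (suc i) (suc k)) ⟩
          c (suc (suc i)) k * (c N 1 * c (suc i) (suc k)) ∎)

        exchange : ∀ N → Zᴷ (replicate (suc N) a) w * Zᴷ (replicate (suc N) b) w ≤
                         Zᴷ (b ∷ replicate N a) w * Zᴷ (a ∷ replicate N b) w
        exchange N = ≤-resp
          (*-congʳ (reflexive (≡.cong (λ us → Zᴷ us w) (++-identityʳ (replicate (suc N) a)))))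
          (*-congʳ (permute (↭.↭-trans (shiftᵇ N 0) (↭.↭-reflexive (≡.cong (b ∷_) (++-identityʳ (replicate N a)))))))
          (exchange-at N 0 ≡.refl)

    module _ {U : Set} where
      open CompleteGraph G-sym G>0 G-rcs {U} using (Zᴷ; G-interaction)
      open PartitionFunction (∑²-isSum (suc n)) {U} using (Z-congʷ)

      -- `exchange` on words in two letters, `false` weighted by f and `true` by g. The right side
      -- is expanded at its first vertex so that `clique-crossing` can fix the two spins there.
      clique-exchange : ∀ u us {f g : Vector R (suc n)} → (∀ x → 0# < f x) → (∀ x → 0# < g x) →
        Zᴷ (u ∷ us) (λ _ → f) * Zᴷ (u ∷ us) (λ _ → g) ≤
        ∑ (λ x → g x * Zᴷ us (λ _ s → f s * G x s)) * ∑ (λ y → f y * Zᴷ us (λ _ t → g t * G y t))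
      clique-exchange u us {f} {g} f>0 g>0 = ≤-resp
        (*-cong (to-word (u ∷ us) false w) (to-word (u ∷ us) true w))
        (*-cong (∑-cong (λ x → *-congˡ {g x} (to-word us false (λ u s → w u s * G x s)))) (∑-cong (λ y → *-congˡ {f y} (to-word us true (λ u t → w u t * G y t)))))
        (Two.exchange false true w>0 (length us))
        where
        w : Weight (∑ {suc n}) Bool
        w b = if b then g else f
        w>0 : ∀ b x → 0# < w b x
        w>0 false = f>0
        w>0 true = g>0
        replicate-length : ∀ (us : List U) {b : Bool} → replicate (length us) b ≡ map (const b) us
        replicate-length [] = ≡.refl
        replicate-length (_ ∷ us) = ≡.cong (_ ∷_) (replicate-length us)
        to-word : ∀ us b (w : Weight (∑ {suc n}) Bool) →
                  Z ∑ (λ _ _ → G) (replicate (length us) b) w ≈ Zᴷ us (λ _ → w b)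
        to-word us b w = trans (reflexive (≡.cong (λ vs → Z ∑ (λ _ _ → G) vs w) (replicate-length us)))
          (Z-map (∑-isSum (suc n)) (λ _ _ → G) (const b) us w)

      -- After the exchange the first vertex carries g in the copy whose other vertices carry f, and
      -- conversely. Renaming its spins to (y , x), with y weighted by f and x by g, the remaining
      -- weights become f · G x and g · G y: exactly the crossed interaction with the first vertex.
      -- For fixed spins these are again two positive weights common to all remaining vertices, so
      -- induction applies.
      clique-crossing : ∀ us {f g : Vector R (suc n)} → (∀ x → 0# < f x) → (∀ x → 0# < g x) →
        Z ∑² (λ _ _ → straight G) us ((λ (_ : U) → f) ⊠ʷ (λ _ → g)) ≤ Z ∑² (λ _ _ → crossed G) us ((λ _ → f) ⊠ʷ (λ _ → g))
      clique-crossing [] f>0 g>0 = ≤-refl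
      clique-crossing (u ∷ us) {f} {g} f>0 g>0 = begin
        Z ∑² (λ _ _ → straight G) (u ∷ us) ((λ _ → f) ⊠ʷ (λ _ → g))
          ≈⟨ Z-doubled G-interaction (u ∷ us) (λ _ → f) (λ _ → g) ⟩
        Zᴷ (u ∷ us) (λ _ → f) * Zᴷ (u ∷ us) (λ _ → g)
          ≤⟨ clique-exchange u us f>0 g>0 ⟩
        ∑ (λ x → g x * Zᴷ us (λ _ s → f s * G x s)) * ∑ (λ y → f y * Zᴷ us (λ _ t → g t * G y t))
          ≈⟨ *-comm _ _ ⟩
        ∑ (λ y → f y * Zᴷ us (λ _ t → g t * G y t)) * ∑ (λ x → g x * Zᴷ us (λ _ s → f s * G x s))
          ≈⟨ ∑²-product (λ y → f y * Zᴷ us (λ _ t → g t * G y t)) (λ x → g x * Zᴷ us (λ _ s → f s * G x s)) ⟨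
        ∑² (λ (y , x) → f y * Zᴷ us (λ _ t → g t * G y t) * (g x * Zᴷ us (λ _ s → f s * G x s)))
          ≈⟨ Sum-cong (λ (y , x) → trans
               (solve 4 (λ a b c d → a :* b :* (c :* d) := a :* c :* (d :* b)) refl
                 (f y) (Zᴷ us (λ _ t → g t * G y t)) (g x) (Zᴷ us (λ _ s → f s * G x s)))
               (*-congˡ (sym (Z-doubled G-interaction us (λ _ s → f s * G x s) (λ _ t → g t * G y t))))) ⟩
        ∑² (λ (y , x) → f y * g x * Z ∑² (λ _ _ → straight G) us ((λ _ s → f s * G x s) ⊠ʷ (λ _ t → g t * G y t)))
          ≤⟨ Sum-mono (λ (y , x) → *-monoˡ-≤ (*-nonNegative (<⇒≤ (f>0 y)) (<⇒≤ (g>0 x)))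
               (clique-crossing us (λ s → *-positive (f>0 s) (G>0 x s)) (λ t → *-positive (g>0 t) (G>0 y t)))) ⟩
        ∑² (λ (y , x) → f y * g x * Z ∑² (λ _ _ → crossed G) us ((λ _ s → f s * G x s) ⊠ʷ (λ _ t → g t * G y t)))
          ≈⟨ Sum-cong (λ (y , x) → *-congˡ {f y * g x} (Z-congʷ (λ _ _ → crossed G) us (λ v (s , t) →
               solve 4 (λ a b c d → a :* b :* (c :* d) := a :* c :* (d :* b)) refl (f s) (G x s) (g t) (G y t)))) ⟩
        Z ∑² (λ _ _ → crossed G) (u ∷ us) ((λ _ → f) ⊠ʷ (λ _ → g)) ∎
        where open IsSum (∑²-isSum (suc n))

-- Homomorphism counts as partition functions.

module Homomorphisms (ℝ : CompleteOrderedField) where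

  open OrderedField ℝ
  open QuadraticForm ℝ
  open PartitionFunctions ℝ
  open CliqueCrossing ℝ
  open ≤-Reasoning

  module Product = Algebra.Properties.CommutativeMonoid.Sum *-commutativeMonoid

  AllPairs-universal : ∀ {A : Set} {S : A → A → Set} → (∀ x y → S x y) → ∀ xs → AllPairs S xs
  AllPairs-universal f [] = []
  AllPairs-universal f (x ∷ xs) = All.universal (f x) xs ∷ AllPairs-universal f xs

  ∏-cong : ∀ {n} {f g : Vector R n} → (∀ i → f i ≈ g i) → ∏ f ≈ ∏ g
  ∏-cong = Product.sum-cong-≋

  ∏-distrib-* : ∀ {n} (f g : Vector R n) → ∏ (λ i → f i * g i) ≈ ∏ f * ∏ g
  ∏-distrib-* = Product.∑-distrib-+

  ∏-one : ∀ {n} {f : Vector R n} → (∀ i → f i ≈ 1#) → ∏ f ≈ 1#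
  ∏-one {n} p = trans (∏-cong p) (Product.sum-replicate-zero n)

  ∑-↑ : ∀ m {n} (f : Vector R (m ℕ.+ n)) → ∑ f ≈ ∑ (λ i → f (i ↑ˡ n)) + ∑ (λ j → f (m ↑ʳ j))
  ∑-↑ zero f = sym (+-identityˡ _)
  ∑-↑ (suc m) f = trans (+-congˡ (∑-↑ m (f ∘ suc))) (sym (+-assoc _ _ _))

  ∑-combine : ∀ m n (f : Vector R (m ℕ.* n)) → ∑ f ≈ ∑ {m} (λ i → ∑ {n} (λ j → f (combine i j)))
  ∑-combine zero n f = refl
  ∑-combine (suc m) n f = trans (∑-↑ n f) (+-congˡ (∑-combine m n (λ k → f (n ↑ʳ k))))

  ∑-remQuot : ∀ m n (f : Fin m → Fin n → R) →
              ∑ {m ℕ.* n} (λ k → f (quotient n k) (remainder {m} n k)) ≈ ∑ (λ i → ∑ (λ j → f i j))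
  ∑-remQuot m n f = trans (∑-combine m n (λ k → uncurry f (remQuot {m} n k)))
    (∑-cong (λ i → ∑-cong (λ j → reflexive (≡.cong (uncurry f) (Fin.remQuot-combine i j)))))

  pairs : ∀ {n} → (Fin n → Fin n → R) → R
  pairs K = ∏ (λ u → ∏ (λ v → if does (u Fin.<? v) then K u v else 1#))

  pairs-suc : ∀ {n} (K : Fin (suc n) → Fin (suc n) → R) →
              pairs K ≈ ∏ (λ v → K zero (suc v)) * pairs (λ u v → K (suc u) (suc v))
  pairs-suc {n} K = *-cong (*-identityˡ _) (∏-cong {n} (λ u →
    *-identityˡ (∏ (λ v → if does (u Fin.<? v) then K (suc u) (suc v) else 1#))))

  -- `finToFun` decodes an index as the spin of vertex zero, its quotient, and an index for the
  -- remaining vertices, its remainder. The enumeration of maps therefore unfolds as `Z` does, with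
  -- the pairs containing vertex zero absorbed by `tilt`.
  ∑-spins : ∀ {n U} N (I : Interaction (∑ {n}) U) (e : Fin N → U) w →
    ∑ {n ℕ.^ N} (λ k → ∏ (λ u → w (e u) (finToFun {n} {N} k u)) *
                       pairs (λ u v → I (e u) (e v) (finToFun {n} {N} k u) (finToFun {n} {N} k v)))
    ≈ Z ∑ I (tabulate e) w
  ∑-spins zero I e w = trans (+-identityʳ _) (*-identityˡ _)
  ∑-spins {n} (suc N) I e w = begin-equality
    ∑ {n ℕ.^ suc N} (λ k → ∏ (λ u → w (e u) (finToFun {n} {suc N} k u)) *
                           pairs (λ u v → I (e u) (e v) (finToFun {n} {suc N} k u) (finToFun {n} {suc N} k v)))
      ≈⟨ ∑-remQuot n (n ℕ.^ N) (λ x k → w (e zero) x * vertices k * pairs (λ u v → I (e u) (e v) (spin x k u) (spin x k v))) ⟩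
    ∑ (λ x → ∑ (λ k → w (e zero) x * vertices k * pairs (λ u v → I (e u) (e v) (spin x k u) (spin x k v))))
      ≈⟨ ∑-cong (λ x → trans (∑-cong (rearrange x)) (sym (*-distribˡ-sum (w (e zero) x) (term x)))) ⟩
    ∑ (λ x → w (e zero) x * ∑ (term x))
      ≈⟨ ∑-cong (λ x → *-congˡ (∑-spins N I (e ∘ suc) (tilt ∑ I w (e zero) x))) ⟩
    Z ∑ I (tabulate e) w ∎
    where
    φ : Fin (n ℕ.^ N) → Fin N → Fin n
    φ = finToFun {n} {N}
    spin : Fin n → Fin (n ℕ.^ N) → Fin (suc N) → Fin n
    spin x k zero = x
    spin x k (suc u) = φ k u
    vertices : Fin (n ℕ.^ N) → R
    vertices k = ∏ (λ u → w (e (suc u)) (φ k u))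
    rest : Fin (n ℕ.^ N) → R
    rest k = pairs (λ u v → I (e (suc u)) (e (suc v)) (φ k u) (φ k v))
    term : Fin n → Fin (n ℕ.^ N) → R
    term x k = ∏ (λ u → tilt ∑ I w (e zero) x (e (suc u)) (φ k u)) * rest k
    rearrange : ∀ x k → w (e zero) x * vertices k * pairs (λ u v → I (e u) (e v) (spin x k u) (spin x k v)) ≈
                w (e zero) x * term x k
    rearrange x k = begin-equality
      w (e zero) x * vertices k * pairs (λ u v → I (e u) (e v) (spin x k u) (spin x k v))
        ≈⟨ *-congˡ (pairs-suc (λ u v → I (e u) (e v) (spin x k u) (spin x k v))) ⟩
      w (e zero) x * vertices k * (∏ star * rest k)
        ≈⟨ solve 4 (λ a b c d → a :* b :* (c :* d) := a :* (b :* c :* d)) refl (w (e zero) x) (vertices k) (∏ star) (rest k) ⟩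
      w (e zero) x * (vertices k * ∏ star * rest k)
        ≈⟨ *-congˡ (*-congʳ (∏-distrib-* (λ u → w (e (suc u)) (φ k u)) star)) ⟨
      w (e zero) x * term x k ∎
      where
      star : Vector R N
      star v = I (e zero) (e (suc v)) x (φ k v)

  edge : ∀ {n} (H : Graph) → Matrix n → Interaction (∑ {n}) (Vertex H)
  edge H G u v x y = if does (adj? H u v) then G x y else 1#

  if-∧ : ∀ {A : Set} a b {x y : A} → (if a ∧ b then x else y) ≡ (if a then (if b then x else y) else y)
  if-∧ true b = ≡.refl
  if-∧ false b = ≡.refl

  hom≈Z : ∀ H G → hom ℝ H G ≈ Z ∑ (edge H (WeightedGraph.weight G)) (allFin (order H)) (λ _ _ → 1#)
  hom≈Z H G = trans (∑-cong {n ℕ.^ N} (λ k → trans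
      (∏-cong {N} (λ u → ∏-cong {N} (λ v → reflexive (if-∧ (does (u Fin.<? v)) (does (adj? H u v))
        {W (finToFun {n} {N} k u) (finToFun {n} {N} k v)} {1#}))))
      (sym (trans (*-congʳ {pairs (λ u v → edge H W u v (finToFun {n} {N} k u) (finToFun {n} {N} k v))}
        (∏-one {N} (λ _ → refl))) (*-identityˡ _)))))
    (∑-spins N (edge H W) id (λ _ _ → 1#))
    where
    open WeightedGraph G using () renaming (order to n; weight to W)
    N = order H

  module _ {n} {U : Set} (I : Interaction (∑ {n}) U) where

    -- Two sites merged into one whose spin is a pair: these are the four interactions between
    -- different merged sites, while the one inside a merged site goes into `pairedʷ`.
    paired : Interaction (∑² {n}) (U × U)
    paired (a , b) (a′ , b′) (x , y) (x′ , y′) =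
      (I a a′ x x′ * I b a′ y x′) * (I a b′ x y′ * I b b′ y y′)

    pairedʷ : Weight (∑ {n}) U → Weight (∑² {n}) (U × U)
    pairedʷ w (a , b) (x , y) = w a x * (w b y * I a b x y)

    Z-paired : ∀ N (e : Fin (N ℕ.* 2) → U) w →
               Z ∑ I (tabulate e) w ≈
               Z ∑² paired (tabulate (λ i → e (combine {N} i zero) , e (combine {N} {2} i (suc zero)))) (pairedʷ w)
    Z-paired zero e w = refl
    Z-paired (suc N) e w = ∑-cong (λ x → trans
      (*-distribˡ-sum (w a x) (λ y → tilt ∑ I w a x b y * Z ∑ I (tabulate e″) (w″ x y)))
      (∑-cong (λ y → trans (sym (*-assoc (w a x) _ _))
        (*-congˡ {w a x * (w b y * I a b x y)} (trans (Z-paired N e″ (w″ x y))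
          (Z-congʷ paired (tabulate (λ i → e″ (combine {N} i zero) , e″ (combine {N} {2} i (suc zero))))
            (λ (c , d) (s , t) → solve 7 (λ p α β r γ δ ε →
              p :* α :* β :* (r :* γ :* δ :* ε) := p :* (r :* ε) :* ((α :* β) :* (γ :* δ))) refl
              (w c s) (I a c x s) (I b c y s) (w d t) (I a d x t) (I b d y t) (I c d s t))))))))
      where
      open PartitionFunction (∑²-isSum n)
      a b : U
      a = e zero
      b = e (suc zero)
      e″ : Fin (N ℕ.* 2) → U
      e″ i = e (suc (suc i))
      w″ : Fin n → Fin n → Weight (∑ {n}) U
      w″ x y = tilt ∑ I (tilt ∑ I w a x) b y

  straightEdge crossedEdge : ∀ {n} (H : Graph) → Matrix n → Interaction (∑² {n}) (Vertex H)
  straightEdge H G u v p q = if does (adj? H u v) then straight G p q else 1#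
  crossedEdge H G u v p q = if does (adj? H u v) then crossed G p q else 1#

  -- The two copies of a vertex are consecutive in the labelling of `H ⊗ K 2`, so they can be merged
  -- by `Z-paired`. Of the four interactions over an edge of H only the two between different layers
  -- remain, and their product is `crossed`; the two copies of one vertex do not interact because H
  -- is loopless.
  hom-⊗K₂≈Z : ∀ H G → hom ℝ (H ⊗ K 2) G ≈
              Z ∑² (crossedEdge H (WeightedGraph.weight G)) (allFin (order H)) (λ _ _ → 1#)
  hom-⊗K₂≈Z H G = begin-equality
    hom ℝ (H ⊗ K 2) G
      ≈⟨ hom≈Z (H ⊗ K 2) G ⟩
    Z ∑ (edge (H ⊗ K 2) W) (allFin (N ℕ.* 2)) (λ _ _ → 1#)
      ≈⟨ Z-paired (edge (H ⊗ K 2) W) N id (λ _ _ → 1#) ⟩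
    Z ∑² (paired (edge (H ⊗ K 2) W)) (tabulate layers) (pairedʷ (edge (H ⊗ K 2) W) (λ _ _ → 1#))
      ≡⟨ ≡.cong (λ us → Z ∑² (paired (edge (H ⊗ K 2) W)) us (pairedʷ (edge (H ⊗ K 2) W) (λ _ _ → 1#))) (map-tabulate id layers) ⟨
    Z ∑² (paired (edge (H ⊗ K 2) W)) (map layers (allFin N)) (pairedʷ (edge (H ⊗ K 2) W) (λ _ _ → 1#))
      ≈⟨ Z-map (∑²-isSum n) (paired (edge (H ⊗ K 2) W)) layers (allFin N) _ ⟩
    Z ∑² (λ u v → paired (edge (H ⊗ K 2) W) (layers u) (layers v)) (allFin N)
         (λ u → pairedʷ (edge (H ⊗ K 2) W) (λ _ _ → 1#) (layers u))
      ≈⟨ Z-cong (All.universal weights (allFin N)) (AllPairs-universal link (allFin N)) ⟩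
    Z ∑² (crossedEdge H W) (allFin N) (λ _ _ → 1#) ∎
    where
    open WeightedGraph G using () renaming (order to n; weight to W)
    open PartitionFunction (∑²-isSum n)
    N = order H
    layers : Vertex H → Vertex (H ⊗ K 2) × Vertex (H ⊗ K 2)
    layers u = combine u zero , combine {N} {2} u (suc zero)
    edge-layers : ∀ u v (i j : Fin 2) x y → edge (H ⊗ K 2) W (combine u i) (combine v j) x y ≡
                  (if does (adj? H u v) ∧ does (¬? (i Fin.≟ j)) then W x y else 1#)
    edge-layers u v i j x y = ≡.cong₂ (λ (a , k) (b , l) → if does (adj? H a b) ∧ does (¬? (k Fin.≟ l)) then W x y else 1#)
      (Fin.remQuot-combine u i) (Fin.remQuot-combine v j)
    weights : ∀ u p → pairedʷ (edge (H ⊗ K 2) W) (λ _ _ → 1#) (layers u) p ≈ 1#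
    weights u (x , y) = trans (*-identityˡ _) (trans (*-identityˡ _) (trans
      (reflexive (edge-layers u u zero (suc zero) x y))
      (reflexive (≡.cong (λ b → if b ∧ true then W x y else 1#) (dec-false (adj? H u u) (loopless H u))))))
    link : ∀ u v p q → paired (edge (H ⊗ K 2) W) (layers u) (layers v) p q ≈ crossedEdge H W u v p q
    link u v (x , y) (x′ , y′) = trans
      (*-cong (*-cong (reflexive (edge-layers u v zero zero x x′)) (reflexive (edge-layers u v (suc zero) zero y x′)))
              (*-cong (reflexive (edge-layers u v zero (suc zero) x y′)) (reflexive (edge-layers u v (suc zero) (suc zero) y y′))))
      (byCases (does (adj? H u v)))
      where
      byCases : ∀ b → ((if b ∧ false then W x x′ else 1#) * (if b ∧ true then W y x′ else 1#)) *
                      ((if b ∧ true then W x y′ else 1#) * (if b ∧ false then W y y′ else 1#)) ≈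
                      (if b then W x y′ * W y x′ else 1#)
      byCases true = trans (*-cong (*-identityˡ _) (*-identityʳ _)) (*-comm _ _)
      byCases false = trans (*-cong (*-identityˡ _) (*-identityˡ _)) (*-identityˡ _)

  hom²≈Z : ∀ H G → hom ℝ H G * hom ℝ H G ≈
           Z ∑² (straightEdge H (WeightedGraph.weight G)) (allFin (order H)) (λ _ _ → 1#)
  hom²≈Z H G = trans (*-cong (hom≈Z H G) (hom≈Z H G)) (trans
    (sym (Z-doubled (edge H W) (allFin (order H)) (λ _ _ → 1#) (λ _ _ → 1#)))
    (Z-cong (All.universal (λ _ _ → *-identityˡ 1#) (allFin (order H))) (AllPairs-universal link (allFin (order H)))))
    where
    open WeightedGraph G using () renaming (order to n; weight to W)
    open PartitionFunction (∑²-isSum n)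
    link : ∀ u v p q → doubled (edge H W) u v p q ≈ straightEdge H W u v p q
    link u v p q with does (adj? H u v)
    ... | true = refl
    ... | false = *-identityˡ 1#

-- Crossing the cliques of a blow-up one at a time.

module BlowUps (ℝ : CompleteOrderedField) where

  open OrderedField ℝ
  open QuadraticForm ℝ
  open Spectrum ℝ
  open PartitionFunctions ℝ
  open CliqueCrossing ℝ
  open Homomorphisms ℝ
  open ≤-Reasoning

  separate : ∀ {A : Set} {P : Pred A 0ℓ} (P? : Decidable P) (xs : List A) →
             ∃[ ys ] ∃[ zs ] (xs ↭ ys ++ zs × All (¬_ ∘ P) ys × All P zs)
  separate P? [] = [] , [] , ↭.refl , [] , []
  separate P? (x ∷ xs) with P? x | separate P? xs
  ... | yes px | ys , zs , p , ¬ps , ps =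
    ys , x ∷ zs , ↭.↭-trans (↭.prep x p) (↭.↭-sym (↭.shift x ys zs)) , ¬ps , px ∷ ps
  ... | no ¬px | ys , zs , p , ¬ps , ps = x ∷ ys , zs , ↭.prep x p , ¬px ∷ ¬ps , ps

  All⇒AllPairs : ∀ {A : Set} {P : Pred A 0ℓ} {S : A → A → Set} → (∀ {x y} → P x → P y → S x y) →
                 ∀ {xs} → All P xs → AllPairs S xs
  All⇒AllPairs f [] = []
  All⇒AllPairs f (p ∷ ps) = All.map (f p) ps ∷ All⇒AllPairs f ps

  -- A change of summation variable at each site; it is used to exchange the two spins of a pair on
  -- one side of F.
  Z-respin : ∀ {X U : Set} {Sum : (X → R) → R} (isSum : IsSum Sum) (I : Interaction Sum U) (τ : U → X → X) →
             (∀ u f → Sum (λ x → f (τ u x)) ≈ Sum f) → ∀ us w →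
             Z Sum (λ u v x y → I u v (τ u x) (τ v y)) us (λ u x → w u (τ u x)) ≈ Z Sum I us w
  Z-respin isSum I τ inv [] w = refl
  Z-respin {Sum = Sum} isSum I τ inv (u ∷ us) w = trans
    (IsSum.Sum-cong isSum (λ x → *-congˡ (Z-respin isSum I τ inv us (tilt Sum I w u (τ u x)))))
    (inv u (λ x → w u x * Z Sum I us (tilt Sum I w u x)))

  if-cong : ∀ b {x x′ y y′ : R} → x ≈ x′ → y ≈ y′ → (if b then x else y) ≈ (if b then x′ else y′)
  if-cong true p _ = p
  if-cong false _ p = p

  if-≥0 : ∀ b {x y : R} → 0# ≤ x → 0# ≤ y → 0# ≤ (if b then x else y)
  if-≥0 true p _ = p
  if-≥0 false _ p = p

  module Crossing {n} {G : Matrix (suc n)} (G-sym : SymmetricMatrix G)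
    (G>0 : ∀ i j → 0# < G i j) (G-rcs : ReverseCauchySchwarz G)
    (F : Graph) {U : Set} (part : U → Vertex F) where

    open PartitionFunction (∑²-isSum (suc n)) {U}
    open IsSum (∑²-isSum (suc n))

    V² : Set
    V² = Fin (suc n) × Fin (suc n)

    joined : Vertex F → Vertex F → V² → V² → R
    joined i j p q = if does (adj? F i j) then straight G p q else 1#

    inside : Bool → V² → V² → R
    inside c p q = if c then crossed G p q else straight G p q

    -- Interpolates from all cliques straight to all cliques crossed: σ marks the parts already
    -- crossed, and different parts stay joined by straight factors throughout.
    mixed : (Vertex F → Bool) → Interaction (∑² {suc n}) U
    mixed σ u v p q = if does (part u Fin.≟ part v) then inside (σ (part u)) p q else joined (part u) (part v) p q

    mixed-≡ : ∀ {σ u v} → part u ≡ part v → ∀ p q → mixed σ u v p q ≡ inside (σ (part u)) p q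
    mixed-≡ {σ} {u} {v} e p q = ≡.cong
      (λ b → if b then inside (σ (part u)) p q else joined (part u) (part v) p q) (dec-true (part u Fin.≟ part v) e)

    mixed-≢ : ∀ {σ u v} → part u ≢ part v → ∀ p q → mixed σ u v p q ≡ joined (part u) (part v) p q
    mixed-≢ {σ} {u} {v} ne p q = ≡.cong
      (λ b → if b then inside (σ (part u)) p q else joined (part u) (part v) p q) (dec-false (part u Fin.≟ part v) ne)

    straight-sym : ∀ p q → straight G p q ≈ straight G q p
    straight-sym (x , y) (x′ , y′) = *-cong (G-sym x x′) (G-sym y y′)

    crossed-sym : ∀ p q → crossed G p q ≈ crossed G q p
    crossed-sym (x , y) (x′ , y′) = trans (*-comm _ _) (*-cong (G-sym y x′) (G-sym x y′))

    inside-sym : ∀ c p q → inside c p q ≈ inside c q p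
    inside-sym c p q = if-cong c (crossed-sym p q) (straight-sym p q)

    joined-sym : ∀ i j p q → joined i j p q ≈ joined j i q p
    joined-sym i j p q = trans (if-cong (does (adj? F i j)) (straight-sym p q) refl)
      (reflexive (≡.cong (λ b → if b then straight G q p else 1#)
        (does-⇔ (mk⇔ (adj-sym F) (adj-sym F)) (adj? F i j) (adj? F j i))))

    mixed-sym : ∀ σ u v p q → mixed σ u v p q ≈ mixed σ v u q p
    mixed-sym σ u v p q = byPart (part u Fin.≟ part v)
      where
      byPart : Dec (part u ≡ part v) → mixed σ u v p q ≈ mixed σ v u q p
      byPart (yes e) = trans (reflexive (mixed-≡ {σ} {u} {v} e p q))
        (trans (inside-sym (σ (part u)) p q)
        (reflexive (≡.trans (≡.cong (λ i → inside (σ i) q p) e) (≡.sym (mixed-≡ {σ} {v} {u} (≡.sym e) q p)))))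
      byPart (no ne) = trans (reflexive (mixed-≢ {σ} {u} {v} ne p q))
        (trans (joined-sym (part u) (part v) p q)
        (reflexive (≡.sym (mixed-≢ {σ} {v} {u} (ne ∘ ≡.sym) q p))))

    mixed-nonNegative : ∀ σ u v p q → 0# ≤ mixed σ u v p q
    mixed-nonNegative σ u v (x , y) (x′ , y′) = if-≥0 (does (part u Fin.≟ part v))
      (if-≥0 (σ (part u)) G*G≥0 G*G≥0) (if-≥0 (does (adj? F (part u) (part v))) G*G≥0 0≤1)
      where
      G*G≥0 : ∀ {a b c d} → 0# ≤ G a b * G c d
      G*G≥0 = *-nonNegative (<⇒≤ (G>0 _ _)) (<⇒≤ (G>0 _ _))

    add : Vertex F → (Vertex F → Bool) → Vertex F → Bool
    add i σ j = does (i Fin.≟ j) ∨ σ j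

    module _ (i : Vertex F) (σ : Vertex F → Bool) where

      mixed-add : ∀ {v} → part v ≢ i → ∀ u p q → mixed σ v u p q ≡ mixed (add i σ) v u p q
      mixed-add {v} ne u p q = ≡.cong (λ b → if does (part v Fin.≟ part u) then inside (b ∨ σ (part v)) p q else joined (part v) (part u) p q)
        (≡.sym (dec-false (i Fin.≟ part v) (ne ∘ ≡.sym)))

      -- The invariant required by `clique-crossing`: all vertices of part i share one weight, which
      -- splits as a product over the two spins.
      ProductOn : Weight (∑² {suc n}) U → (f g : Vector R (suc n)) → Set
      ProductOn w f g = ∀ u → part u ≡ i → ∀ x y → w u (x , y) ≈ f x * g y

      cross-clique : ∀ {zs} → All (λ u → part u ≡ i) zs → ∀ {w f g} → (∀ x → 0# < f x) → (∀ x → 0# < g x) →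
                     ProductOn w f g → Z ∑² (mixed σ) zs w ≤ Z ∑² (mixed (add i σ)) zs w
      cross-clique {zs} all≡ {w} {f} {g} f>0 g>0 w≈ = begin
        Z ∑² (mixed σ) zs w
          ≈⟨ Z-cong weights (All⇒AllPairs (λ e e′ p q → reflexive (≡.trans (mixed-≡ {σ} (≡.trans e (≡.sym e′)) p q)
               (≡.cong (λ j → inside (σ j) p q) e))) all≡) ⟩
        Z ∑² (λ _ _ → inside (σ i)) zs ((λ _ → f) ⊠ʷ (λ _ → g))
          ≤⟨ cross (σ i) ⟩
        Z ∑² (λ _ _ → crossed G) zs ((λ _ → f) ⊠ʷ (λ _ → g))
          ≈⟨ Z-cong weights (All⇒AllPairs (λ e e′ p q → reflexive (≡.trans (mixed-≡ {add i σ} (≡.trans e (≡.sym e′)) p q)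
               (≡.trans (≡.cong (λ j → inside (add i σ j) p q) e)
               (≡.cong (λ b → inside (b ∨ σ i) p q) (dec-true (i Fin.≟ i) ≡.refl))))) all≡) ⟨
        Z ∑² (mixed (add i σ)) zs w ∎
        where
        weights : All (λ u → ∀ p → w u p ≈ ((λ _ → f) ⊠ʷ (λ _ → g)) u p) zs
        weights = All.map (λ e (x , y) → w≈ _ e x y) all≡
        cross : ∀ c → Z ∑² (λ _ _ → inside c) zs ((λ (_ : U) → f) ⊠ʷ (λ _ → g)) ≤
                      Z ∑² (λ _ _ → crossed G) zs ((λ _ → f) ⊠ʷ (λ _ → g))
        cross true = ≤-refl
        cross false = clique-crossing G-sym G>0 G-rcs zs f>0 g>0

      -- The vertices `ys` outside part i are summed first, which fixes their spins. Such a vertex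
      -- interacts with all of part i in the same way, through a straight factor or not at all, so
      -- `ProductOn` persists with new positive f and g, and only the clique remains to be crossed.
      cross-part : ∀ {ys zs} → All (λ u → part u ≢ i) ys → All (λ u → part u ≡ i) zs →
                   ∀ {w f g} → (∀ u p → 0# ≤ w u p) → (∀ x → 0# < f x) → (∀ x → 0# < g x) →
                   ProductOn w f g → Z ∑² (mixed σ) (ys ++ zs) w ≤ Z ∑² (mixed (add i σ)) (ys ++ zs) w
      cross-part [] all≡ w≥0 f>0 g>0 w≈ = cross-clique all≡ f>0 g>0 w≈
      cross-part {v ∷ ys} {zs} (v≢ ∷ all≢) all≡ {w} {f} {g} w≥0 f>0 g>0 w≈ = begin
        ∑² (λ p → w v p * Z ∑² (mixed σ) (ys ++ zs) (tilt ∑² (mixed σ) w v p))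
          ≤⟨ Sum-mono (λ p → *-monoˡ-≤ (w≥0 v p) (cross-part all≢ all≡
               (λ u q → *-nonNegative (w≥0 u q) (mixed-nonNegative σ v u p q))
               (tilted>0 (does (adj? F (part v) i)) (proj₁ p) f>0) (tilted>0 (does (adj? F (part v) i)) (proj₂ p) g>0)
               (tilted-product p))) ⟩
        ∑² (λ p → w v p * Z ∑² (mixed (add i σ)) (ys ++ zs) (tilt ∑² (mixed σ) w v p))
          ≈⟨ Sum-cong (λ p → *-congˡ {w v p} (Z-congʷ (mixed (add i σ)) (ys ++ zs) (λ u q →
               *-congˡ {w u q} (reflexive (mixed-add v≢ u p q))))) ⟩
        ∑² (λ p → w v p * Z ∑² (mixed (add i σ)) (ys ++ zs) (tilt ∑² (mixed (add i σ)) w v p)) ∎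
        where
        tilted : Bool → Fin (suc n) → Vector R (suc n) → Vector R (suc n)
        tilted b a h s = if b then h s * G a s else h s
        tilted>0 : ∀ b a {h} → (∀ x → 0# < h x) → ∀ x → 0# < tilted b a h x
        tilted>0 true a h>0 x = *-positive (h>0 x) (G>0 a x)
        tilted>0 false a h>0 x = h>0 x
        tilted-* : ∀ b a c x y → f x * g y * (if b then straight G (a , c) (x , y) else 1#) ≈
                   tilted b a f x * tilted b c g y
        tilted-* true a c x y = solve 4 (λ f g α β → f :* g :* (α :* β) := f :* α :* (g :* β)) refl (f x) (g y) (G a x) (G c y)
        tilted-* false a c x y = *-identityʳ _
        tilted-product : ∀ p → ProductOn (tilt ∑² (mixed σ) w v p)
          (tilted (does (adj? F (part v) i)) (proj₁ p) f) (tilted (does (adj? F (part v) i)) (proj₂ p) g)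
        tilted-product (a , c) u e x y = trans
          (*-cong (w≈ u e x y) (reflexive (≡.trans
            (mixed-≢ {σ} {v} {u} (λ e′ → v≢ (≡.trans e′ e)) (a , c) (x , y))
            (≡.cong (λ j → joined (part v) j (a , c) (x , y)) e))))
          (tilted-* (does (adj? F (part v) i)) a c x y)

      cross-one : ∀ us → Z ∑² (mixed σ) us (λ _ _ → 1#) ≤ Z ∑² (mixed (add i σ)) us (λ _ _ → 1#)
      cross-one us =
        let ys , zs , perm , all≢ , all≡ = separate (λ u → part u Fin.≟ i) us in
        ≤-resp (sym (Z-↭ (mixed σ) (mixed-sym σ) perm (λ _ _ → 1#)))
               (sym (Z-↭ (mixed (add i σ)) (mixed-sym (add i σ)) perm (λ _ _ → 1#)))
               (cross-part all≢ all≡ (λ _ _ → 0≤1) (λ _ → 0<1) (λ _ → 0<1) (λ _ _ _ _ → sym (*-identityˡ 1#)))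

    member : List (Vertex F) → Vertex F → Bool
    member [] j = false
    member (i ∷ is) = add i (member is)

    member-∈ : ∀ {j is} → j ∈ is → member is j ≡ true
    member-∈ {j} {i ∷ is} (here ≡.refl) = ≡.cong (_∨ member is j) (dec-true (j Fin.≟ j) ≡.refl)
    member-∈ {j} {i ∷ is} (there p) with does (i Fin.≟ j)
    ... | true = ≡.refl
    ... | false = member-∈ p

    cross-many : ∀ is us → Z ∑² (mixed (λ _ → false)) us (λ _ _ → 1#) ≤ Z ∑² (mixed (member is)) us (λ _ _ → 1#)
    cross-many [] us = ≤-refl
    cross-many (i ∷ is) us = ≤-trans (cross-many is us) (cross-one i (member is) us)

    cross-all : ∀ us → Z ∑² (mixed (λ _ → false)) us (λ _ _ → 1#) ≤ Z ∑² (mixed (λ _ → true)) us (λ _ _ → 1#)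
    cross-all us = ≤-respʳ (Z-cong (All.universal (λ _ _ → refl) us) (AllPairs-universal (λ u v p q → reflexive
        (≡.cong (λ b → if does (part u Fin.≟ part v) then inside b p q else joined (part u) (part v) p q)
          (member-∈ (∈-allFin (part u))))) us))
      (cross-many (allFin (order F)) us)

  module _ (F H : Graph) (bipartite : Bipartite F) (part : Vertex H → Vertex F)
    (adj-inside : ∀ u v → u ≢ v → part u ≡ part v → Adj H u v)
    (adj-across : ∀ u v → Adj F (part u) (part v) → Adj H u v)
    (adj-cases  : ∀ u v → Adj H u v → part u ≡ part v ⊎ Adj F (part u) (part v)) where

    private
      side : Vertex F → Bool
      side = proj₁ bipartite

    module _ {n} {G : Matrix (suc n)} (G-sym : SymmetricMatrix G)
      (G>0 : ∀ i j → 0# < G i j) (G-rcs : ReverseCauchySchwarz G) where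
      open Crossing G-sym G>0 G-rcs F part
      open PartitionFunction (∑²-isSum (suc n)) {Vertex H}

      flip : Bool → V² → V²
      flip b p = if b then swap p else p

      ∑²-flip : ∀ b f → ∑² (λ p → f (flip b p)) ≈ ∑² f
      ∑²-flip true f = ∑-comm (λ x y → f (y , x))
      ∑²-flip false f = refl

      edge-yes : ∀ {u v} {x : R} → Adj H u v → x ≈ (if does (adj? H u v) then x else 1#)
      edge-yes {u} {v} {x} a = reflexive (≡.cong (λ b → if b then x else 1#) (≡.sym (dec-true (adj? H u v) a)))

      edge-no : ∀ {u v} {x : R} → ¬ Adj H u v → 1# ≈ (if does (adj? H u v) then x else 1#)
      edge-no {u} {v} {x} ¬a = reflexive (≡.cong (λ b → if b then x else 1#) (≡.sym (dec-false (adj? H u v) ¬a)))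

      mixed≈ : ∀ c u v p q {x} → u ≢ v →
               (part u ≡ part v → inside c p q ≈ x) →
               (Adj F (part u) (part v) → straight G p q ≈ x) →
               mixed (λ _ → c) u v p q ≈ (if does (adj? H u v) then x else 1#)
      mixed≈ c u v p q {x} u≢v same across = byPart (part u Fin.≟ part v)
        where
        byPart : Dec (part u ≡ part v) → mixed (λ _ → c) u v p q ≈ (if does (adj? H u v) then x else 1#)
        byPart (yes e) = trans (reflexive (mixed-≡ {λ _ → c} e p q)) (trans (same e) (edge-yes (adj-inside u v u≢v e)))
        byPart (no ne) = trans (reflexive (mixed-≢ {λ _ → c} ne p q)) (byAdj (adj? F (part u) (part v)))
          where
          byAdj : Dec (Adj F (part u) (part v)) → joined (part u) (part v) p q ≈ (if does (adj? H u v) then x else 1#)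
          byAdj (yes a) = trans (reflexive (≡.cong (λ b → if b then straight G p q else 1#) (dec-true (adj? F (part u) (part v)) a)))
            (trans (across a) (edge-yes (adj-across u v a)))
          byAdj (no ¬a) = trans (reflexive (≡.cong (λ b → if b then straight G p q else 1#) (dec-false (adj? F (part u) (part v)) ¬a)))
            (edge-no λ a → neither (adj-cases u v a))
            where
            neither : part u ≡ part v ⊎ Adj F (part u) (part v) → _
            neither (inj₁ e) = ⊥-elim (ne e)
            neither (inj₂ a) = ⊥-elim (¬a a)

      flip-inside : ∀ b p q → crossed G p q ≈ crossed G (flip b p) (flip b q)
      flip-inside true (x , y) (x′ , y′) = *-comm _ _
      flip-inside false p q = refl

      flip-across : ∀ b b′ p q → b ≢ b′ → straight G p q ≈ crossed G (flip b p) (flip b′ q)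
      flip-across true true p q b≢b′ = ⊥-elim (b≢b′ ≡.refl)
      flip-across true false (x , y) (x′ , y′) _ = *-comm _ _
      flip-across false true (x , y) (x′ , y′) _ = refl
      flip-across false false p q b≢b′ = ⊥-elim (b≢b′ ≡.refl)

      -- Exchanging the two spins on one side of F turns the straight factors
      -- between different parts into crossed ones, and fixes those inside a part.
      straight≤crossed⁺ : Z ∑² (straightEdge H G) (allFin (order H)) (λ _ _ → 1#) ≤
                          Z ∑² (crossedEdge H G) (allFin (order H)) (λ _ _ → 1#)
      straight≤crossed⁺ = begin
        Z ∑² (straightEdge H G) us (λ _ _ → 1#)
          ≈⟨ Z-cong {mixed (λ _ → false)} trivial (AllPairs.map (λ {u} {v} u≢v p q →
               mixed≈ false u v p q u≢v (λ _ → refl) (λ _ → refl)) unique) ⟨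
        Z ∑² (mixed (λ _ → false)) us (λ _ _ → 1#)
          ≤⟨ cross-all us ⟩
        Z ∑² (mixed (λ _ → true)) us (λ _ _ → 1#)
          ≈⟨ Z-cong {mixed (λ _ → true)} trivial (AllPairs.map (λ {u} {v} u≢v p q → mixed≈ true u v p q u≢v
               (λ e → trans (flip-inside (side (part u)) p q)
                 (reflexive (≡.cong (λ i → crossed G (τ u p) (flip (side i) q)) e)))
               (λ a → flip-across (side (part u)) (side (part v)) p q (proj₂ bipartite _ _ a))) unique) ⟩
        Z ∑² (λ u v p q → crossedEdge H G u v (τ u p) (τ v q)) us (λ _ _ → 1#)
          ≈⟨ Z-respin (∑²-isSum (suc n)) (crossedEdge H G) τ (λ u → ∑²-flip (side (part u))) us (λ _ _ → 1#) ⟩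
        Z ∑² (crossedEdge H G) us (λ _ _ → 1#) ∎
        where
        us = allFin (order H)
        unique = allFin⁺ (order H)
        τ : Vertex H → V² → V²
        τ u = flip (side (part u))
        trivial : All (λ u → ∀ p → 1# ≈ 1#) us
        trivial = All.universal (λ _ _ → refl) us

    straight≤crossed : ∀ {m} {G : Matrix m} → SymmetricMatrix G → (∀ i j → 0# < G i j) → ReverseCauchySchwarz G →
                       Z ∑² (straightEdge H G) (allFin (order H)) (λ _ _ → 1#) ≤
                       Z ∑² (crossedEdge H G) (allFin (order H)) (λ _ _ → 1#)
    -- The Perron-Frobenius argument needs at least one spin. Without spins both sides are 1 on the
    -- empty list and the empty sum otherwise.
    straight≤crossed {zero} {G} _ _ _ = spinless (allFin (order H))
      where
      spinless : ∀ us → Z ∑² (straightEdge H G) us (λ _ _ → 1#) ≤ Z ∑² (crossedEdge H G) us (λ _ _ → 1#)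
      spinless [] = ≤-refl
      spinless (_ ∷ _) = ≤-refl
    straight≤crossed {suc n} = straight≤crossed⁺

    hom²≤hom-⊗K₂-positive : ∀ (G : WeightedGraph ℝ) → (∀ i j → 0# < WeightedGraph.weight G i j) →
                       ReverseCauchySchwarz (WeightedGraph.weight G) →
                       hom ℝ H G * hom ℝ H G ≤ hom ℝ (H ⊗ K 2) G
    hom²≤hom-⊗K₂-positive G G>0 G-rcs = ≤-resp (sym (hom²≈Z H G)) (sym (hom-⊗K₂≈Z H G))
      (straight≤crossed (WeightedGraph.symm G) G>0 G-rcs)

  module _ {F H : Graph} (blowUp : IsBlowUp Complete F H) where
    open IsBlowUp blowUp

    private
      label : Vertex H → ∃ λ i → Vertex (parts i)
      label u = proj₁ (Bijection.strictlySurjective vertices u)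

      to-label : ∀ u → Bijection.to vertices (label u) ≡ u
      to-label u = proj₂ (Bijection.strictlySurjective vertices u)

      adj⇔ : ∀ u v → (BlowUpAdj F parts (label u) (label v) → Adj H u v) ×
                     (Adj H u v → BlowUpAdj F parts (label u) (label v))
      adj⇔ u v = (λ b → ≡.subst₂ (Adj H) (to-label u) (to-label v) (Equivalence.to (edges _ _) b)) ,
                 (λ a → Equivalence.from (edges _ _) (≡.subst₂ (Adj H) (≡.sym (to-label u)) (≡.sym (to-label v)) a))

    blowUp-part : Vertex H → Vertex F
    blowUp-part u = proj₁ (label u)

    blowUp-inside : ∀ u v → u ≢ v → blowUp-part u ≡ blowUp-part v → Adj H u v
    blowUp-inside u v u≢v e = proj₁ (adj⇔ u v) (within′ (label u) (label v) e
      (λ eq → u≢v (≡.trans (≡.sym (to-label u)) (≡.trans (≡.cong (Bijection.to vertices) eq) (to-label v)))))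
      where
      within′ : ∀ x y → proj₁ x ≡ proj₁ y → x ≢ y → BlowUpAdj F parts x y
      within′ (i , a) (.i , b) ≡.refl x≢y = within (parts∈𝓗 i a b (λ a≡b → x≢y (≡.cong (i ,_) a≡b)))

    blowUp-across : ∀ u v → Adj F (blowUp-part u) (blowUp-part v) → Adj H u v
    blowUp-across u v a = proj₁ (adj⇔ u v) (between a)

    blowUp-cases : ∀ u v → Adj H u v → blowUp-part u ≡ blowUp-part v ⊎ Adj F (blowUp-part u) (blowUp-part v)
    blowUp-cases u v a = cases (proj₂ (adj⇔ u v) a)
      where
      cases : ∀ {x y} → BlowUpAdj F parts x y → proj₁ x ≡ proj₁ y ⊎ Adj F (proj₁ x) (proj₁ y)
      cases (within _) = inj₁ ≡.refl
      cases (between a) = inj₂ a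

-- Reduction to positive weights by a limit.

module Perturbation (ℝ : CompleteOrderedField) where

  open OrderedField ℝ
  open QuadraticForm ℝ
  open Spectrum ℝ
  open BlowUps ℝ
  open ≤-Reasoning

  -- a₀ ≤ a ε ≤ a₀ + O(ε) as ε ↓ 0.
  record _↘_ (a : R → R) (a₀ : R) : Set where
    field
      limit≥0 : 0# ≤ a₀
      rate    : R
      rate≥0  : 0# ≤ rate
      lower   : ∀ {ε} → 0# ≤ ε → ε ≤ 1# → a₀ ≤ a ε
      upper   : ∀ {ε} → 0# ≤ ε → ε ≤ 1# → a ε ≤ a₀ + rate * ε

  open _↘_

  ↘-const : ∀ {c} → 0# ≤ c → (λ _ → c) ↘ c
  ↘-const {c} 0≤c = record
    { limit≥0 = 0≤c ; rate = 0# ; rate≥0 = ≤-refl ; lower = λ _ _ → ≤-refl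
    ; upper = λ _ _ → O.reflexive (sym (trans (+-congˡ (zeroˡ _)) (+-identityʳ c))) }

  ↘-id : (λ ε → ε) ↘ 0#
  ↘-id = record
    { limit≥0 = ≤-refl ; rate = 1# ; rate≥0 = 0≤1 ; lower = λ 0≤ε _ → 0≤ε
    ; upper = λ _ _ → O.reflexive (sym (trans (+-identityˡ _) (*-identityˡ _))) }

  ↘-resp : ∀ {a a₀ b₀} → a₀ ≈ b₀ → a ↘ a₀ → a ↘ b₀
  ↘-resp e a↘ = record
    { limit≥0 = ≤-respʳ e (limit≥0 a↘) ; rate = rate a↘ ; rate≥0 = rate≥0 a↘
    ; lower = λ p q → ≤-respˡ e (lower a↘ p q) ; upper = λ p q → ≤-respʳ (+-congʳ e) (upper a↘ p q) }

  ↘-+ : ∀ {a a₀ b b₀} → a ↘ a₀ → b ↘ b₀ → (λ ε → a ε + b ε) ↘ (a₀ + b₀)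
  ↘-+ {a₀ = a₀} {b₀ = b₀} a↘ b↘ = record
    { limit≥0 = +-nonNegative (limit≥0 a↘) (limit≥0 b↘)
    ; rate = rate a↘ + rate b↘
    ; rate≥0 = +-nonNegative (rate≥0 a↘) (rate≥0 b↘)
    ; lower = λ p q → +-mono-≤ (lower a↘ p q) (lower b↘ p q)
    ; upper = λ {ε} p q → ≤-respʳ
        (solve 5 (λ a b C D ε → (a :+ C :* ε) :+ (b :+ D :* ε) := (a :+ b) :+ (C :+ D) :* ε) refl a₀ b₀ (rate a↘) (rate b↘) ε)
        (+-mono-≤ (upper a↘ p q) (upper b↘ p q)) }

  ↘-* : ∀ {a a₀ b b₀} → a ↘ a₀ → b ↘ b₀ → (λ ε → a ε * b ε) ↘ (a₀ * b₀)
  ↘-* {a} {a₀} {b} {b₀} a↘ b↘ = record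
    { limit≥0 = *-nonNegative (limit≥0 a↘) (limit≥0 b↘)
    -- The term C D comes from the ε² of the product, bounded by ε because ε ≤ 1.
    ; rate = C * b₀ + a₀ * D + C * D
    ; rate≥0 = +-nonNegative (+-nonNegative (*-nonNegative (rate≥0 a↘) (limit≥0 b↘))
        (*-nonNegative (limit≥0 a↘) (rate≥0 b↘))) (*-nonNegative (rate≥0 a↘) (rate≥0 b↘))
    ; lower = λ p q → *-mono-≤ (limit≥0 a↘) (limit≥0 b↘) (lower a↘ p q) (lower b↘ p q)
    ; upper = λ {ε} p q → begin
        a ε * b ε
          ≤⟨ *-mono-≤ (≤-trans (limit≥0 a↘) (lower a↘ p q)) (≤-trans (limit≥0 b↘) (lower b↘ p q)) (upper a↘ p q) (upper b↘ p q) ⟩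
        (a₀ + C * ε) * (b₀ + D * ε)
          ≈⟨ solve 5 (λ a b C D ε → (a :+ C :* ε) :* (b :+ D :* ε) :=
               C :* D :* (ε :* ε) :+ (a :* b :+ (C :* b :+ a :* D) :* ε)) refl a₀ b₀ C D ε ⟩
        C * D * (ε * ε) + (a₀ * b₀ + (C * b₀ + a₀ * D) * ε)
          ≤⟨ +-monoˡ-≤ _ (*-monoˡ-≤ (*-nonNegative (rate≥0 a↘) (rate≥0 b↘)) (≤-respʳ (*-identityˡ ε) (*-monoʳ-≤ p q))) ⟩
        C * D * ε + (a₀ * b₀ + (C * b₀ + a₀ * D) * ε)
          ≈⟨ solve 5 (λ a b C D ε → C :* D :* ε :+ (a :* b :+ (C :* b :+ a :* D) :* ε) :=
               a :* b :+ (C :* b :+ a :* D :+ C :* D) :* ε) refl a₀ b₀ C D ε ⟩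
        a₀ * b₀ + (C * b₀ + a₀ * D + C * D) * ε ∎ }
    where
    C D : R
    C = rate a↘
    D = rate b↘

  ↘-if : ∀ c {a a₀ b b₀} → a ↘ a₀ → b ↘ b₀ → (λ ε → if c then a ε else b ε) ↘ (if c then a₀ else b₀)
  ↘-if true a↘ _ = a↘
  ↘-if false _ b↘ = b↘

  ↘-∑ : ∀ {n} {a : Fin n → R → R} {a₀} → (∀ i → a i ↘ a₀ i) → (λ ε → ∑ (λ i → a i ε)) ↘ ∑ a₀
  ↘-∑ {zero} p = ↘-const ≤-refl
  ↘-∑ {suc n} p = ↘-+ (p zero) (↘-∑ (λ i → p (suc i)))

  ↘-∏ : ∀ {n} {a : Fin n → R → R} {a₀} → (∀ i → a i ↘ a₀ i) → (λ ε → ∏ (λ i → a i ε)) ↘ ∏ a₀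
  ↘-∏ {zero} p = ↘-const 0≤1
  ↘-∏ {suc n} p = ↘-* (p zero) (↘-∏ (λ i → p (suc i)))

  ≤-limit : ∀ {A B C} → 0# ≤ C → (∀ {ε} → 0# < ε → ε ≤ 1# → A ≤ B + C * ε) → A ≤ B
  ≤-limit {A} {B} {C} 0≤C approx = ≮⇒≥ contradict
    where
    contradict : ¬ (B < A)
    contradict B<A@(B≤A , B≉A) = <⇒≱ (*-positive 0<d (+-positive 0<1 (<⇒≤ 0<d))) (begin
      d * (1# + d)                ≈⟨ solve 3 (λ d e C → d :* (e :+ d) := d :* (e :+ d :+ C) :- C :* d) refl d 1# C ⟩
      d * M - C * d               ≤⟨ +-monoˡ-≤ (- (C * d)) (*-monoʳ-≤ (<⇒≤ 0<M) d≤Cε) ⟩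
      C * (d * M⁻¹) * M - C * d   ≈⟨ +-congʳ (solve 4 (λ C d k k′ → C :* (d :* k′) :* k := C :* d :* (k :* k′)) refl C d M M⁻¹) ⟩
      C * d * (M * M⁻¹) - C * d   ≈⟨ +-congʳ (trans (*-congˡ MM⁻¹≈1) (*-identityʳ _)) ⟩
      C * d - C * d               ≈⟨ -‿inverseʳ _ ⟩
      0#                          ∎)
      where
      -- The inequality is tested at ε = d / M. This M gives ε ≤ 1, and d ≤ C ε would mean d M ≤ C
      -- d, that is d (1 + d) ≤ 0.
      d M : R
      d = A - B
      M = 1# + d + C
      0<d : 0# < d
      0<d = y≤x⇒x-y≥0 B≤A , λ e → B≉A (begin-equality
        B          ≈⟨ +-identityˡ B ⟨
        0# + B     ≈⟨ +-congʳ e ⟩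
        A - B + B  ≈⟨ solve 2 (λ A B → A :- B :+ B := A) refl A B ⟩
        A          ∎)
      0<M : 0# < M
      0<M = +-positive (+-positive 0<1 (<⇒≤ 0<d)) 0≤C
      M⁻¹ = proj₁ (inverse⁺ 0<M)
      0<M⁻¹ = proj₁ (proj₂ (inverse⁺ 0<M))
      MM⁻¹≈1 = proj₂ (proj₂ (inverse⁺ 0<M))
      d≤M : d ≤ M
      d≤M = ≤-by _ (+-nonNegative 0≤1 0≤C) (solve 3 (λ e d C → e :+ C := e :+ d :+ C :- d) refl 1# d C)
      d≤Cε : d ≤ C * (d * M⁻¹)
      d≤Cε = ≤-by _ (y≤x⇒x-y≥0 (approx (*-positive 0<d 0<M⁻¹) (≤-respʳ MM⁻¹≈1 (*-monoʳ-≤ (<⇒≤ 0<M⁻¹) d≤M))))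
        (solve 3 (λ A B X → B :+ X :- A := X :- (A :- B)) refl A B (C * (d * M⁻¹)))

  record Approximation {n} (W : Matrix n) : Set where
    field
      W⟨_⟩      : R → Matrix n
      symmetric : ∀ {ε} → SymmetricMatrix W⟨ ε ⟩
      positive  : ∀ {ε} → 0# < ε → ∀ i j → 0# < W⟨ ε ⟩ i j
      rcs       : ∀ {ε} → 0# < ε → ReverseCauchySchwarz W⟨ ε ⟩
      converges : ∀ i j → (λ ε → W⟨ ε ⟩ i j) ↘ W i j

  module _ {n} {W : Matrix n} (W-sym : SymmetricMatrix W) (W≥0 : ∀ i j → 0# ≤ W i j)
           (W-rcs : ReverseCauchySchwarz W) where

    private
      one d : Vector R n
      one _ = 1#
      d = W ⊙ one
      s : R
      s = q W one

      entry≥0 : ∀ i j → 0# ≤ W i j * 1#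
      entry≥0 i j = *-nonNegative (W≥0 i j) 0≤1
      d≥0 : ∀ i → 0# ≤ d i
      d≥0 i = ∑-nonNegative (entry≥0 i)
      s≥0 : 0# ≤ s
      s≥0 = ∑-nonNegative (λ i → *-nonNegative 0≤1 (d≥0 i))

      -- The matrix (I + ε J) W (I + ε J), with J the all-ones matrix.
      spread : R → Matrix n
      spread ε i j = 1# * (1# * W i j + ε * (1# * (d ⊗ᵛ one) i j + 1# * (one ⊗ᵛ d) i j)) + ε * ε * s * (one ⊗ᵛ one) i j

      shift : R → Vector R n → Vector R n
      shift ε f = lin 1# f (ε * ⟪ one , f ⟫) one

      -- I + εJ acts on vectors as `shift`, so reverse Cauchy-Schwarz for `spread ε` is the one for
      -- `W` at shifted vectors. Both sides are expanded to the same polynomial in ε.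
      form-spread : ∀ ε f u → form (spread ε) f u ≈ form W (shift ε f) (shift ε u)
      form-spread ε f u = trans lhs (sym rhs)
        where
        α = ⟪ one , f ⟫
        β = ⟪ one , u ⟫
        lhs : form (spread ε) f u ≈ 1# * (1# * form W f u + ε * (1# * (⟪ d , f ⟫ * β) + 1# * (α * ⟪ d , u ⟫))) + ε * ε * s * (α * β)
        lhs = trans (form-linᴹ 1# _ (ε * ε * s) (one ⊗ᵛ one) f u) (+-cong
          (*-congˡ (trans (form-linᴹ 1# W ε _ f u) (+-congˡ (*-congˡ
            (trans (form-linᴹ 1# (d ⊗ᵛ one) 1# (one ⊗ᵛ d) f u)
              (+-cong (*-congˡ (form-⊗ᵛ d one f u)) (*-congˡ (form-⊗ᵛ one d f u))))))))
          (*-congˡ (form-⊗ᵛ one one f u)))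
        form-oneʳ : ∀ x → form W x one ≈ ⟪ d , x ⟫
        form-oneʳ x = ⟪⟫-comm x d
        rhs : form W (shift ε f) (shift ε u) ≈ 1# * (1# * form W f u + ε * (1# * (⟪ d , f ⟫ * β) + 1# * (α * ⟪ d , u ⟫))) + ε * ε * s * (α * β)
        rhs = begin-equality
          form W (shift ε f) (shift ε u)
            ≈⟨ form-linʳ W (shift ε f) 1# u (ε * β) one ⟩
          1# * form W (shift ε f) u + (ε * β) * form W (shift ε f) one
            ≈⟨ +-cong (*-congˡ (⟪⟫-linˡ (W ⊙ u) 1# f (ε * α) one)) (*-congˡ (⟪⟫-linˡ d 1# f (ε * α) one)) ⟩
          1# * (1# * form W f u + (ε * α) * form W one u) + (ε * β) * (1# * ⟪ f , d ⟫ + (ε * α) * s)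
            ≈⟨ +-cong (*-congˡ (+-congˡ (*-congˡ (trans (form-sym W-sym one u) (form-oneʳ u)))))
                 (*-congˡ (+-congʳ (*-congˡ (form-oneʳ f)))) ⟩
          1# * (1# * form W f u + (ε * α) * ⟪ d , u ⟫) + (ε * β) * (1# * ⟪ d , f ⟫ + (ε * α) * s)
            ≈⟨ +-cong (trans (*-identityˡ _) (+-congʳ (*-identityˡ _))) (*-congˡ (+-congʳ (*-identityˡ _))) ⟩
          (form W f u + (ε * α) * ⟪ d , u ⟫) + (ε * β) * (⟪ d , f ⟫ + (ε * α) * s)
            ≈⟨ solve 7 (λ F ε α β df du s → (F :+ (ε :* α) :* du) :+ (ε :* β) :* (df :+ (ε :* α) :* s) :=
                 (F :+ ε :* (df :* β :+ α :* du)) :+ ε :* ε :* s :* (α :* β)) refl (form W f u) ε α β ⟪ d , f ⟫ ⟪ d , u ⟫ s ⟩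
          (form W f u + ε * (⟪ d , f ⟫ * β + α * ⟪ d , u ⟫)) + ε * ε * s * (α * β)
            ≈⟨ +-congʳ (sym (trans (*-identityˡ _) (+-cong (*-identityˡ _) (*-congˡ (+-cong (*-identityˡ _) (*-identityˡ _)))))) ⟩
          1# * (1# * form W f u + ε * (1# * (⟪ d , f ⟫ * β) + 1# * (α * ⟪ d , u ⟫))) + ε * ε * s * (α * β) ∎

      -- Every entry gains ε² s, where s is the sum of all entries of W; this makes them positive
      -- when W is nonzero.
      spread-approximation : 0# < s → Approximation W
      spread-approximation 0<s = record
        { W⟨_⟩ = spread
        ; symmetric = λ {ε} i j → +-congʳ (*-congˡ (+-cong (*-congˡ (W-sym i j)) (*-congˡ (trans (+-comm _ _)
            (+-cong (*-congˡ (*-comm 1# (d j))) (*-congˡ (*-comm (d i) 1#)))))))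
        ; positive = λ {ε} 0<ε i j → <-respʳ (+-comm _ _) (+-positive
            (<-respʳ (sym (trans (*-congˡ (*-identityˡ 1#)) (*-identityʳ _))) (*-positive (*-positive 0<ε 0<ε) 0<s))
            (*-nonNegative 0≤1 (+-nonNegative (*-nonNegative 0≤1 (W≥0 i j)) (*-nonNegative (<⇒≤ 0<ε)
              (+-nonNegative (*-nonNegative 0≤1 (*-nonNegative (d≥0 i) 0≤1)) (*-nonNegative 0≤1 (*-nonNegative 0≤1 (d≥0 j))))))))
        ; rcs = λ {ε} _ f u 0≤p → ≤-resp
            (sym (*-cong (form-spread ε f f) (form-spread ε u u))) (sym (*-cong (form-spread ε f u) (form-spread ε f u)))
            (W-rcs (shift ε f) (shift ε u) (≤-respʳ (form-spread ε f f) 0≤p))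
        ; converges = λ i j → ↘-resp (base i j) (↘-+ (↘-* (↘-const 0≤1) (↘-+ (↘-* (↘-const 0≤1) (↘-const (W≥0 i j)))
            (↘-* ↘-id (↘-const (+-nonNegative (*-nonNegative 0≤1 (*-nonNegative (d≥0 i) 0≤1)) (*-nonNegative 0≤1 (*-nonNegative 0≤1 (d≥0 j))))))))
            (↘-* (↘-* (↘-* ↘-id ↘-id) (↘-const s≥0)) (↘-const (*-nonNegative 0≤1 0≤1))))
        }
        where
        base : ∀ i j → 1# * (1# * W i j + 0# * (1# * (d ⊗ᵛ one) i j + 1# * (one ⊗ᵛ d) i j)) + 0# * 0# * s * (1# * 1#) ≈ W i j
        base i j = trans (+-cong (trans (*-identityˡ _) (trans (+-cong (*-identityˡ _) (zeroˡ _)) (+-identityʳ _)))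
          (trans (*-congʳ (trans (*-congʳ (zeroˡ 0#)) (zeroˡ s))) (zeroˡ _))) (+-identityʳ _)

      -- Here W = 0, and any congruence of it vanishes too, so εJ is taken instead. It has rank one
      -- and is zero on the vectors of sum zero.
      constant-approximation : s ≈ 0# → Approximation W
      constant-approximation s≈0 = record
        { W⟨_⟩ = λ ε → (λ _ → ε) ⊗ᵛ one
        ; symmetric = λ _ _ → refl
        ; positive = λ 0<ε i j → *-positive 0<ε 0<1
        ; rcs = λ {ε} _ → nonPositive-on-hyperplane⇒RCS (λ _ _ → refl) one (λ z one⊥z →
            O.reflexive (trans (form-⊗ᵛ (λ _ → ε) one z z) (trans (*-congˡ one⊥z) (zeroʳ _))))
        ; converges = λ i j → ↘-resp (trans (zeroˡ 1#) (sym (W≈0 i j))) (↘-* ↘-id (↘-const 0≤1))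
        }
        where
        W≈0 : ∀ i j → W i j ≈ 0#
        W≈0 i j = trans (sym (*-identityʳ _)) (∑≈0⇒≈0 (entry≥0 i) (trans (sym (*-identityˡ (d i)))
          (∑≈0⇒≈0 (λ i → *-nonNegative 0≤1 (d≥0 i)) s≈0 i)) j)

    approximation : Approximation W
    approximation = cases (s ≟ 0#)
      where
      cases : Dec (s ≈ 0#) → Approximation W
      cases (yes s≈0) = constant-approximation s≈0
      cases (no s≉0) = spread-approximation (s≥0 , λ e → s≉0 (sym e))

  module _ (G : WeightedGraph ℝ) (G-anti : Antiferromagnetic ℝ G) where
    open WeightedGraph G renaming (order to n; weight to W; symm to W-sym)

    -- The perturbation only increases weights, so the left side passes to `G⟨ ε ⟩` without error;
    -- the right side returns with an error linear in ε, which `≤-limit` removes.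
    hom²≤hom-⊗K₂ : ∀ F H → Bipartite F → IsBlowUp Complete F H → hom ℝ H G * hom ℝ H G ≤ hom ℝ (H ⊗ K 2) G
    hom²≤hom-⊗K₂ F H bipartite blowUp = ≤-limit (rate≥0 (hom-converges (H ⊗ K 2))) λ {ε} 0<ε ε≤1 → begin
      hom ℝ H G * hom ℝ H G
        ≤⟨ lower (↘-* (hom-converges H) (hom-converges H)) (<⇒≤ 0<ε) ε≤1 ⟩
      hom ℝ H (G⟨ ε ⟩ 0<ε) * hom ℝ H (G⟨ ε ⟩ 0<ε)
        ≤⟨ hom²≤hom-⊗K₂-positive F H bipartite (blowUp-part blowUp) (blowUp-inside blowUp) (blowUp-across blowUp) (blowUp-cases blowUp)
             (G⟨ ε ⟩ 0<ε) (positive 0<ε) (rcs 0<ε) ⟩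
      hom ℝ (H ⊗ K 2) (G⟨ ε ⟩ 0<ε)
        ≤⟨ upper (hom-converges (H ⊗ K 2)) (<⇒≤ 0<ε) ε≤1 ⟩
      hom ℝ (H ⊗ K 2) G + rate (hom-converges (H ⊗ K 2)) * ε ∎
      where
      open Approximation (approximation W-sym nonNeg (antiferromagnetic⇒RCS G G-anti))
      G⟨_⟩ : ∀ ε → 0# < ε → WeightedGraph ℝ
      G⟨ ε ⟩ 0<ε = record { order = n ; weight = W⟨ ε ⟩ ; symm = symmetric ; nonNeg = λ i j → <⇒≤ (positive 0<ε i j) }
      -- `G⟨ ε ⟩` takes a proof of 0 < ε, so its homomorphism count is written out here as a
      -- function of ε alone.
      hom-converges : ∀ L → (λ ε → ∑ {n ℕ.^ order L} (λ k → ∏ (λ u → ∏ (λ v →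
        if does (u Fin.<? v ×-dec adj? L u v) then W⟨ ε ⟩ (finToFun {n} {order L} k u) (finToFun {n} {order L} k v) else 1#)))) ↘ hom ℝ L G
      hom-converges L = ↘-∑ (λ k → ↘-∏ (λ u → ↘-∏ (λ v →
        ↘-if (does (u Fin.<? v ×-dec adj? L u v)) (converges (finToFun {n} {order L} k u) (finToFun {n} {order L} k v)) (↘-const 0≤1))))

theorem1p6 : (ℝ : CompleteOrderedField) (let open CompleteOrderedField ℝ)
    (G : WeightedGraph ℝ) → Antiferromagnetic ℝ G →
    (F H : Graph) → Bipartite F → IsBlowUp Complete F H →
    hom ℝ H G * hom ℝ H G ≤ hom ℝ (H ⊗ K 2) G
theorem1p6 ℝ G G-anti = Perturbation.hom²≤hom-⊗K₂ ℝ G G-anti
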